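{- Let $a,b,c$ be non-negative integers with $a\le b$. Then the number of lozenge tilings of the region $S_{a,b,c}$ is \[ M(S_{a,b,c})=\frac{(c+a+2)_{b-a}\,(2c+b+3)_{a-1}\,\big[(2b-a+2)c+(b+1)(b+2)\big]}{(a+2)_{b-a+1}\,(b+3)_{a-1}}\prod_{i=1}^{a}\frac{(c+i)_{b-a+1}\,(2c+b-a+1+i)_{i-1}}{(i)_{b-a+1}\,(b-a+1+i)_{i-1}} . \] Moreover, for every non-negative integers $b,c$, $M(S_{b+1,b,c})=M(S_{b,b,c})$.
   Context: Work in the triangular lattice of unit equilateral triangles whose lattice lines are the horizontal lines $y=kh$ ($k\in\mathbb Z$, $h=\sqrt3/2$) and the lines at $60^\circ$ and $120^\circ$ to them; the lattice points are $(i+k/2,\,kh)$ for $i,k\in\mathbb Z$. A region is a finite union of unit triangles; a lozenge is the union of two unit triangles sharing an edge; a lozenge tiling of a region is a covering of it by non-overlapping lozenges. $M(R)$ denotes the number of lozenge tilings of $R$. Pochhammer symbol: for $k\in\mathbb Z$, $(\alpha)_k=\alpha(\alpha+1)\cdots(\alpha+k-1)$ if $k>0$, $(\alpha)_0=1$, and $(\alpha)_k=1/\big((\alpha-1)(\alpha-2)\cdots(\alpha+k)\big)$ if $k<0$. Empty products equal $1$. The region $S_{a,b,c}$ (for non-negative integers $a,b,c$ with $a\le b+1$): let $H$ be the lattice hexagon with vertices $B=(0,0)$, $C=(c+1,0)$, $D=(c+1+b/2,\,bh)$, $E=(c+(b-a)/2,\,(a+b+2)h)$, $F=((b-a)/2,\,(a+b+2)h)$,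 $A=(-(a+1)/2,\,(a+1)h)$; its sides have lengths $|BC|=c+1$ (south), $|CD|=b$ (southeast), $|DE|=a+2$ (northeast), $|EF|=c$ (north), $|FA|=b+1$ (northwest), $|AB|=a+1$ (southwest). Let $Z$ be the zigzag lattice path starting at $B$ consisting of $2a+1$ unit steps alternating between $(-1/2,h)$ and $(1/2,h)$, starting and ending with $(-1/2,h)$; it ends at $(-1/2,(2a+1)h)$, a point of side $FA$. Remove from $H$ the part lying west of $Z$ (the "maximal staircase"), i.e. keep the region bounded by $B\to C\to D\to E\to F$, then along side $FA$ from $F$ down to $(-1/2,(2a+1)h)$, then back along $Z$ to $B$. Finally remove the upward-pointing unit triangle with vertices $(c+(b-1)/2,(b+1)h)$, $(c+(b+1)/2,(b+1)h)$, $(c+b/2,(b+2)h)$ (the unit triangle having an edge on the northeast side $DE$, second from the east corner $D$). The resulting region is $S_{a,b,c}$. -}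

module Defs where

open import Data.Bool using (Bool; true; false; _∧_; if_then_else_)
open import Data.Nat using (ℕ; zero; suc)
import Data.Nat as ℕ
open import Data.Integer as ℤ using (ℤ; +_; -[1+_])
open import Data.Rational as ℚ using (ℚ; 0ℚ; 1ℚ)
open import Data.Rational.Properties as ℚP using ()
open import Data.List using (List; []; _∷_; _++_; map; concatMap; upTo)
open import Data.Product using (_×_; _,_)
open import Relation.Nullary using (yes; no; does)
open import Relation.Binary.PropositionalEquality using (_≡_)

-- Triangular lattice.
-- The lattice point (i + k/2 , k h) is given lattice coordinates (i , k).
-- The up-pointing unit triangle  up(i,k)  has vertices (i,k),(i+1,k),(i,k+1);
-- the down-pointing unit triangle dn(i,k) has vertices (i+1,k),(i,k+1),(i+1,k+1).
-- Every unit triangle is exactly one of these.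

data Orient : Set where
  up dn : Orient

record Tri : Set where
  constructor tri
  field
    orient : Orient
    col    : ℤ
    row    : ℤ

_≟O_ : Orient → Orient → Bool
up ≟O up = true
dn ≟O dn = true
_  ≟O _  = false

_==ℤ_ : ℤ → ℤ → Bool
x ==ℤ y = does (x ℤ.≟ y)

_==T_ : Tri → Tri → Bool
tri o i k ==T tri o' i' k' = (o ≟O o') ∧ ((i ==ℤ i') ∧ (k ==ℤ k'))

-- A region (finite union of unit triangles) is given by the duplicate-free
-- list of its unit triangles.
Region : Set
Region = List Tri

_∈ᵇ_ : Tri → Region → Bool
t ∈ᵇ [] = false
t ∈ᵇ (s ∷ R) = if t ==T s then true else t ∈ᵇ R

-- A lozenge is the union of two unit triangles sharing an edge; every such
-- pair consists of an up triangle up(i,k) and one of its three neighbours: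
--   dn(i,k)   (common edge (i+1,k)-(i,k+1)),
--   dn(i-1,k) (common edge (i,k)-(i,k+1)),
--   dn(i,k-1) (common edge (i,k)-(i+1,k)).
data Dir : Set where
  d₀ d₁ d₂ : Dir

record Lozenge : Set where
  constructor loz
  field
    upCol : ℤ
    upRow : ℤ
    dir   : Dir

partner : ℤ → ℤ → Dir → Tri
partner i k d₀ = tri dn i k
partner i k d₁ = tri dn (i ℤ.- + 1) k
partner i k d₂ = tri dn i (k ℤ.- + 1)

covers : Lozenge → Tri → Bool
covers (loz i k d) t = (t ==T tri up i k) Data.Bool.∨ (t ==T partner i k d)
  where import Data.Bool

lozengesIn : Region → List Lozenge
lozengesIn R = concatMap f R
  where
  f : Tri → List Lozenge
  f (tri dn _ _) = []
  f (tri up i k) = keep d₀ (keep d₁ (keep d₂ []))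
    where
    keep : Dir → List Lozenge → List Lozenge
    keep d ls = if partner i k d ∈ᵇ R then loz i k d ∷ ls else ls

sublists : {A : Set} → List A → List (List A)
sublists [] = [] ∷ []
sublists (x ∷ xs) = sublists xs ++ map (x ∷_) (sublists xs)

count : {A : Set} → (A → Bool) → List A → ℕ
count p [] = 0
count p (x ∷ xs) = if p x then suc (count p xs) else count p xs

_==ℕ_ : ℕ → ℕ → Bool
m ==ℕ n = does (m ℕ.≟ n)

all : {A : Set} → (A → Bool) → List A → Bool
all p [] = true
all p (x ∷ xs) = p x ∧ all p xs

isTiling : Region → List Lozenge → Bool
isTiling R S = all (λ t → count (λ l → covers l t) S ==ℕ 1) R

M : Region → ℕ
M R = count (isTiling R) (sublists (lozengesIn R))

-- The region S_{a,b,c}.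
-- In lattice coordinates the hexagon H is
--   0 ≤ k ≤ a+b+2 ,  -(a+1) ≤ i ≤ c+1 ,  0 ≤ i+k ≤ b+c+1
-- (B=(0,0), C=(c+1,0), D=(c+1,b), E=(c-a-1,a+b+2), F=(-a-1,a+b+2), A=(-a-1,a+1)).
-- The zigzag Z visits (0,0),(-1,1),(-1,2),(-2,3),...,(-j,2j),(-j-1,2j+1),...,(-a-1,2a+1).
-- In row strip k (between heights k and k+1), k ≤ 2a, the triangles east of Z
-- are exactly: up(i,k) with 2i+k ≥ -1 and dn(i,k) with 2i+k ≥ -2.
-- For k ≥ 2a+1 nothing beyond H is removed.
-- Finally the unit triangle up(c-1,b+1) is removed.

private
  z : ℕ → ℤ
  z = +_

  infix 4 _≤ᵇ_
  infixl 6 _+ᶻ_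
  _≤ᵇ_ = ℤ._≤ᵇ_
  _+ᶻ_ = ℤ._+_

inH : ℕ → ℕ → ℕ → ℤ → ℤ → Bool
inH a b c i k =
  (z 0 ≤ᵇ k) ∧ (k ≤ᵇ z (a ℕ.+ b ℕ.+ 2)) ∧
  (ℤ.- z (suc a) ≤ᵇ i) ∧ (i ≤ᵇ z (suc c)) ∧
  (z 0 ≤ᵇ (i +ᶻ k)) ∧ ((i +ᶻ k) ≤ᵇ z (b ℕ.+ c ℕ.+ 1))

-- the unit triangle lies in H iff its three vertices do (H is convex)
triInH : ℕ → ℕ → ℕ → Tri → Bool
triInH a b c (tri up i k) =
  inH a b c i k ∧ inH a b c (i +ᶻ z 1) k ∧ inH a b c i (k +ᶻ z 1)
triInH a b c (tri dn i k) =
  inH a b c (i +ᶻ z 1) k ∧ inH a b c i (k +ᶻ z 1) ∧ inH a b c (i +ᶻ z 1) (k +ᶻ z 1)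

eastOfZ : ℕ → Tri → Bool
eastOfZ a (tri up i k) = if k ≤ᵇ z (2 ℕ.* a) then ℤ.- z 1 ≤ᵇ (z 2 ℤ.* i +ᶻ k) else true
eastOfZ a (tri dn i k) = if k ≤ᵇ z (2 ℕ.* a) then ℤ.- z 2 ≤ᵇ (z 2 ℤ.* i +ᶻ k) else true

removedTri : ℕ → ℕ → Tri
removedTri b c = tri up (z c ℤ.- z 1) (z (suc b))

inS : ℕ → ℕ → ℕ → Tri → Bool
inS a b c t = triInH a b c t ∧ eastOfZ a t ∧ Data.Bool.not (t ==T removedTri b c)
  where import Data.Bool

box : ℕ → ℕ → ℕ → List Tri
box a b c = concatMap (λ k → concatMap (λ j →
              let i = z j ℤ.- z (suc a) in tri up i (z k) ∷ tri dn i (z k) ∷ [])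
              (upTo (a ℕ.+ c ℕ.+ 3)))
            (upTo (a ℕ.+ b ℕ.+ 3))

filterᵇ : {A : Set} → (A → Bool) → List A → List A
filterᵇ p [] = []
filterᵇ p (x ∷ xs) = if p x then x ∷ filterᵇ p xs else filterᵇ p xs

-- S_{a,b,c} (meaningful for a ≤ b+1)
S : ℕ → ℕ → ℕ → Region
S a b c = filterᵇ (inS a b c) (box a b c)

-- total inverse (0 ↦ 0); only ever applied to nonzero arguments below
inv : ℚ → ℚ
inv q with q ℚP.≟ 0ℚ
... | yes _ = 0ℚ
... | no q≢0 = ℚ.1/_ q {{ℚ.≢-nonZero q≢0}}

fromℤ : ℤ → ℚ
fromℤ i = i ℚ./ 1

fromℕ : ℕ → ℚ
fromℕ n = fromℤ (+ n)

prodℕ : ℕ → (ℕ → ℚ) → ℚ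
prodℕ zero f = 1ℚ
prodℕ (suc n) f = prodℕ n f ℚ.* f n

poch : ℚ → ℤ → ℚ
poch α (+ n)     = prodℕ n (λ j → α ℚ.+ fromℕ j)
poch α -[1+ n ]  = inv (prodℕ (suc n) (λ j → α ℚ.- fromℕ (suc j)))

formula : ℕ → ℕ → ℕ → ℚ
formula a b c =
  ((poch (q (c + a + 2)) (+ b ℤ.- + a)
     ℚ.* poch (q (2 * c + b + 3)) (+ a ℤ.- + 1)
     ℚ.* fromℤ ((+ (2 * b) ℤ.- + a ℤ.+ + 2) ℤ.* + c ℤ.+ + ((b + 1) * (b + 2))))
   ℚ.* inv (poch (q (a + 2)) (+ b ℤ.- + a ℤ.+ + 1) ℚ.* poch (q (b + 3)) (+ a ℤ.- + 1)))
  ℚ.* prodℕ a (λ j → let i = suc j in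
        (poch (q (c + i)) (+ b ℤ.- + a ℤ.+ + 1) ℚ.* poch (fromℤ (+ (2 * c + b + 1 + i) ℤ.- + a)) (+ i ℤ.- + 1))
        ℚ.* inv (poch (q i) (+ b ℤ.- + a ℤ.+ + 1) ℚ.* poch (fromℤ (+ (b + 1 + i) ℤ.- + a)) (+ i ℤ.- + 1)))
  where
  open Data.Nat using (_+_; _*_)
  q = fromℕ

{-# OPTIONS --safe #-}
module Submission where

-- Following the lozenges that do not cross horizontal lattice lines, a tiling of S_{a,b,c} is a family
-- of c + 1 non-intersecting paths which start at the bottom side and move by half a unit to the left or
-- to the right in each row, the zigzag acting as a wall; c of them end at the top side and the rightmost
-- one at the base of the removed triangle.  We measure columns by their distance B = c - i from the
-- right; on line k put A = k + 2(c + 1) - B.  A path at B on one line comes from B or B - 1 on the line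
-- below, so on functions of (A , B) the transfer operator is F(A , B - 1) + F(A - 1 , B), and its
-- eigenfunctions (A - B) / ((A - j)! (B - j)!) vanish on the wall A = B.  Hence the number of path
-- families ending at given positions on line k is, up to an explicit constant, the determinant of these
-- eigenfunctions, which is a Vandermonde determinant in the variables AB.
--
-- Continue the rightmost path to position B = 1 of the top line.  The families obtained in excess are
-- those in which it is still at B = 0 on the line of the removed triangle's base; it then moves to B = 1
-- in one of the a + 1 rows above, where it meets no other path.  So, with X the block of the c top
-- positions and N the number of unrestricted families, M(S_{a,b,c}) = N(1 ∷ X) - (a + 1) N(0 ∷ X), and
-- the two products combine to the linear factor (2b - a + 2) c + (b + 1)(b + 2).  For a = b + 1 the
-- block X touches the wall, which forces the last step of every path.

open import Defs
open import Data.Bool using (Bool; true; false; if_then_else_; _∧_; _∨_; not; T)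
import Data.Bool.Properties as BoolP
open import Data.Empty using (⊥; ⊥-elim)
open import Data.Integer as ℤ using (ℤ; +_)
import Data.Integer.Properties as ℤP
import Data.Integer.Solver as ℤS
open import Data.List using (List; []; _∷_; _++_; _∷ʳ_; _ʳ++_; map; concatMap; upTo; length; reverse)
open import Data.List.Membership.Propositional using (_∈_; lose)
import Data.List.Membership.Propositional.Properties as ∈P
import Data.List.Properties as ListP
open import Data.List.Relation.Unary.All as All using (All; []; _∷_)
import Data.List.Relation.Unary.All.Properties as AllP
open import Data.List.Relation.Unary.Any using (here; there)
open import Data.Nat as ℕ using (ℕ; zero; suc; _≤_; _<_; z≤n; s≤s)
open import Data.Nat.ListAction using (sum)
import Data.Nat.Properties as ℕP
import Data.Nat.Solver as ℕS
open import Data.Product using (Σ; ∃; ∃₂; _×_; _,_; proj₁; proj₂)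
open import Data.Rational as ℚ using (ℚ; 0ℚ; 1ℚ; toℚᵘ)
import Data.Rational.Properties as ℚP
import Data.Rational.Solver as ℚS
import Data.Rational.Unnormalised as ℚᵘ
import Data.Rational.Unnormalised.Properties as ℚᵘP
open import Data.Sum using (_⊎_; inj₁; inj₂)
open import Data.Unit using (⊤; tt)
open import Function using (_∘_)
open import Relation.Binary.PropositionalEquality using (_≡_; _≢_; refl; sym; trans; cong; cong₂; subst; subst₂; module ≡-Reasoning)
open import Relation.Nullary using (yes; no; contradiction; ¬_)
open import Relation.Nullary.Decidable using (dec-false; dec-true)

-- No bijection between tilings and path families is built. `M` counts sublists of the list of
-- lozenges, and this count is unfolded from the end of that list: rows from the top, columns from
-- the right. Deciding the lozenge of each up triangle in this order leaves as data only the down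
-- triangles still to be covered, and after a row these are the path positions on the line below. So
-- the count obeys the recursion `strictSum`, and the work is to see that the determinant obeys it
-- too. The recursion wants distinct positions east of the wall, whereas the transfer operator moves
-- every path independently; the two agree because the determinant vanishes on equal adjacent
-- positions and on wall positions.
--
-- The offset 2(c + 1) in A makes position c + 1 of the bottom line, the first one beyond the
-- starting points, satisfy A = B; from there the wall runs vertically, as the zigzag does.

module Paths where

  open import Data.Rational using (_+_; _*_; _-_; -_)
  open ℚS.+-*-Solver using (solve; _:+_; _:*_; _:-_; :-_; _:=_; con)

  -- Integers and naturals inside the rationals.

  fromℤ-+ : ∀ i j → fromℤ (i ℤ.+ j) ≡ fromℤ i + fromℤ j
  fromℤ-+ i j = ℚP.toℚᵘ-injective (begin-equality
      toℚᵘ (fromℤ (i ℤ.+ j))                   ≃⟨ ℚP.toℚᵘ-fromℚᵘ (ℚᵘ.mkℚᵘ (i ℤ.+ j) 0) ⟩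
      ℚᵘ.mkℚᵘ (i ℤ.+ j) 0                      ≃⟨ ℚᵘ.*≡* (cong (ℤ._* + 1) (cong₂ ℤ._+_ (sym (ℤP.*-identityʳ i)) (sym (ℤP.*-identityʳ j)))) ⟩
      ℚᵘ.mkℚᵘ i 0 ℚᵘ.+ ℚᵘ.mkℚᵘ j 0             ≃⟨ ℚᵘP.+-cong (ℚP.toℚᵘ-fromℚᵘ (ℚᵘ.mkℚᵘ i 0)) (ℚP.toℚᵘ-fromℚᵘ (ℚᵘ.mkℚᵘ j 0)) ⟨
      toℚᵘ (fromℤ i) ℚᵘ.+ toℚᵘ (fromℤ j)       ≃⟨ ℚP.toℚᵘ-homo-+ (fromℤ i) (fromℤ j) ⟨
      toℚᵘ (fromℤ i + fromℤ j)                 ∎)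
    where open ℚᵘP.≤-Reasoning

  fromℤ-* : ∀ i j → fromℤ (i ℤ.* j) ≡ fromℤ i * fromℤ j
  fromℤ-* i j = ℚP.toℚᵘ-injective (begin-equality
      toℚᵘ (fromℤ (i ℤ.* j))                   ≃⟨ ℚP.toℚᵘ-fromℚᵘ (ℚᵘ.mkℚᵘ (i ℤ.* j) 0) ⟩
      ℚᵘ.mkℚᵘ i 0 ℚᵘ.* ℚᵘ.mkℚᵘ j 0             ≃⟨ ℚᵘP.*-cong (ℚP.toℚᵘ-fromℚᵘ (ℚᵘ.mkℚᵘ i 0)) (ℚP.toℚᵘ-fromℚᵘ (ℚᵘ.mkℚᵘ j 0)) ⟨
      toℚᵘ (fromℤ i) ℚᵘ.* toℚᵘ (fromℤ j)       ≃⟨ ℚP.toℚᵘ-homo-* (fromℤ i) (fromℤ j) ⟨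
      toℚᵘ (fromℤ i * fromℤ j)                 ∎)
    where open ℚᵘP.≤-Reasoning

  fromℕ-+ : ∀ m n → fromℕ (m ℕ.+ n) ≡ fromℕ m + fromℕ n
  fromℕ-+ m n = fromℤ-+ (+ m) (+ n)

  fromℕ-* : ∀ m n → fromℕ (m ℕ.* n) ≡ fromℕ m * fromℕ n
  fromℕ-* m n = trans (cong fromℤ (ℤP.pos-* m n)) (fromℤ-* (+ m) (+ n))

  fromℕ-suc : ∀ n → fromℕ (suc n) ≡ 1ℚ + fromℕ n
  fromℕ-suc n = fromℕ-+ 1 n

  fromℕ-∸ : ∀ {m n} → n ℕ.≤ m → fromℕ (m ℕ.∸ n) ≡ fromℕ m - fromℕ n
  fromℕ-∸ {m} {n} n≤m = begin
      fromℕ (m ℕ.∸ n)                       ≡⟨ solve 2 (λ x y → x := (x :+ y) :- y) refl (fromℕ (m ℕ.∸ n)) (fromℕ n) ⟩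
      fromℕ (m ℕ.∸ n) + fromℕ n - fromℕ n   ≡⟨ cong (_- fromℕ n) (sym (fromℕ-+ (m ℕ.∸ n) n)) ⟩
      fromℕ (m ℕ.∸ n ℕ.+ n) - fromℕ n       ≡⟨ cong (λ x → fromℕ x - fromℕ n) (ℕP.m∸n+n≡m n≤m) ⟩
      fromℕ m - fromℕ n                     ∎
    where open ≡-Reasoning

  private variable
    P C C₁ : Set

  -- Determinants as iterated contractions of an exterior product of columns.

  contract : (C → ℚ) → List C → (List C → ℚ) → ℚ
  contract w []       F = 0ℚ
  contract w (c ∷ cs) F = w c * F cs - contract w cs (F ∘ (c ∷_))

  contract-cong : ∀ {w v : C → ℚ} {F G} cs → (∀ c → w c ≡ v c) → (∀ r → F r ≡ G r) → contract w cs F ≡ contract v cs G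
  contract-cong []       w≗v F≗G = refl
  contract-cong (c ∷ cs) w≗v F≗G = cong₂ _-_ (cong₂ _*_ (w≗v c) (F≗G cs)) (contract-cong cs w≗v (F≗G ∘ (c ∷_)))

  contract-+ : ∀ (w : C → ℚ) cs F G → contract w cs (λ r → F r + G r) ≡ contract w cs F + contract w cs G
  contract-+ w []       F G = refl
  contract-+ w (c ∷ cs) F G = trans
    (cong (_-_ (w c * (F cs + G cs))) (contract-+ w cs (F ∘ (c ∷_)) (G ∘ (c ∷_))))
    (solve 5 (λ w f g x y → w :* (f :+ g) :- (x :+ y) := (w :* f :- x) :+ (w :* g :- y)) refl (w c) (F cs) (G cs) _ _)

  contract-* : ∀ (w : C → ℚ) cs k F → contract w cs (λ r → k * F r) ≡ k * contract w cs F
  contract-* w []       k F = sym (ℚP.*-zeroʳ k)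
  contract-* w (c ∷ cs) k F = trans
    (cong (_-_ (w c * (k * F cs))) (contract-* w cs k (F ∘ (c ∷_))))
    (solve 4 (λ w k f x → w :* (k :* f) :- k :* x := k :* (w :* f :- x)) refl (w c) k (F cs) _)

  contract-zero : ∀ (w : C → ℚ) cs → contract w cs (λ _ → 0ℚ) ≡ 0ℚ
  contract-zero w cs = trans (contract-* w cs 0ℚ (λ _ → 0ℚ)) (ℚP.*-zeroˡ (contract w cs (λ _ → 0ℚ)))

  contract-- : ∀ (w : C → ℚ) cs F G → contract w cs (λ r → F r - G r) ≡ contract w cs F - contract w cs G
  contract-- w cs F G = begin
      contract w cs (λ r → F r - G r)                 ≡⟨ contract-cong cs (λ _ → refl) (λ r → minus (F r) (G r)) ⟩
      contract w cs (λ r → F r + - 1ℚ * G r)          ≡⟨ contract-+ w cs F (λ r → - 1ℚ * G r) ⟩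
      contract w cs F + contract w cs (λ r → - 1ℚ * G r) ≡⟨ cong (λ z → contract w cs F + z) (contract-* w cs (- 1ℚ) G) ⟩
      contract w cs F + - 1ℚ * contract w cs G        ≡⟨ sym (minus (contract w cs F) (contract w cs G)) ⟩
      contract w cs F - contract w cs G               ∎
    where
    open ≡-Reasoning
    minus : ∀ x y → x - y ≡ x + - 1ℚ * y
    minus = solve 2 (λ x y → x :- y := x :+ con (- 1ℚ) :* y) refl

  contract-weight-- : ∀ (w v : C → ℚ) cs F → contract (λ c → w c - v c) cs F ≡ contract w cs F - contract v cs F
  contract-weight-- w v []       F = refl
  contract-weight-- w v (c ∷ cs) F = trans
    (cong (_-_ ((w c - v c) * F cs)) (contract-weight-- w v cs (F ∘ (c ∷_))))
    (solve 5 (λ w v f x y → (w :- v) :* f :- (x :- y) := (w :* f :- x) :- (v :* f :- y)) refl (w c) (v c) (F cs) _ _)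

  contract-weight-+ : ∀ (w v : C → ℚ) cs F → contract (λ c → w c + v c) cs F ≡ contract w cs F + contract v cs F
  contract-weight-+ w v []       F = refl
  contract-weight-+ w v (c ∷ cs) F = trans
    (cong (_-_ ((w c + v c) * F cs)) (contract-weight-+ w v cs (F ∘ (c ∷_))))
    (solve 5 (λ w v f x y → (w :+ v) :* f :- (x :+ y) := (w :* f :- x) :+ (v :* f :- y)) refl (w c) (v c) (F cs) _ _)

  -- Separating the column `c` leaves two terms that are antisymmetric in `w` and `v`, plus a double
  -- contraction on `cs`; anticommutation and the vanishing of a repeated contraction both follow
  -- from this by induction.
  contract-contract : ∀ (w v : C → ℚ) c cs F →
    contract w (c ∷ cs) (λ r → contract v r F) ≡
    w c * contract v cs F - v c * contract w cs F + contract w cs (λ r → contract v r (F ∘ (c ∷_)))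
  contract-contract w v c cs F = trans
    (cong (_-_ (w c * contract v cs F)) (trans (contract-- w cs (λ r → v c * F r) _) (cong (_- rest) (contract-* w cs (v c) F))))
    (solve 3 (λ x y z → x :- (y :- z) := (x :- y) :+ z) refl (w c * contract v cs F) (v c * contract w cs F) rest)
    where rest = contract w cs (λ r → contract v r (F ∘ (c ∷_)))

  contract-anticomm : ∀ (w v : C → ℚ) cs F →
    contract w cs (λ r → contract v r F) ≡ - contract v cs (λ r → contract w r F)
  contract-anticomm w v []       F = refl
  contract-anticomm w v (c ∷ cs) F = begin
      contract w (c ∷ cs) (λ r → contract v r F)     ≡⟨ contract-contract w v c cs F ⟩
      w c * contract v cs F - v c * contract w cs F + contract w cs (λ r → contract v r (F ∘ (c ∷_)))
        ≡⟨ cong (λ z → w c * contract v cs F - v c * contract w cs F + z) (contract-anticomm w v cs (F ∘ (c ∷_))) ⟩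
      w c * contract v cs F - v c * contract w cs F - contract v cs (λ r → contract w r (F ∘ (c ∷_)))
        ≡⟨ solve 3 (λ x y z → x :- y :- z := :- (y :- x :+ z)) refl (w c * contract v cs F) (v c * contract w cs F) _ ⟩
      - (v c * contract w cs F - w c * contract v cs F + contract v cs (λ r → contract w r (F ∘ (c ∷_))))
        ≡⟨ cong -_ (sym (contract-contract v w c cs F)) ⟩
      - contract v (c ∷ cs) (λ r → contract w r F)   ∎
    where open ≡-Reasoning

  contract-twice : ∀ (w : C → ℚ) cs F → contract w cs (λ r → contract w r F) ≡ 0ℚ
  contract-twice w []       F = refl
  contract-twice w (c ∷ cs) F = trans (contract-contract w w c cs F)
    (trans (cong (λ z → w c * contract w cs F - w c * contract w cs F + z) (contract-twice w cs (F ∘ (c ∷_))))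
           (solve 1 (λ x → x :- x :+ con 0ℚ := con 0ℚ) refl (w c * contract w cs F)))

  contract-map : ∀ (g : C₁ → C) (w : C → ℚ) cs F → contract w (map g cs) F ≡ contract (w ∘ g) cs (F ∘ map g)
  contract-map g w []       F = refl
  contract-map g w (c ∷ cs) F = cong (_-_ (w (g c) * F (map g cs))) (contract-map g w cs (F ∘ (g c ∷_)))

  -- Determinants by expansion along the rows.

  det : (P → C → ℚ) → List P → List C → ℚ
  det f []       []      = 1ℚ
  det f []       (_ ∷ _) = 0ℚ
  det f (x ∷ xs) cs      = contract (f x) cs (det f xs)

  det-cong : ∀ {f g : P → C → ℚ} {xs} cs → All (λ x → ∀ c → f x c ≡ g x c) xs → det f xs cs ≡ det g xs cs
  det-cong []      []            = refl
  det-cong (_ ∷ _) []            = refl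
  det-cong cs      (fx≗gx ∷ f≗g) = contract-cong cs fx≗gx (λ r → det-cong r f≗g)

  det-map-columns : ∀ (f : P → C → ℚ) (g : C₁ → C) xs cs → det f xs (map g cs) ≡ det (λ x c → f x (g c)) xs cs
  det-map-columns f g []       []      = refl
  det-map-columns f g []       (_ ∷ _) = refl
  det-map-columns f g (x ∷ xs) cs      = trans (contract-map g (f x) cs (det f xs))
    (contract-cong cs (λ _ → refl) (det-map-columns f g xs))

  det-map-rows : ∀ {P₁ : Set} (f : P → C → ℚ) (g : P₁ → P) xs cs → det f (map g xs) cs ≡ det (f ∘ g) xs cs
  det-map-rows f g []       []      = refl
  det-map-rows f g []       (_ ∷ _) = refl
  det-map-rows f g (x ∷ xs) cs      = contract-cong cs (λ _ → refl) (det-map-rows f g xs)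

  -- Adjacent equal rows suffice: one step keeps the positions weakly ordered, so only neighbouring
  -- paths can collide. The reason is `contract-twice`, applied below the expansion along `rs`.
  det-repeat : ∀ (f : P → C → ℚ) rs x xs cs → det f (rs ++ x ∷ x ∷ xs) cs ≡ 0ℚ
  det-repeat f []       x xs cs = contract-twice (f x) cs (det f xs)
  det-repeat f (r ∷ rs) x xs cs = trans (contract-cong cs (λ _ → refl) (det-repeat f rs x xs)) (contract-zero (f r) cs)

  contract-weight-zero : ∀ {w : C → ℚ} cs F → (∀ c → w c ≡ 0ℚ) → contract w cs F ≡ 0ℚ
  contract-weight-zero []       F w≗0 = refl
  contract-weight-zero {w = w} (c ∷ cs) F w≗0 = trans
    (cong₂ _-_ (trans (cong (_* F cs) (w≗0 c)) (ℚP.*-zeroˡ (F cs))) (contract-weight-zero cs (F ∘ (c ∷_)) w≗0)) refl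

  det-zero-row : ∀ (f : P → C → ℚ) rs x xs cs → (∀ c → f x c ≡ 0ℚ) → det f (rs ++ x ∷ xs) cs ≡ 0ℚ
  det-zero-row f []       x xs cs fx≗0 = contract-weight-zero cs (det f xs) fx≗0
  det-zero-row f (r ∷ rs) x xs cs fx≗0 = trans
    (contract-cong cs (λ _ → refl) (λ c → det-zero-row f rs x xs c fx≗0)) (contract-zero (f r) cs)

  product : (P → ℚ) → List P → ℚ
  product g []       = 1ℚ
  product g (x ∷ xs) = g x * product g xs

  product-cong : ∀ {g h : P → ℚ} xs → (∀ x → g x ≡ h x) → product g xs ≡ product h xs
  product-cong []       g≗h = refl
  product-cong (x ∷ xs) g≗h = cong₂ _*_ (g≗h x) (product-cong xs g≗h)

  product-map : ∀ (g : P → ℚ) (h : C → P) xs → product g (map h xs) ≡ product (g ∘ h) xs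
  product-map g h []       = refl
  product-map g h (x ∷ xs) = cong (g (h x) *_) (product-map g h xs)

  product-* : ∀ (g h : P → ℚ) xs → product (λ x → g x * h x) xs ≡ product g xs * product h xs
  product-* g h []       = refl
  product-* g h (x ∷ xs) = trans (cong (g x * h x *_) (product-* g h xs))
    (solve 4 (λ a b c d → a :* b :* (c :* d) := a :* c :* (b :* d)) refl (g x) (h x) _ _)

  contract-weight-* : ∀ k (w : C → ℚ) cs F → contract (λ c → k * w c) cs F ≡ k * contract w cs F
  contract-weight-* k w []       F = sym (ℚP.*-zeroʳ k)
  contract-weight-* k w (c ∷ cs) F = trans
    (cong (_-_ (k * w c * F cs)) (contract-weight-* k w cs (F ∘ (c ∷_))))
    (solve 4 (λ k w f x → k :* w :* f :- k :* x := k :* (w :* f :- x)) refl k (w c) (F cs) _)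

  det-row-factor : ∀ (g : P → ℚ) (f : P → C → ℚ) xs cs → det (λ x c → g x * f x c) xs cs ≡ product g xs * det f xs cs
  det-row-factor g f []       []      = refl
  det-row-factor g f []       (_ ∷ _) = refl
  det-row-factor g f (x ∷ xs) cs      = begin
      contract (λ c → g x * f x c) cs (det (λ x c → g x * f x c) xs)  ≡⟨ contract-weight-* (g x) (f x) cs _ ⟩
      g x * contract (f x) cs (det (λ x c → g x * f x c) xs)          ≡⟨ cong (g x *_) (contract-cong cs (λ _ → refl) (det-row-factor g f xs)) ⟩
      g x * contract (f x) cs (λ r → product g xs * det f xs r)       ≡⟨ cong (g x *_) (contract-* (f x) cs (product g xs) (det f xs)) ⟩
      g x * (product g xs * contract (f x) cs (det f xs))             ≡⟨ sym (ℚP.*-assoc (g x) _ _) ⟩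
      g x * product g xs * contract (f x) cs (det f xs)               ∎
    where open ≡-Reasoning

  -- Every term of the expansion uses each column exactly once, so column-dependent scalings
  -- contribute the same factor to all terms.
  contract-eigen : ∀ (l w : C → ℚ) cs F →
    contract (λ c → l c * w c) cs (λ r → product l r * F r) ≡ product l cs * contract w cs F
  contract-eigen l w []       F = refl
  contract-eigen l w (c ∷ cs) F = begin
      l c * w c * (product l cs * F cs) - contract (λ c → l c * w c) cs (λ r → l c * product l r * F (c ∷ r))
        ≡⟨ cong (_-_ (l c * w c * (product l cs * F cs))) (begin
             contract (λ c → l c * w c) cs (λ r → l c * product l r * F (c ∷ r))
               ≡⟨ contract-cong cs (λ _ → refl) (λ r → ℚP.*-assoc (l c) (product l r) (F (c ∷ r))) ⟩
             contract (λ c → l c * w c) cs (λ r → l c * (product l r * F (c ∷ r)))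
               ≡⟨ contract-* (λ c → l c * w c) cs (l c) (λ r → product l r * F (c ∷ r)) ⟩
             l c * contract (λ c → l c * w c) cs (λ r → product l r * F (c ∷ r))
               ≡⟨ cong (l c *_) (contract-eigen l w cs (F ∘ (c ∷_))) ⟩
             l c * (product l cs * contract w cs (F ∘ (c ∷_))) ∎) ⟩
      l c * w c * (product l cs * F cs) - l c * (product l cs * contract w cs (F ∘ (c ∷_)))
        ≡⟨ solve 5 (λ l w p f x → l :* w :* (p :* f) :- l :* (p :* x) := l :* p :* (w :* f :- x)) refl (l c) (w c) (product l cs) (F cs) _ ⟩
      l c * product l cs * (w c * F cs - contract w cs (F ∘ (c ∷_))) ∎
    where open ≡-Reasoning

  -- Column elimination and Vandermonde determinants.

  -- The determinant with an additional first column of ones.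
  det₁ : (P → C → ℚ) → List P → List C → ℚ
  det₁ f []       cs = 0ℚ
  det₁ f (x ∷ xs) cs = det f xs cs - contract (f x) cs (det₁ f xs)

  det₁-correct : ∀ (f : P → C → ℚ) c₀ → (∀ x → f x c₀ ≡ 1ℚ) → ∀ xs cs → det f xs (c₀ ∷ cs) ≡ det₁ f xs cs
  det₁-correct f c₀ one []       cs = refl
  det₁-correct f c₀ one (x ∷ xs) cs = cong₂ _-_
    (trans (cong (_* det f xs cs) (one x)) (ℚP.*-identityˡ (det f xs cs)))
    (contract-cong cs (λ _ → refl) (det₁-correct f c₀ one xs))

  -- Multilinear expansion in the rows: a term taking `α` from two rows vanishes by
  -- `contract-twice`, and the terms taking it from one row sum, up to sign, to `α` contracted
  -- against the determinant with a column of ones.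
  det-column-shift : ∀ (f : P → C → ℚ) (α : C → ℚ) xs cs →
    det (λ x c → f x c - α c) xs cs ≡ det f xs cs - contract α cs (det₁ f xs)
  det-column-shift f α []       []       = refl
  det-column-shift f α []       (c ∷ cs) = sym (cong (λ z → 0ℚ - z) (contract-zero α (c ∷ cs)))
  det-column-shift f α (x ∷ xs) cs       = begin
      contract (λ c → f x c - α c) cs (det (λ x c → f x c - α c) xs)
        ≡⟨ contract-cong cs (λ _ → refl) (det-column-shift f α xs) ⟩
      contract (λ c → f x c - α c) cs (λ r → det f xs r - contract α r (det₁ f xs))
        ≡⟨ contract-weight-- (f x) α cs _ ⟩
      contract (f x) cs (λ r → det f xs r - contract α r (det₁ f xs)) - contract α cs (λ r → det f xs r - contract α r (det₁ f xs))
        ≡⟨ cong₂ _-_ (contract-- (f x) cs (det f xs) _) (contract-- α cs (det f xs) _) ⟩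
      (contract (f x) cs (det f xs) - contract (f x) cs (λ r → contract α r (det₁ f xs)))
        - (contract α cs (det f xs) - contract α cs (λ r → contract α r (det₁ f xs)))
        ≡⟨ cong₂ (λ y z → (contract (f x) cs (det f xs) - y) - (contract α cs (det f xs) - z))
             (contract-anticomm (f x) α cs (det₁ f xs)) (contract-twice α cs (det₁ f xs)) ⟩
      (contract (f x) cs (det f xs) - - contract α cs (λ r → contract (f x) r (det₁ f xs))) - (contract α cs (det f xs) - 0ℚ)
        ≡⟨ solve 3 (λ p q r → (p :- :- q) :- (r :- con 0ℚ) := p :- (r :- q)) refl (contract (f x) cs (det f xs)) _ (contract α cs (det f xs)) ⟩
      contract (f x) cs (det f xs) - (contract α cs (det f xs) - contract α cs (λ r → contract (f x) r (det₁ f xs)))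
        ≡⟨ cong (_-_ (contract (f x) cs (det f xs))) (sym (contract-- α cs (det f xs) _)) ⟩
      contract (f x) cs (det f xs) - contract α cs (det₁ f (x ∷ xs)) ∎
    where open ≡-Reasoning

  -- Subtracting the row of `x` from all the others clears the column of ones; `det-column-shift`
  -- performs all these subtractions at once.
  det-eliminate : ∀ (f : P → C → ℚ) c₀ → (∀ x → f x c₀ ≡ 1ℚ) → ∀ x xs cs →
    det f (x ∷ xs) (c₀ ∷ cs) ≡ det (λ y c → f y c - f x c) xs cs
  det-eliminate f c₀ one x xs cs = trans (det₁-correct f c₀ one (x ∷ xs) cs) (sym (det-column-shift f (f x) xs cs))

  -- Monic j f says that f is a monic polynomial function of degree j, by
  -- recursion on divided differences.
  Monic : ℕ → (ℚ → ℚ) → Set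
  Monic zero    f = ∀ u → f u ≡ 1ℚ
  Monic (suc j) f = ∀ x → Σ (ℚ → ℚ) λ g → Monic j g × (∀ u → f u - f x ≡ (u - x) * g u)

  monic-perturb : ∀ j {f g} β → Monic (suc j) f → Monic j g → Monic (suc j) (λ u → f u + β * g u)
  monic-perturb zero    {f} {g} β f-monic g-monic x with f-monic x
  ... | f′ , f′-monic , eq = f′ , f′-monic , λ u → begin
      f u + β * g u - (f x + β * g x)   ≡⟨ cong₂ (λ p q → f u + β * p - (f x + β * q)) (g-monic u) (g-monic x) ⟩
      f u + β * 1ℚ - (f x + β * 1ℚ)     ≡⟨ solve 3 (λ p q r → p :+ r :- (q :+ r) := p :- q) refl (f u) (f x) (β * 1ℚ) ⟩
      f u - f x                         ≡⟨ eq u ⟩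
      (u - x) * f′ u                    ∎
    where open ≡-Reasoning
  monic-perturb (suc j) {f} {g} β f-monic g-monic x with f-monic x | g-monic x
  ... | f′ , f′-monic , eq | g′ , g′-monic , eq′ = _ , monic-perturb j {f′} {g′} β f′-monic g′-monic , λ u → begin
      f u + β * g u - (f x + β * g x)         ≡⟨ solve 5 (λ p q r s b → p :+ b :* r :- (q :+ b :* s) := (p :- q) :+ b :* (r :- s)) refl (f u) (f x) (g u) (g x) β ⟩
      (f u - f x) + β * (g u - g x)           ≡⟨ cong₂ (λ p q → p + β * q) (eq u) (eq′ u) ⟩
      (u - x) * f′ u + β * ((u - x) * g′ u)   ≡⟨ solve 4 (λ d p q b → d :* p :+ b :* (d :* q) := d :* (p :+ b :* q)) refl (u - x) (f′ u) (g′ u) β ⟩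
      (u - x) * (f′ u + β * g′ u)             ∎
    where open ≡-Reasoning

  monic-* : ∀ j {f} κ → Monic j f → Monic (suc j) (λ u → (u - κ) * f u)
  monic-* zero {f} κ f-monic x = f , f-monic , λ u → begin
      (u - κ) * f u - (x - κ) * f x   ≡⟨ cong (λ z → (u - κ) * f u - (x - κ) * z) (trans (f-monic x) (sym (f-monic u))) ⟩
      (u - κ) * f u - (x - κ) * f u   ≡⟨ solve 4 (λ u x k f → (u :- k) :* f :- (x :- k) :* f := (u :- x) :* f) refl u x κ (f u) ⟩
      (u - x) * f u                   ∎
    where open ≡-Reasoning
  monic-* (suc j) {f} κ f-monic x with f-monic x
  ... | g , g-monic , eq = _ , monic-perturb j {f} {g} (x - κ) f-monic g-monic , λ u → begin
      (u - κ) * f u - (x - κ) * f x                   ≡⟨ solve 5 (λ u x k f h → (u :- k) :* f :- (x :- k) :* h := (u :- x) :* f :+ (x :- k) :* (f :- h)) refl u x κ (f u) (f x) ⟩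
      (u - x) * f u + (x - κ) * (f u - f x)           ≡⟨ cong (λ z → (u - x) * f u + (x - κ) * z) (eq u) ⟩
      (u - x) * f u + (x - κ) * ((u - x) * g u)       ≡⟨ solve 4 (λ d p q b → d :* p :+ b :* (d :* q) := d :* (p :+ b :* q)) refl (u - x) (f u) (g u) (x - κ) ⟩
      (u - x) * (f u + (x - κ) * g u)                 ∎
    where open ≡-Reasoning

  vandermonde : List ℚ → ℚ
  vandermonde []       = 1ℚ
  vandermonde (x ∷ xs) = product (_- x) xs * vandermonde xs

  range : ℕ → ℕ → List ℕ
  range lo zero    = []
  range lo (suc n) = lo ∷ range (suc lo) n

  length-range : ∀ lo n → length (range lo n) ≡ n
  length-range lo zero    = refl
  length-range lo (suc n) = cong suc (length-range (suc lo) n)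

  map-suc-range : ∀ lo n → map suc (range lo n) ≡ range (suc lo) n
  map-suc-range lo zero    = refl
  map-suc-range lo (suc n) = cong (suc lo ∷_) (map-suc-range (suc lo) n)

  -- Column 0 consists of ones, so eliminating the row of `x` leaves `f (suc j) u - f (suc j) x`,
  -- which is `u - x` times a monic function of degree `j`. The factors `u - x` are the first
  -- product of the Vandermonde, and the divided differences form a family of the same kind for the
  -- other nodes.
  det-vandermonde : ∀ (f : ℕ → ℚ → ℚ) → (∀ j → Monic j (f j)) → ∀ us →
    det (λ u j → f j u) us (range 0 (length us)) ≡ vandermonde us
  det-vandermonde f f-monic []       = refl
  det-vandermonde f f-monic (x ∷ us) = begin
      det (λ u j → f j u) (x ∷ us) (0 ∷ range 1 (length us))
        ≡⟨ cong (det (λ u j → f j u) (x ∷ us) ∘ (0 ∷_)) (sym (map-suc-range 0 (length us))) ⟩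
      det (λ u j → f j u) (x ∷ us) (0 ∷ map suc (range 0 (length us)))
        ≡⟨ det-eliminate (λ u j → f j u) 0 (f-monic 0) x us _ ⟩
      det (λ u j → f j u - f j x) us (map suc (range 0 (length us)))
        ≡⟨ det-map-columns (λ u j → f j u - f j x) suc us _ ⟩
      det (λ u j → f (suc j) u - f (suc j) x) us (range 0 (length us))
        ≡⟨ det-cong _ (All.universal (λ u j → proj₂ (proj₂ (f-monic (suc j) x)) u) us) ⟩
      det (λ u j → (u - x) * g j u) us (range 0 (length us))
        ≡⟨ det-row-factor (_- x) (λ u j → g j u) us _ ⟩
      product (_- x) us * det (λ u j → g j u) us (range 0 (length us))
        ≡⟨ cong (product (_- x) us *_) (det-vandermonde g (λ j → proj₁ (proj₂ (f-monic (suc j) x))) us) ⟩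
      product (_- x) us * vandermonde us ∎
    where
    open ≡-Reasoning
    g : ℕ → ℚ → ℚ
    g j = proj₁ (f-monic (suc j) x)

  -- Inverses and factorials.

  inv-inverseʳ : ∀ {p} → p ≢ 0ℚ → p * inv p ≡ 1ℚ
  inv-inverseʳ {p} p≢0 with p ℚP.≟ 0ℚ
  ... | yes p≡0 = contradiction p≡0 p≢0
  ... | no  p≢0 = ℚP.*-inverseʳ p {{ℚ.≢-nonZero p≢0}}

  fromℕ-suc≢0 : ∀ n → fromℕ (suc n) ≢ 0ℚ
  fromℕ-suc≢0 n eq with ℚᵘP.≃-trans (ℚᵘP.≃-sym (ℚP.toℚᵘ-fromℚᵘ (ℚᵘ.mkℚᵘ (+ suc n) 0))) (ℚᵘP.≃-reflexive (cong toℚᵘ eq))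
  ... | ℚᵘ.*≡* ()

  fromℕ-injective : ∀ {m n} → fromℕ m ≡ fromℕ n → m ≡ n
  fromℕ-injective {m} {n} eq with ℚᵘP.≃-trans (ℚᵘP.≃-sym (ℚP.toℚᵘ-fromℚᵘ (ℚᵘ.mkℚᵘ (+ m) 0))) (ℚᵘP.≃-trans (ℚᵘP.≃-reflexive (cong toℚᵘ eq)) (ℚP.toℚᵘ-fromℚᵘ (ℚᵘ.mkℚᵘ (+ n) 0)))
  ... | ℚᵘ.*≡* e = ℤP.+-injective (trans (sym (ℤP.*-identityʳ (+ m))) (trans e (ℤP.*-identityʳ (+ n))))

  factorial inverse-factorial : ℕ → ℚ
  factorial zero    = 1ℚ
  factorial (suc n) = fromℕ (suc n) * factorial n
  inverse-factorial zero    = 1ℚ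
  inverse-factorial (suc n) = inv (fromℕ (suc n)) * inverse-factorial n

  suc*inverse-factorial : ∀ n → fromℕ (suc n) * inverse-factorial (suc n) ≡ inverse-factorial n
  suc*inverse-factorial n = begin
      fromℕ (suc n) * (inv (fromℕ (suc n)) * inverse-factorial n)  ≡⟨ ℚP.*-assoc (fromℕ (suc n)) _ _ ⟨
      fromℕ (suc n) * inv (fromℕ (suc n)) * inverse-factorial n    ≡⟨ cong (_* inverse-factorial n) (inv-inverseʳ (fromℕ-suc≢0 n)) ⟩
      1ℚ * inverse-factorial n                                     ≡⟨ ℚP.*-identityˡ (inverse-factorial n) ⟩
      inverse-factorial n                                          ∎
    where open ≡-Reasoning

  factorial-inverse : ∀ n → factorial n * inverse-factorial n ≡ 1ℚ
  factorial-inverse zero    = refl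
  factorial-inverse (suc n) = begin
      fromℕ (suc n) * factorial n * inverse-factorial (suc n)    ≡⟨ solve 3 (λ a b c → a :* b :* c := b :* (a :* c)) refl (fromℕ (suc n)) (factorial n) (inverse-factorial (suc n)) ⟩
      factorial n * (fromℕ (suc n) * inverse-factorial (suc n))  ≡⟨ cong (factorial n *_) (suc*inverse-factorial n) ⟩
      factorial n * inverse-factorial n                          ≡⟨ factorial-inverse n ⟩
      1ℚ                                                         ∎
    where open ≡-Reasoning

  -- Eigenfunctions of the transfer operator.

  -- ρ A j = 1 / (A - j)!, which is 0 for A < j.
  ρ : ℕ → ℕ → ℚ
  ρ A zero    = inverse-factorial A
  ρ A (suc j) = (fromℕ A - fromℕ j) * ρ A j

  ρ-suc-suc : ∀ A j → ρ (suc A) (suc j) ≡ ρ A j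
  ρ-suc-suc A zero    = trans (cong (_* inverse-factorial (suc A)) (solve 1 (λ x → x :- con 0ℚ := x) refl (fromℕ (suc A)))) (suc*inverse-factorial A)
  ρ-suc-suc A (suc j) = cong₂ _*_
    (trans (cong₂ _-_ (fromℕ-suc A) (fromℕ-suc j)) (solve 2 (λ a b → (con 1ℚ :+ a) :- (con 1ℚ :+ b) := a :- b) refl (fromℕ A) (fromℕ j)))
    (ρ-suc-suc A j)

  ρ-zero-suc : ∀ j → ρ 0 (suc j) ≡ 0ℚ
  ρ-zero-suc zero    = refl
  ρ-zero-suc (suc j) = trans (cong ((fromℕ 0 - fromℕ (suc j)) *_) (ρ-zero-suc j)) (ℚP.*-zeroʳ (fromℕ 0 - fromℕ (suc j)))

  weight : ℕ → ℕ → ℕ → ℚ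
  weight A B j = (fromℕ A - fromℕ B) * ρ A j * ρ B j

  eigenvalue : ℕ → ℕ → ℚ
  eigenvalue s j = fromℕ s - (fromℕ j + fromℕ j)

  -- The functions `weight _ _ j` are eigenvectors of the transfer operator on each antidiagonal A + B = s.
  weight-step : ∀ A B j → weight (suc A) B j + weight A (suc B) j ≡ eigenvalue (A ℕ.+ suc B) j * weight (suc A) (suc B) j
  weight-step A B j = begin
      weight (suc A) B j + weight A (suc B) j
        ≡⟨ cong₂ (λ x y → (fromℕ (suc A) - fromℕ B) * X * x + (fromℕ A - fromℕ (suc B)) * y * Y) (sym (ρ-suc-suc B j)) (sym (ρ-suc-suc A j)) ⟩
      (fromℕ (suc A) - fromℕ B) * X * ((fromℕ (suc B) - fromℕ j) * Y) + (fromℕ A - fromℕ (suc B)) * ((fromℕ (suc A) - fromℕ j) * X) * Y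
        ≡⟨ cong₂ (λ p q → (p - fromℕ B) * X * ((q - fromℕ j) * Y) + (fromℕ A - q) * ((p - fromℕ j) * X) * Y) (fromℕ-suc A) (fromℕ-suc B) ⟩
      (1ℚ + fromℕ A - fromℕ B) * X * ((1ℚ + fromℕ B - fromℕ j) * Y) + (fromℕ A - (1ℚ + fromℕ B)) * ((1ℚ + fromℕ A - fromℕ j) * X) * Y
        ≡⟨ solve 5 (λ a b j x y → (con 1ℚ :+ a :- b) :* x :* ((con 1ℚ :+ b :- j) :* y) :+ (a :- (con 1ℚ :+ b)) :* ((con 1ℚ :+ a :- j) :* x) :* y
                               := (a :+ (con 1ℚ :+ b) :- (j :+ j)) :* ((con 1ℚ :+ a :- (con 1ℚ :+ b)) :* x :* y)) refl (fromℕ A) (fromℕ B) (fromℕ j) X Y ⟩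
      (fromℕ A + (1ℚ + fromℕ B) - (fromℕ j + fromℕ j)) * ((1ℚ + fromℕ A - (1ℚ + fromℕ B)) * X * Y)
        ≡⟨ cong₂ (λ p q → (fromℕ A + q - (fromℕ j + fromℕ j)) * ((p - q) * X * Y)) (sym (fromℕ-suc A)) (sym (fromℕ-suc B)) ⟩
      (fromℕ A + fromℕ (suc B) - (fromℕ j + fromℕ j)) * weight (suc A) (suc B) j
        ≡⟨ cong (λ z → (z - (fromℕ j + fromℕ j)) * weight (suc A) (suc B) j) (sym (fromℕ-+ A (suc B))) ⟩
      eigenvalue (A ℕ.+ suc B) j * weight (suc A) (suc B) j ∎
    where
    open ≡-Reasoning
    X = ρ (suc A) j
    Y = ρ (suc B) j

  -- Position 0 has a single predecessor. As a polynomial identity this fails by a multiple of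
  -- `j * ρ 0 j`; that defect is, up to sign, `ρ 0 (suc j)`, which is zero.
  weight-step₀ : ∀ A j → weight A 0 j ≡ eigenvalue A j * weight (suc A) 0 j
  weight-step₀ A j = begin
      (fromℕ A - 0ℚ) * ρ A j * ρ 0 j
        ≡⟨ cong (λ x → (fromℕ A - 0ℚ) * x * ρ 0 j) (sym (ρ-suc-suc A j)) ⟩
      (fromℕ A - 0ℚ) * ((fromℕ (suc A) - fromℕ j) * X) * ρ 0 j
        ≡⟨ cong (λ p → (fromℕ A - 0ℚ) * ((p - fromℕ j) * X) * ρ 0 j) (fromℕ-suc A) ⟩
      (fromℕ A - 0ℚ) * ((1ℚ + fromℕ A - fromℕ j) * X) * ρ 0 j
        ≡⟨ solve 4 (λ a j x y → (a :- con 0ℚ) :* ((con 1ℚ :+ a :- j) :* x) :* y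
                             := (a :- (j :+ j)) :* ((con 1ℚ :+ a :- con 0ℚ) :* x :* y) :- (a :+ con 1ℚ :+ con 1ℚ) :* x :* ((con 0ℚ :- j) :* y))
             refl (fromℕ A) (fromℕ j) X (ρ 0 j) ⟩
      eigenvalue A j * ((1ℚ + fromℕ A - 0ℚ) * X * ρ 0 j) - (fromℕ A + 1ℚ + 1ℚ) * X * ρ 0 (suc j)
        ≡⟨ cong₂ (λ p z → eigenvalue A j * ((p - 0ℚ) * X * ρ 0 j) - (fromℕ A + 1ℚ + 1ℚ) * X * z) (sym (fromℕ-suc A)) (ρ-zero-suc j) ⟩
      eigenvalue A j * weight (suc A) 0 j - (fromℕ A + 1ℚ + 1ℚ) * X * 0ℚ
        ≡⟨ solve 2 (λ x y → x :- y :* con 0ℚ := x) refl (eigenvalue A j * weight (suc A) 0 j) ((fromℕ A + 1ℚ + 1ℚ) * X) ⟩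
      eigenvalue A j * weight (suc A) 0 j ∎
    where
    open ≡-Reasoning
    X = ρ (suc A) j

  -- On line `k` with `n` paths the sum A + B is `s = k + 2 * n`. The truncated difference equals A
  -- only for `y ≤ s`, hence the bounds `_≤ s` carried along below.
  φ : ℕ → ℕ → ℕ → ℚ
  φ s y = weight (s ℕ.∸ y) y

  φ-step : ∀ s y j → suc y ℕ.≤ s → φ s y j + φ s (suc y) j ≡ eigenvalue s j * φ (suc s) (suc y) j
  φ-step s y j y<s = begin
      weight (s ℕ.∸ y) y j + weight A (suc y) j          ≡⟨ cong (λ z → weight z y j + weight A (suc y) j) s∸y ⟩
      weight (suc A) y j + weight A (suc y) j            ≡⟨ weight-step A y j ⟩
      eigenvalue (A ℕ.+ suc y) j * weight (suc A) (suc y) j ≡⟨ cong₂ (λ p q → eigenvalue p j * weight q (suc y) j) (ℕP.m∸n+n≡m y<s) (sym s∸y) ⟩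
      eigenvalue s j * weight (s ℕ.∸ y) (suc y) j        ∎
    where
    open ≡-Reasoning
    A = s ℕ.∸ suc y
    s∸y : s ℕ.∸ y ≡ suc A
    s∸y = ℕP.+-∸-assoc 1 y<s

  -- Sums over the positions one line below.

  -- A position y on a line is reached from y or y - 1 on the line below.
  stepSum : (List ℕ → ℚ) → List ℕ → ℚ
  stepSum h []           = h []
  stepSum h (zero ∷ ys)  = stepSum (h ∘ (0 ∷_)) ys
  stepSum h (suc y ∷ ys) = stepSum (h ∘ (y ∷_)) ys + stepSum (h ∘ (suc y ∷_)) ys

  -- As stepSum, but the positions below are distinct and at least lo.
  strictSum : ℕ → (List ℕ → ℚ) → List ℕ → ℚ
  strictSum lo h []           = h []
  strictSum lo h (zero ∷ ys)  = strictSum 1 (h ∘ (0 ∷_)) ys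
  strictSum lo h (suc y ∷ ys) = (if lo ℕ.≤ᵇ y then strictSum (suc y) (h ∘ (y ∷_)) ys else 0ℚ) + strictSum (2 ℕ.+ y) (h ∘ (suc y ∷_)) ys

  Increasing : ℕ → List ℕ → Set
  Increasing lo []       = ⊤
  Increasing lo (y ∷ ys) = lo ℕ.≤ y × Increasing (suc y) ys

  Increasing-weaken : ∀ {l m} zs → l ℕ.≤ m → Increasing m zs → Increasing l zs
  Increasing-weaken []       l≤m _            = tt
  Increasing-weaken (z ∷ zs) l≤m (m≤z , incr) = ℕP.≤-trans l≤m m≤z , incr

  stepSum-cong : ∀ {g h} q → (∀ p → g p ≡ h p) → stepSum g q ≡ stepSum h q
  stepSum-cong []           g≗h = g≗h []
  stepSum-cong (zero ∷ ys)  g≗h = stepSum-cong ys (g≗h ∘ (0 ∷_))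
  stepSum-cong (suc y ∷ ys) g≗h = cong₂ _+_ (stepSum-cong ys (g≗h ∘ (y ∷_))) (stepSum-cong ys (g≗h ∘ (suc y ∷_)))

  stepSum-* : ∀ k h q → stepSum (λ p → k * h p) q ≡ k * stepSum h q
  stepSum-* k h []           = refl
  stepSum-* k h (zero ∷ ys)  = stepSum-* k _ ys
  stepSum-* k h (suc y ∷ ys) = trans (cong₂ _+_ (stepSum-* k _ ys) (stepSum-* k _ ys)) (sym (ℚP.*-distribˡ-+ k _ _))

  stepSum-+ : ∀ g h q → stepSum (λ p → g p + h p) q ≡ stepSum g q + stepSum h q
  stepSum-+ g h []           = refl
  stepSum-+ g h (zero ∷ ys)  = stepSum-+ _ _ ys
  stepSum-+ g h (suc y ∷ ys) = trans (cong₂ _+_ (stepSum-+ (g ∘ (y ∷_)) (h ∘ (y ∷_)) ys) (stepSum-+ (g ∘ (suc y ∷_)) (h ∘ (suc y ∷_)) ys))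
    (solve 4 (λ a b c d → (a :+ b) :+ (c :+ d) := (a :+ c) :+ (b :+ d)) refl
      (stepSum (g ∘ (y ∷_)) ys) (stepSum (h ∘ (y ∷_)) ys) (stepSum (g ∘ (suc y ∷_)) ys) (stepSum (h ∘ (suc y ∷_)) ys))

  stepSum-zero : ∀ {h} q → (∀ p → h p ≡ 0ℚ) → stepSum h q ≡ 0ℚ
  stepSum-zero q h≗0 = trans (stepSum-cong q h≗0) (trans (stepSum-* 0ℚ (λ _ → 0ℚ) q) (ℚP.*-zeroˡ (stepSum (λ _ → 0ℚ) q)))

  stepSum-contract : ∀ {C : Set} (w : C → ℚ) cs (G : List ℕ → List C → ℚ) q →
    stepSum (λ p → contract w cs (G p)) q ≡ contract w cs (λ r → stepSum (λ p → G p r) q)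
  stepSum-contract w cs G []           = refl
  stepSum-contract w cs G (zero ∷ ys)  = stepSum-contract w cs _ ys
  stepSum-contract w cs G (suc y ∷ ys) = trans (cong₂ _+_ (stepSum-contract w cs (G ∘ (y ∷_)) ys) (stepSum-contract w cs (G ∘ (suc y ∷_)) ys))
    (sym (contract-+ w cs _ _))

  Alternating : (List ℕ → ℚ) → Set
  Alternating h = ∀ rs x xs → h (rs ++ x ∷ x ∷ xs) ≡ 0ℚ

  -- The extra terms of `stepSum` put a path on the position just taken by its right neighbour, and
  -- `h` is zero on adjacent equal entries. The hypothesis about `suc x ≡ lo` is this vanishing for
  -- the first entry, whose neighbour is already absorbed into `h`.
  strictSum≡stepSum : ∀ lo h q → Alternating h → (∀ x xs → suc x ≡ lo → h (x ∷ xs) ≡ 0ℚ) → Increasing lo q →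
    strictSum lo h q ≡ stepSum h q
  strictSum≡stepSum lo h []          alt low inc = refl
  strictSum≡stepSum lo h (zero ∷ ys) alt low (lo≤ , inc) =
    strictSum≡stepSum 1 _ ys (alt ∘ (0 ∷_)) (λ { .0 xs refl → alt [] 0 xs }) inc
  strictSum≡stepSum lo h (suc y ∷ ys) alt low (lo≤ , inc) = cong₂ _+_ first
    (strictSum≡stepSum (2 ℕ.+ y) _ ys (alt ∘ (suc y ∷_)) (λ { .(suc y) xs refl → alt [] (suc y) xs }) inc)
    where
    first : (if lo ℕ.≤ᵇ y then strictSum (suc y) (h ∘ (y ∷_)) ys else 0ℚ) ≡ stepSum (h ∘ (y ∷_)) ys
    first with lo ℕ.≤ᵇ y in eq
    ... | true  = strictSum≡stepSum (suc y) _ ys (alt ∘ (y ∷_)) (λ { .y xs refl → alt [] y xs }) (Increasing-weaken ys (ℕP.n≤1+n (suc y)) inc)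
    ... | false = sym (stepSum-zero ys (λ p → low y p (ℕP.≤-antisym (ℕP.≰⇒> (λ lo≤y → subst T eq (ℕP.≤⇒≤ᵇ lo≤y))) lo≤)))

  -- A block that begins at the lower bound has no room to its right, so every path comes from its
  -- own position.
  strictSum-range : ∀ lo h n → strictSum lo h (range lo n) ≡ h (range lo n)
  strictSum-range lo       h zero    = refl
  strictSum-range zero     h (suc n) = strictSum-range 1 (h ∘ (0 ∷_)) n
  strictSum-range (suc lo) h (suc n) with suc lo ℕ.≤ᵇ lo in eq
  ... | true  = contradiction (ℕP.≤ᵇ⇒≤ (suc lo) lo (subst T (sym eq) tt)) (ℕP.<-irrefl refl)
  ... | false = trans (ℚP.+-identityˡ _) (strictSum-range (2 ℕ.+ lo) (h ∘ (suc lo ∷_)) n)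

  -- The transfer operator acts on each row separately and multiplies its entry in column `j` by
  -- `eigenvalue s j`; `contract-eigen` collects these into a constant independent of the positions.
  stepSum-det : ∀ s cs {q} → All (ℕ._≤ s) q →
    stepSum (λ p → det (φ s) p cs) q ≡ product (eigenvalue s) cs * det (φ (suc s)) q cs
  stepSum-det s []       [] = refl
  stepSum-det s (c ∷ cs) [] = sym (ℚP.*-zeroʳ (product (eigenvalue s) (c ∷ cs)))
  stepSum-det s cs {zero ∷ ys} (_ ∷ ys≤s) = begin
      stepSum (λ p → contract (φ s 0) cs (det (φ s) p)) ys
        ≡⟨ stepSum-contract (φ s 0) cs (det (φ s)) ys ⟩
      contract (φ s 0) cs (λ r → stepSum (λ p → det (φ s) p r) ys)
        ≡⟨ contract-cong cs (weight-step₀ s) (λ r → stepSum-det s r ys≤s) ⟩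
      contract (λ j → eigenvalue s j * φ (suc s) 0 j) cs (λ r → product (eigenvalue s) r * det (φ (suc s)) ys r)
        ≡⟨ contract-eigen (eigenvalue s) (φ (suc s) 0) cs (det (φ (suc s)) ys) ⟩
      product (eigenvalue s) cs * contract (φ (suc s) 0) cs (det (φ (suc s)) ys) ∎
    where open ≡-Reasoning
  stepSum-det s cs {suc y ∷ ys} (y<s ∷ ys≤s) = begin
      stepSum (λ p → contract (φ s y) cs (det (φ s) p)) ys + stepSum (λ p → contract (φ s (suc y)) cs (det (φ s) p)) ys
        ≡⟨ cong₂ _+_ (stepSum-contract (φ s y) cs (det (φ s)) ys) (stepSum-contract (φ s (suc y)) cs (det (φ s)) ys) ⟩
      contract (φ s y) cs G + contract (φ s (suc y)) cs G
        ≡⟨ contract-weight-+ (φ s y) (φ s (suc y)) cs G ⟨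
      contract (λ j → φ s y j + φ s (suc y) j) cs G
        ≡⟨ contract-cong cs (λ j → φ-step s y j y<s) (λ r → stepSum-det s r ys≤s) ⟩
      contract (λ j → eigenvalue s j * φ (suc s) (suc y) j) cs (λ r → product (eigenvalue s) r * det (φ (suc s)) ys r)
        ≡⟨ contract-eigen (eigenvalue s) (φ (suc s) (suc y)) cs (det (φ (suc s)) ys) ⟩
      product (eigenvalue s) cs * contract (φ (suc s) (suc y)) cs (det (φ (suc s)) ys) ∎
    where
    open ≡-Reasoning
    G = λ r → stepSum (λ p → det (φ s) p r) ys

  -- The row of position 0 vanishes outside column 0, because `ρ 0 (suc j)` is zero. Lowering the
  -- remaining positions and columns by one lowers both A and B by one, so the remaining minor
  -- belongs to the sum `s`.
  det-peel : ∀ s n {q} → All (ℕ._≤ s) q →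
    det (φ (2 ℕ.+ s)) (0 ∷ map suc q) (range 0 (suc n)) ≡ inverse-factorial (suc s) * det (φ s) q (range 0 n)
  det-peel s n {q} q≤s = begin
      φ (2 ℕ.+ s) 0 0 * det (φ (2 ℕ.+ s)) (map suc q) (range 1 n) - contract (φ (2 ℕ.+ s) 0) (range 1 n) F
        ≡⟨ cong₂ (λ x y → x * y - contract (φ (2 ℕ.+ s) 0) (range 1 n) F) corner shifted ⟩
      inverse-factorial (suc s) * det (φ s) q (range 0 n) - contract (φ (2 ℕ.+ s) 0) (range 1 n) F
        ≡⟨ cong (_-_ (inverse-factorial (suc s) * det (φ s) q (range 0 n))) rest ⟩
      inverse-factorial (suc s) * det (φ s) q (range 0 n) - 0ℚ
        ≡⟨ solve 1 (λ x → x :- con 0ℚ := x) refl (inverse-factorial (suc s) * det (φ s) q (range 0 n)) ⟩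
      inverse-factorial (suc s) * det (φ s) q (range 0 n) ∎
    where
    open ≡-Reasoning
    F = λ r → det (φ (2 ℕ.+ s)) (map suc q) (0 ∷ r)
    corner : φ (2 ℕ.+ s) 0 0 ≡ inverse-factorial (suc s)
    corner = trans (solve 2 (λ x y → (x :- con 0ℚ) :* y :* con 1ℚ := x :* y) refl (fromℕ (2 ℕ.+ s)) (inverse-factorial (2 ℕ.+ s))) (suc*inverse-factorial (suc s))
    entry : ∀ y → y ℕ.≤ s → ∀ j → φ (2 ℕ.+ s) (suc y) (suc j) ≡ φ s y j
    entry y y≤s j rewrite ℕP.+-∸-assoc 1 y≤s = cong₂ _*_ (cong₂ _*_
      (trans (cong₂ _-_ (fromℕ-suc (s ℕ.∸ y)) (fromℕ-suc y)) (solve 2 (λ a b → (con 1ℚ :+ a) :- (con 1ℚ :+ b) := a :- b) refl (fromℕ (s ℕ.∸ y)) (fromℕ y)))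
      (ρ-suc-suc (s ℕ.∸ y) j)) (ρ-suc-suc y j)
    shifted : det (φ (2 ℕ.+ s)) (map suc q) (range 1 n) ≡ det (φ s) q (range 0 n)
    shifted = begin
      det (φ (2 ℕ.+ s)) (map suc q) (range 1 n)               ≡⟨ cong (det (φ (2 ℕ.+ s)) (map suc q)) (map-suc-range 0 n) ⟨
      det (φ (2 ℕ.+ s)) (map suc q) (map suc (range 0 n))     ≡⟨ det-map-columns (φ (2 ℕ.+ s)) suc (map suc q) (range 0 n) ⟩
      det (λ y j → φ (2 ℕ.+ s) y (suc j)) (map suc q) (range 0 n) ≡⟨ det-map-rows (λ y j → φ (2 ℕ.+ s) y (suc j)) suc q (range 0 n) ⟩
      det (λ y j → φ (2 ℕ.+ s) (suc y) (suc j)) q (range 0 n) ≡⟨ det-cong (range 0 n) (All.map (λ {y} → entry y) q≤s) ⟩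
      det (φ s) q (range 0 n)                                 ∎
    rest : contract (φ (2 ℕ.+ s) 0) (range 1 n) F ≡ 0ℚ
    rest = begin
      contract (φ (2 ℕ.+ s) 0) (range 1 n) F                        ≡⟨ cong (λ r → contract (φ (2 ℕ.+ s) 0) r F) (map-suc-range 0 n) ⟨
      contract (φ (2 ℕ.+ s) 0) (map suc (range 0 n)) F              ≡⟨ contract-map suc (φ (2 ℕ.+ s) 0) (range 0 n) F ⟩
      contract (φ (2 ℕ.+ s) 0 ∘ suc) (range 0 n) (F ∘ map suc)
        ≡⟨ contract-weight-zero (range 0 n) (F ∘ map suc) (λ j → trans (cong ((fromℕ (2 ℕ.+ s) - 0ℚ) * ρ (2 ℕ.+ s) (suc j) *_) (ρ-zero-suc j)) (ℚP.*-zeroʳ ((fromℕ (2 ℕ.+ s) - 0ℚ) * ρ (2 ℕ.+ s) (suc j)))) ⟩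
      0ℚ ∎

  -- The normalised determinant and its transfer law.

  coefficient : ℕ → ℕ → ℚ
  coefficient zero    zero    = 1ℚ
  coefficient (suc n) zero    = factorial (suc (2 ℕ.* n)) * coefficient n zero
  coefficient n       (suc k) = coefficient n k * product (eigenvalue (k ℕ.+ 2 ℕ.* n)) (range 0 n)

  -- The number of families of n non-intersecting paths from positions 0, …, n - 1 on line 0 to positions q on line k.
  walks : ℕ → ℕ → List ℕ → ℚ
  walks n k q = coefficient n k * det (φ (k ℕ.+ 2 ℕ.* n)) q (range 0 n)

  walks-alternating : ∀ n k → Alternating (walks n k)
  walks-alternating n k rs x xs = trans (cong (coefficient n k *_) (det-repeat (φ _) rs x xs (range 0 n))) (ℚP.*-zeroʳ (coefficient n k))

  -- On the wall the factor A - B of every entry in the row of `y` is zero.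
  walks-wall : ∀ n k rs y ys → y ℕ.+ y ≡ k ℕ.+ 2 ℕ.* n → walks n k (rs ++ y ∷ ys) ≡ 0ℚ
  walks-wall n k rs y ys eq = trans (cong (coefficient n k *_) (det-zero-row (φ _) rs y ys (range 0 n) zero-row)) (ℚP.*-zeroʳ (coefficient n k))
    where
    zero-row : ∀ j → φ (k ℕ.+ 2 ℕ.* n) y j ≡ 0ℚ
    zero-row j rewrite sym eq | ℕP.m+n∸n≡m y y = solve 3 (λ x r t → (x :- x) :* r :* t := con 0ℚ) refl (fromℕ y) (ρ y j) (ρ y j)

  walks-stepSum : ∀ n k {q} → All (ℕ._≤ k ℕ.+ 2 ℕ.* n) q → stepSum (walks n k) q ≡ walks n (suc k) q
  walks-stepSum n k {q} q≤ = begin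
      stepSum (walks n k) q                                               ≡⟨ stepSum-* (coefficient n k) (λ p → det (φ s) p (range 0 n)) q ⟩
      coefficient n k * stepSum (λ p → det (φ s) p (range 0 n)) q         ≡⟨ cong (coefficient n k *_) (stepSum-det s (range 0 n) q≤) ⟩
      coefficient n k * (product (eigenvalue s) (range 0 n) * det (φ (suc s)) q (range 0 n)) ≡⟨ ℚP.*-assoc (coefficient n k) (product (eigenvalue s) (range 0 n)) _ ⟨
      coefficient n k * product (eigenvalue s) (range 0 n) * det (φ (suc s)) q (range 0 n)   ≡⟨ cong (_* det (φ (suc s)) q (range 0 n)) (coefficient-suc n) ⟨
      walks n (suc k) q                                                   ∎
    where
    open ≡-Reasoning
    s = k ℕ.+ 2 ℕ.* n
    coefficient-suc : ∀ n → coefficient n (suc k) ≡ coefficient n k * product (eigenvalue (k ℕ.+ 2 ℕ.* n)) (range 0 n)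
    coefficient-suc zero    = refl
    coefficient-suc (suc n) = refl

  walks-transfer : ∀ n k q → Increasing 0 q → All (ℕ._≤ k ℕ.+ 2 ℕ.* n) q → strictSum 0 (walks n k) q ≡ walks n (suc k) q
  walks-transfer n k q inc q≤ = trans (strictSum≡stepSum 0 (walks n k) q (walks-alternating n k) (λ _ _ ()) inc) (walks-stepSum n k q≤)

  range-bounded : ∀ lo n {m} → lo ℕ.+ n ℕ.≤ m → All (ℕ._< m) (range lo n)
  range-bounded lo zero    _  = []
  range-bounded lo (suc n) le = ℕP.≤-trans (s≤s (ℕP.m≤m+n lo n)) (ℕP.≤-trans (ℕP.≤-reflexive (sym (ℕP.+-suc lo n))) le)
    ∷ range-bounded (suc lo) n (ℕP.≤-trans (ℕP.≤-reflexive (sym (ℕP.+-suc lo n))) le)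

  range-increasing : ∀ lo n → Increasing lo (range lo n)
  range-increasing lo zero    = tt
  range-increasing lo (suc n) = ℕP.≤-refl , range-increasing (suc lo) n

  walks-initial : ∀ n → walks n 0 (range 0 n) ≡ 1ℚ
  walks-initial zero    = refl
  walks-initial (suc n) = begin
      factorial (suc (2 ℕ.* n)) * coefficient n 0 * det (φ (2 ℕ.* suc n)) (0 ∷ range 1 n) (range 0 (suc n))
        ≡⟨ cong₂ (λ s r → factorial (suc (2 ℕ.* n)) * coefficient n 0 * det (φ s) (0 ∷ r) (range 0 (suc n))) (cong suc (ℕP.+-suc n (n ℕ.+ 0))) (sym (map-suc-range 0 n)) ⟩
      factorial (suc (2 ℕ.* n)) * coefficient n 0 * det (φ (2 ℕ.+ 2 ℕ.* n)) (0 ∷ map suc (range 0 n)) (range 0 (suc n))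
        ≡⟨ cong (factorial (suc (2 ℕ.* n)) * coefficient n 0 *_) (det-peel (2 ℕ.* n) n (All.map (λ y<n → ℕP.≤-trans (ℕP.<⇒≤ y<n) (ℕP.m≤m+n n (n ℕ.+ 0))) (range-bounded 0 n ℕP.≤-refl))) ⟩
      factorial (suc (2 ℕ.* n)) * coefficient n 0 * (inverse-factorial (suc (2 ℕ.* n)) * det (φ (2 ℕ.* n)) (range 0 n) (range 0 n))
        ≡⟨ solve 4 (λ a b c d → a :* b :* (c :* d) := a :* c :* (b :* d)) refl (factorial (suc (2 ℕ.* n))) (coefficient n 0) _ _ ⟩
      factorial (suc (2 ℕ.* n)) * inverse-factorial (suc (2 ℕ.* n)) * walks n 0 (range 0 n)
        ≡⟨ cong₂ _*_ (factorial-inverse (suc (2 ℕ.* n))) (walks-initial n) ⟩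
      1ℚ ∎
    where open ≡-Reasoning

  -- Paths that fill the positions from 0 on can never move, so there is one family on every line;
  -- this value starts the product evaluation.
  walks-range : ∀ n k → walks n k (range 0 n) ≡ 1ℚ
  walks-range n zero    = walks-initial n
  walks-range n (suc k) = begin
      walks n (suc k) (range 0 n)              ≡⟨ walks-stepSum n k (All.map (λ y<n → ℕP.≤-trans (ℕP.<⇒≤ y<n) (ℕP.≤-trans (ℕP.m≤m+n n (n ℕ.+ 0)) (ℕP.m≤n+m (2 ℕ.* n) k))) (range-bounded 0 n ℕP.≤-refl)) ⟨
      stepSum (walks n k) (range 0 n)          ≡⟨ strictSum≡stepSum 0 (walks n k) (range 0 n) (walks-alternating n k) (λ _ _ ()) (range-increasing 0 n) ⟨
      strictSum 0 (walks n k) (range 0 n)      ≡⟨ strictSum-range 0 (walks n k) n ⟩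
      walks n k (range 0 n)                    ≡⟨ walks-range n k ⟩
      1ℚ                                       ∎
    where open ≡-Reasoning

open Paths

module Tilings where

  open import Data.Nat using (_+_; _*_; _∸_)

  private variable
    A B C : Set

  -- Counting the sublists that tile a region.

  all-cong : ∀ {p p′ : A → Bool} {xs} → All (λ x → p x ≡ p′ x) xs → all p xs ≡ all p′ xs
  all-cong []        = refl
  all-cong (eq ∷ eqs) = cong₂ _∧_ eq (all-cong eqs)

  all-false : ∀ {p : A → Bool} {x xs} → x ∈ xs → p x ≡ false → all p xs ≡ false
  all-false (here refl) px≡false rewrite px≡false = refl
  all-false {p = p} {xs = y ∷ ys} (there x∈xs) px≡false with p y
  ... | true  = all-false x∈xs px≡false
  ... | false = refl

  all-true : ∀ {p : A → Bool} xs → (∀ x → p x ≡ true) → all p xs ≡ true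
  all-true []       h = refl
  all-true (x ∷ xs) h = cong₂ _∧_ (h x) (all-true xs h)

  count-++ : ∀ (p : A → Bool) xs ys → count p (xs ++ ys) ≡ count p xs + count p ys
  count-++ p []       ys = refl
  count-++ p (x ∷ xs) ys with p x
  ... | true  = cong suc (count-++ p xs ys)
  ... | false = count-++ p xs ys

  count-map : ∀ (p : B → Bool) (f : A → B) xs → count p (map f xs) ≡ count (p ∘ f) xs
  count-map p f []       = refl
  count-map p f (x ∷ xs) with p (f x)
  ... | true  = cong suc (count-map p f xs)
  ... | false = count-map p f xs

  count-cong : ∀ {p p′ : A → Bool} → (∀ x → p x ≡ p′ x) → ∀ xs → count p xs ≡ count p′ xs
  count-cong p≗p′ []       = refl
  count-cong {p = p} {p′} p≗p′ (x ∷ xs) rewrite p≗p′ x with p′ x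
  ... | true  = cong suc (count-cong p≗p′ xs)
  ... | false = count-cong p≗p′ xs

  bit : Bool → ℕ
  bit true  = 1
  bit false = 0

  cover : Lozenge → (Tri → ℕ) → Tri → ℕ
  cover l e t = bit (covers l t) + e t

  -- The number of sublists of ls which complete the coverage e to a tiling of R.
  completions : Region → List Lozenge → (Tri → ℕ) → ℕ
  completions R []       e = bit (all (λ t → e t ==ℕ 1) R)
  completions R (l ∷ ls) e = completions R ls e + completions R ls (cover l e)

  count≡completions : ∀ R ls e →
    count (λ S → all (λ t → (e t + count (λ l → covers l t) S) ==ℕ 1) R) (sublists ls) ≡ completions R ls e
  count≡completions R [] e = trans
    (cong (λ b → if b then 1 else 0) (all-cong (All.universal (λ t → cong (_==ℕ 1) (ℕP.+-identityʳ (e t))) R))) (if-bit _)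
    where
    if-bit : ∀ b → (if b then 1 else 0) ≡ bit b
    if-bit true  = refl
    if-bit false = refl
  count≡completions R (l ∷ ls) e = begin
      count p (sublists ls ++ map (l ∷_) (sublists ls))            ≡⟨ count-++ p (sublists ls) _ ⟩
      count p (sublists ls) + count p (map (l ∷_) (sublists ls))   ≡⟨ cong₂ _+_ (count≡completions R ls e) (begin
        count p (map (l ∷_) (sublists ls))                           ≡⟨ count-map p (l ∷_) (sublists ls) ⟩
        count (p ∘ (l ∷_)) (sublists ls)                             ≡⟨ count-cong (λ S → all-cong (All.universal (λ t → cong (_==ℕ 1) (shift t S)) R)) (sublists ls) ⟩
        count (λ S → all (λ t → (cover l e t + count (λ l → covers l t) S) ==ℕ 1) R) (sublists ls) ≡⟨ count≡completions R ls (cover l e) ⟩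
        completions R ls (cover l e)                                 ∎) ⟩
      completions R ls e + completions R ls (cover l e)            ∎
    where
    open ≡-Reasoning
    p : List Lozenge → Bool
    p S = all (λ t → (e t + count (λ l → covers l t) S) ==ℕ 1) R
    shift : ∀ t S → e t + count (λ l → covers l t) (l ∷ S) ≡ cover l e t + count (λ l → covers l t) S
    shift t S with covers l t
    ... | true  = ℕP.+-suc (e t) _
    ... | false = refl

  M≡completions : ∀ R → M R ≡ completions R (lozengesIn R) (λ _ → 0)
  M≡completions R = count≡completions R (lozengesIn R) (λ _ → 0)

  completions-cong : ∀ {R} ls {e e′} → All (λ t → e t ≡ e′ t) R → completions R ls e ≡ completions R ls e′
  completions-cong []       e≗e′ = cong bit (all-cong (All.map (cong (_==ℕ 1)) e≗e′))
  completions-cong (l ∷ ls) e≗e′ = cong₂ _+_ (completions-cong ls e≗e′) (completions-cong ls (All.map (λ {t} → cong (λ z → bit (covers l t) + z)) e≗e′))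

  completions-over : ∀ {R t} ls {e} → t ∈ R → 2 ≤ e t → completions R ls e ≡ 0
  completions-over {t = t} [] {e} t∈R 2≤et = cong bit (all-false t∈R (over (e t) 2≤et))
    where
    over : ∀ n → 2 ≤ n → (n ==ℕ 1) ≡ false
    over (suc zero)    (s≤s ())
    over (suc (suc n)) _ = refl
  completions-over (l ∷ ls) t∈R 2≤et = cong₂ _+_ (completions-over ls t∈R 2≤et) (completions-over ls t∈R (ℕP.m≤n⇒m≤o+n _ 2≤et))

  completions-dead : ∀ {R t} ls {e} → t ∈ R → All (λ l → covers l t ≡ false) ls → e t ≡ 0 → completions R ls e ≡ 0
  completions-dead [] t∈R [] et≡0 = cong bit (all-false t∈R (cong (_==ℕ 1) et≡0))
  completions-dead (l ∷ ls) t∈R (eq ∷ eqs) et≡0 =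
    cong₂ _+_ (completions-dead ls t∈R eqs et≡0) (completions-dead ls t∈R eqs (cong₂ _+_ (cong bit eq) et≡0))

  -- Coverage is additive, so the order of the lozenges is irrelevant and any one of them may be
  -- decided first.
  completions-middle : ∀ R ls b bs e →
    completions R (ls ++ b ∷ bs) e ≡ completions R (ls ++ bs) e + completions R (ls ++ bs) (cover b e)
  completions-middle R []       b bs e = refl
  completions-middle R (l ∷ ls) b bs e = begin
      completions R (ls ++ b ∷ bs) e + completions R (ls ++ b ∷ bs) (cover l e)
        ≡⟨ cong₂ _+_ (completions-middle R ls b bs e) (completions-middle R ls b bs (cover l e)) ⟩
      (X e + X (cover b e)) + (X (cover l e) + X (cover b (cover l e)))
        ≡⟨ ℕ-interchange (X e) (X (cover b e)) (X (cover l e)) _ ⟩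
      (X e + X (cover l e)) + (X (cover b e) + X (cover b (cover l e)))
        ≡⟨ cong (λ z → (X e + X (cover l e)) + (X (cover b e) + z)) (completions-cong (ls ++ bs) (All.universal swap R)) ⟩
      (X e + X (cover l e)) + (X (cover b e) + X (cover l (cover b e))) ∎
    where
    open ≡-Reasoning
    X : (Tri → ℕ) → ℕ
    X = completions R (ls ++ bs)
    ℕ-interchange : ∀ a b c d → (a + b) + (c + d) ≡ (a + c) + (b + d)
    ℕ-interchange a b c d = trans (ℕP.+-assoc a b (c + d)) (trans (cong (λ z → a + z) (trans (sym (ℕP.+-assoc b c d)) (trans (cong (_+ d) (ℕP.+-comm b c)) (ℕP.+-assoc c b d)))) (sym (ℕP.+-assoc a c (b + d))))
    swap : ∀ t → cover b (cover l e) t ≡ cover l (cover b e) t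
    swap t = trans (sym (ℕP.+-assoc (bit (covers b t)) _ _)) (trans (cong (_+ e t) (ℕP.+-comm (bit (covers b t)) _)) (ℕP.+-assoc (bit (covers l t)) _ _))

  completions-covered : ∀ {R t} ls bs {e} → t ∈ R → All (λ l → covers l t ≡ true) bs → e t ≡ 1 →
    completions R (ls ++ bs) e ≡ completions R ls e
  completions-covered {R} ls [] {e} t∈R [] et≡1 = cong (λ l → completions R l e) (ListP.++-identityʳ ls)
  completions-covered {R} ls (b ∷ bs) {e} t∈R (eq ∷ eqs) et≡1 = begin
      completions R (ls ++ b ∷ bs) e                                        ≡⟨ completions-middle R ls b bs e ⟩
      completions R (ls ++ bs) e + completions R (ls ++ bs) (cover b e)     ≡⟨ cong₂ _+_ (completions-covered ls bs t∈R eqs et≡1)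
                                                                                 (completions-over (ls ++ bs) t∈R (ℕP.≤-reflexive (sym (cong₂ _+_ (cong bit eq) et≡1)))) ⟩
      completions R ls e + 0                                                ≡⟨ ℕP.+-identityʳ _ ⟩
      completions R ls e                                                    ∎
    where open ≡-Reasoning

  -- Only lozenges of `bs` can cover `t`: choosing none leaves it bare and choosing two covers it
  -- twice, so exactly one is used. In the application `bs` holds the lozenges of one up triangle,
  -- which stand at the end of the remaining list.
  completions-block : ∀ {R t} ls bs {e} → t ∈ R → All (λ l → covers l t ≡ false) ls → All (λ l → covers l t ≡ true) bs → e t ≡ 0 →
    completions R (ls ++ bs) e ≡ sum (map (λ l → completions R ls (cover l e)) bs)
  completions-block {R} ls [] {e} t∈R out [] et≡0 =
    trans (cong (λ l → completions R l e) (ListP.++-identityʳ ls)) (completions-dead ls t∈R out et≡0)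
  completions-block {R} ls (b ∷ bs) {e} t∈R out (eq ∷ eqs) et≡0 = begin
      completions R (ls ++ b ∷ bs) e                                        ≡⟨ completions-middle R ls b bs e ⟩
      completions R (ls ++ bs) e + completions R (ls ++ bs) (cover b e)     ≡⟨ ℕP.+-comm (completions R (ls ++ bs) e) _ ⟩
      completions R (ls ++ bs) (cover b e) + completions R (ls ++ bs) e     ≡⟨ cong₂ _+_ (completions-covered ls bs t∈R eqs (cong₂ _+_ (cong bit eq) et≡0))
                                                                                          (completions-block ls bs t∈R out eqs et≡0) ⟩
      completions R ls (cover b e) + sum (map (λ l → completions R ls (cover l e)) bs) ∎
    where open ≡-Reasoning

  ∧-true : ∀ {x y} → x ∧ y ≡ true → x ≡ true × y ≡ true
  ∧-true {true} eq = refl , eq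

  true→T : ∀ {b} → b ≡ true → T b
  true→T refl = tt

  T→true : ∀ {b} → T b → b ≡ true
  T→true {true} _ = refl

  bool-ext : ∀ {x y} → (x ≡ true → y ≡ true) → (y ≡ true → x ≡ true) → x ≡ y
  bool-ext {true}  {y}     f g = sym (f refl)
  bool-ext {false} {true}  f g = g refl
  bool-ext {false} {false} f g = refl

  -- The region in coordinates counted from the right.

  module _ (i j t : ℤ) {m n : ℕ} (i+t : i ℤ.+ t ≡ + m) (j+t : j ℤ.+ t ≡ + n) where
    -- Adding `t` turns both sides into natural numbers, so the Boolean integer tests that define
    -- the region become inequalities in `ℕ`.
    shift-≤ᵇ⁻ : (i ℤ.≤ᵇ j) ≡ true → m ≤ n
    shift-≤ᵇ⁻ eq = ℤP.drop‿+≤+ (subst₂ ℤ._≤_ i+t j+t (ℤP.+-monoˡ-≤ t (ℤP.≤ᵇ⇒≤ {i} {j} (true→T eq))))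

    shift-≤ᵇ⁺ : m ≤ n → (i ℤ.≤ᵇ j) ≡ true
    shift-≤ᵇ⁺ m≤n = T→true (ℤP.≤⇒≤ᵇ (subst₂ ℤ._≤_ (cancel i) (cancel j) (ℤP.+-monoˡ-≤ (ℤ.- t) (subst₂ ℤ._≤_ (sym i+t) (sym j+t) (ℤ.+≤+ m≤n)))))
      where
      cancel : ∀ k → k ℤ.+ t ℤ.+ ℤ.- t ≡ k
      cancel k = solve 2 (λ k t → k :+ t :+ :- t := k) refl k t
        where open ℤS.+-*-Solver

  module Geometry (a b c : ℕ) where

    open ℤS.+-*-Solver

    inside : Tri → Bool
    inside = inS a b c

    K W : ℕ
    K = a + b + 2
    W = a + c + 2

    column : ℕ → ℤ
    column B = + c ℤ.- + B

    at : Orient → ℕ → ℕ → Tri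
    at o k B = tri o (column B) (+ k)

    -- Column c - B contains a lattice edge of the region on the horizontal line k.
    Position : ℕ → ℕ → Set
    Position k B = k ≤ b + B × B + B < k + 2 * suc c × B < W

    Hole : ℕ → ℕ → Set
    Hole k B = k ≡ suc b × B ≡ 1

    -- The column is the integer `x - y` with natural `x` and `y`, which keeps all inequalities free
    -- of subtraction.
    record InH (x y k : ℕ) : Set where
      constructor mkInH
      field
        k≤K    : k ≤ K
        west   : y ≤ x + suc a
        east   : x ≤ suc c + y
        south  : y ≤ x + k
        north  : x + k ≤ b + c + 1 + y

    inH⁻ : ∀ i x y k → i ℤ.+ + y ≡ + x → inH a b c i (+ k) ≡ true → InH x y k
    inH⁻ i x y k eq h =
      let h₁ , h = ∧-true {+ 0 ℤ.≤ᵇ + k} h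
          h₂ , h = ∧-true {+ k ℤ.≤ᵇ + K} h
          h₃ , h = ∧-true {ℤ.- (+ suc a) ℤ.≤ᵇ i} h
          h₄ , h = ∧-true {i ℤ.≤ᵇ + suc c} h
          h₅ , h₆ = ∧-true {+ 0 ℤ.≤ᵇ (i ℤ.+ + k)} h
      in mkInH (ℤP.drop‿+≤+ (ℤP.≤ᵇ⇒≤ (true→T h₂)))
               (shift-≤ᵇ⁻ (ℤ.- (+ suc a)) i (+ y ℤ.+ + suc a) westˡ westʳ h₃)
               (shift-≤ᵇ⁻ i (+ suc c) (+ y) eq refl h₄)
               (shift-≤ᵇ⁻ (+ 0) (i ℤ.+ + k) (+ y) refl southʳ h₅)
               (shift-≤ᵇ⁻ (i ℤ.+ + k) (+ (b + c + 1)) (+ y) southʳ refl h₆)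
      where
      westˡ : ℤ.- (+ suc a) ℤ.+ (+ y ℤ.+ + suc a) ≡ + y
      westˡ = solve 2 (λ y a → :- a :+ (y :+ a) := y) refl (+ y) (+ suc a)
      westʳ : i ℤ.+ (+ y ℤ.+ + suc a) ≡ + (x + suc a)
      westʳ = trans (sym (ℤP.+-assoc i (+ y) (+ suc a))) (cong (ℤ._+ + suc a) eq)
      southʳ : i ℤ.+ + k ℤ.+ + y ≡ + (x + k)
      southʳ = trans (solve 3 (λ i k y → i :+ k :+ y := i :+ y :+ k) refl i (+ k) (+ y)) (cong (ℤ._+ + k) eq)

    inH⁺ : ∀ i x y k → i ℤ.+ + y ≡ + x → InH x y k → inH a b c i (+ k) ≡ true
    inH⁺ i x y k eq (mkInH k≤K west east south north) = cong₂ _∧_ {x = + 0 ℤ.≤ᵇ + k} refl (cong₂ _∧_ (T→true (ℤP.≤⇒≤ᵇ (ℤ.+≤+ k≤K)))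
      (cong₂ _∧_ (shift-≤ᵇ⁺ (ℤ.- (+ suc a)) i (+ y ℤ.+ + suc a) westˡ westʳ west)
      (cong₂ _∧_ (shift-≤ᵇ⁺ i (+ suc c) (+ y) eq refl east)
      (cong₂ _∧_ (shift-≤ᵇ⁺ (+ 0) (i ℤ.+ + k) (+ y) refl southʳ south)
                 (shift-≤ᵇ⁺ (i ℤ.+ + k) (+ (b + c + 1)) (+ y) southʳ refl north)))))
      where
      westˡ : ℤ.- (+ suc a) ℤ.+ (+ y ℤ.+ + suc a) ≡ + y
      westˡ = solve 2 (λ y a → :- a :+ (y :+ a) := y) refl (+ y) (+ suc a)
      westʳ : i ℤ.+ (+ y ℤ.+ + suc a) ≡ + (x + suc a)
      westʳ = trans (sym (ℤP.+-assoc i (+ y) (+ suc a))) (cong (ℤ._+ + suc a) eq)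
      southʳ : i ℤ.+ + k ℤ.+ + y ≡ + (x + k)
      southʳ = trans (solve 3 (λ i k y → i :+ k :+ y := i :+ y :+ k) refl i (+ k) (+ y)) (cong (ℤ._+ + k) eq)

    column₀ : ∀ B → + c ℤ.- + B ℤ.+ + B ≡ + c
    column₀ B = solve 2 (λ c B → c :- B :+ B := c) refl (+ c) (+ B)

    column₁ : ∀ B → + c ℤ.- + B ℤ.+ + 1 ℤ.+ + B ≡ + (c + 1)
    column₁ B = solve 2 (λ c B → c :- B :+ con (+ 1) :+ B := c :+ con (+ 1)) refl (+ c) (+ B)

    private
      zigzag : ∀ B k → + 2 ℤ.* (+ c ℤ.- + B) ℤ.+ + k ℤ.+ (+ B ℤ.+ + B ℤ.+ + 2) ≡ + (c + c + k + 2)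
      zigzag B k = solve 3 (λ c B k → con (+ 2) :* (c :- B) :+ k :+ (B :+ B :+ con (+ 2)) := c :+ c :+ k :+ con (+ 2)) refl (+ c) (+ B) (+ k)

      zigzag-up : ∀ B → ℤ.- (+ 1) ℤ.+ (+ B ℤ.+ + B ℤ.+ + 2) ≡ + (B + B + 1)
      zigzag-up B = solve 1 (λ B → con (ℤ.- (+ 1)) :+ (B :+ B :+ con (+ 2)) := B :+ B :+ con (+ 1)) refl (+ B)

      zigzag-dn : ∀ B → ℤ.- (+ 2) ℤ.+ (+ B ℤ.+ + B ℤ.+ + 2) ≡ + (B + B)
      zigzag-dn B = solve 1 (λ B → con (ℤ.- (+ 2)) :+ (B :+ B :+ con (+ 2)) := B :+ B) refl (+ B)

    eastOfZ-up⁻ : ∀ k B → k ≤ 2 * a → eastOfZ a (at up k B) ≡ true → B + B + 1 ≤ c + c + k + 2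
    eastOfZ-up⁻ k B k≤2a h rewrite T→true (ℤP.≤⇒≤ᵇ (ℤ.+≤+ k≤2a)) = shift-≤ᵇ⁻ (ℤ.- (+ 1)) (+ 2 ℤ.* (+ c ℤ.- + B) ℤ.+ + k) (+ B ℤ.+ + B ℤ.+ + 2) (zigzag-up B) (zigzag B k) h

    eastOfZ-dn⁻ : ∀ k B → k ≤ 2 * a → eastOfZ a (at dn k B) ≡ true → B + B ≤ c + c + k + 2
    eastOfZ-dn⁻ k B k≤2a h rewrite T→true (ℤP.≤⇒≤ᵇ (ℤ.+≤+ k≤2a)) = shift-≤ᵇ⁻ (ℤ.- (+ 2)) (+ 2 ℤ.* (+ c ℤ.- + B) ℤ.+ + k) (+ B ℤ.+ + B ℤ.+ + 2) (zigzag-dn B) (zigzag B k) h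

    eastOfZ-up⁺ : ∀ k B → B + B + 1 ≤ c + c + k + 2 → eastOfZ a (at up k B) ≡ true
    eastOfZ-up⁺ k B h with + k ℤ.≤ᵇ + (2 * a)
    ... | true  = shift-≤ᵇ⁺ (ℤ.- (+ 1)) (+ 2 ℤ.* (+ c ℤ.- + B) ℤ.+ + k) (+ B ℤ.+ + B ℤ.+ + 2) (zigzag-up B) (zigzag B k) h
    ... | false = refl

    eastOfZ-dn⁺ : ∀ k B → B + B ≤ c + c + k + 2 → eastOfZ a (at dn k B) ≡ true
    eastOfZ-dn⁺ k B h with + k ℤ.≤ᵇ + (2 * a)
    ... | true  = shift-≤ᵇ⁺ (ℤ.- (+ 2)) (+ 2 ℤ.* (+ c ℤ.- + B) ℤ.+ + k) (+ B ℤ.+ + B ℤ.+ + 2) (zigzag-dn B) (zigzag B k) h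
    ... | false = refl

    at-injective : ∀ {B B′} → + c ℤ.- + B ≡ + c ℤ.- + B′ → B ≡ B′
    at-injective {B} {B′} eq = ℤP.+-injective (trans (sym (reflect B)) (trans (cong (λ x → + c ℤ.- x) eq) (reflect B′)))
      where
      reflect : ∀ B → + c ℤ.- (+ c ℤ.- + B) ≡ + B
      reflect B = solve 2 (λ c B → c :- (c :- B) := B) refl (+ c) (+ B)

    ==ℤ-column : ∀ B B′ → ((+ c ℤ.- + B) ==ℤ (+ c ℤ.- + B′)) ≡ (B ℕ.≡ᵇ B′)
    ==ℤ-column B B′ with (+ c ℤ.- + B) ℤ.≟ (+ c ℤ.- + B′)
    ... | yes eq = sym (T→true (ℕP.≡⇒≡ᵇ B B′ (at-injective eq)))
    ... | no neq = bool-ext (λ ()) (λ eq → contradiction (cong (λ x → + c ℤ.- + x) (ℕP.≡ᵇ⇒≡ B B′ (true→T eq))) neq)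

    ==T-at : ∀ o k B o′ k′ B′ → (at o k B ==T at o′ k′ B′) ≡ (o ≟O o′) ∧ ((B ℕ.≡ᵇ B′) ∧ (k ℕ.≡ᵇ k′))
    ==T-at o k B o′ k′ B′ = cong (λ x → (o ≟O o′) ∧ (x ∧ (k ℕ.≡ᵇ k′))) (==ℤ-column B B′)

    module _ where
      open ℕP.≤-Reasoning
      open ℕS.+-*-Solver using () renaming (solve to solveℕ; _:+_ to _⊕_; _:*_ to _⊗_; con to κ; _:=_ to _≐_)

      up-inside⁺ : ∀ k B → k < K → Position k B → ¬ Hole k B → inside (at up k B) ≡ true
      up-inside⁺ k B k<K (k≤ , wall , B<W) ¬hole = cong₂ _∧_
        (cong₂ _∧_ (inH⁺ (column B) c B k (column₀ B) (mkInH (ℕP.<⇒≤ k<K) west (ℕP.m≤n⇒m≤n+o B (ℕP.n≤1+n c)) south (ℕP.≤-trans (ℕP.m≤m+n _ 1) north)))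
        (cong₂ _∧_ (inH⁺ (column B ℤ.+ + 1) (c + 1) B k (column₁ B) (mkInH (ℕP.<⇒≤ k<K) (ℕP.≤-trans west (ℕP.+-monoˡ-≤ (suc a) (ℕP.m≤m+n c 1)))
                      (ℕP.m≤n⇒m≤n+o B (ℕP.≤-reflexive (ℕP.+-comm c 1))) (ℕP.≤-trans south (ℕP.+-monoˡ-≤ k (ℕP.m≤m+n c 1))) (ℕP.≤-trans (ℕP.≤-reflexive (swap c k)) north)))
                   (inH⁺ (column B) c B (k + 1) (column₀ B) (mkInH (ℕP.≤-trans (ℕP.≤-reflexive (ℕP.+-comm k 1)) k<K) west (ℕP.m≤n⇒m≤n+o B (ℕP.n≤1+n c))
                      (ℕP.≤-trans south (ℕP.+-monoʳ-≤ c (ℕP.m≤m+n k 1))) (ℕP.≤-trans (ℕP.≤-reflexive (sym (ℕP.+-assoc c k 1))) north)))))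
        (cong₂ _∧_ (eastOfZ-up⁺ k B (begin
            B + B + 1           ≡⟨ ℕP.+-comm (B + B) 1 ⟩
            suc (B + B)         ≤⟨ wall ⟩
            k + 2 * suc c       ≡⟨ solveℕ 2 (λ k c → k ⊕ κ 2 ⊗ (κ 1 ⊕ c) ≐ c ⊕ c ⊕ k ⊕ κ 2) refl k c ⟩
            c + c + k + 2       ∎))
          (cong not (trans (==T-at up k B up (suc b) 1) not-hole)))
        where
        swap : ∀ c k → c + 1 + k ≡ c + k + 1
        swap = solveℕ 2 (λ c k → c ⊕ κ 1 ⊕ k ≐ c ⊕ k ⊕ κ 1) refl
        west : B ≤ c + suc a
        west = ℕP.≤-pred (ℕP.≤-trans B<W (ℕP.≤-reflexive (solveℕ 2 (λ a c → a ⊕ c ⊕ κ 2 ≐ κ 1 ⊕ (c ⊕ (κ 1 ⊕ a))) refl a c)))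
        south : B ≤ c + k
        south with B ℕP.≤? c + k
        ... | yes p = p
        -- The southwest side follows from the wall: beyond that side `B` is at least `c + k + 1`,
        -- and doubling this violates the wall inequality.
        ... | no ¬p = contradiction wall (ℕP.≤⇒≯ (begin
            k + 2 * suc c               ≤⟨ ℕP.m≤m+n _ k ⟩
            k + 2 * suc c + k           ≡⟨ solveℕ 2 (λ k c → k ⊕ κ 2 ⊗ (κ 1 ⊕ c) ⊕ k ≐ (κ 1 ⊕ (c ⊕ k)) ⊕ (κ 1 ⊕ (c ⊕ k))) refl k c ⟩
            suc (c + k) + suc (c + k)   ≤⟨ ℕP.+-mono-≤ (ℕP.≰⇒> ¬p) (ℕP.≰⇒> ¬p) ⟩
            B + B                       ∎))
        north : c + k + 1 ≤ b + c + 1 + B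
        north = begin
            c + k + 1         ≤⟨ ℕP.+-monoˡ-≤ 1 (ℕP.+-monoʳ-≤ c k≤) ⟩
            c + (b + B) + 1   ≡⟨ solveℕ 3 (λ b c B → c ⊕ (b ⊕ B) ⊕ κ 1 ≐ b ⊕ c ⊕ κ 1 ⊕ B) refl b c B ⟩
            b + c + 1 + B     ∎
        not-hole : ((B ℕ.≡ᵇ 1) ∧ (k ℕ.≡ᵇ suc b)) ≡ false
        not-hole = bool-ext (λ eq → let B≡1 , k≡ = ∧-true {B ℕ.≡ᵇ 1} eq in
          ⊥-elim (¬hole (ℕP.≡ᵇ⇒≡ k (suc b) (true→T k≡) , ℕP.≡ᵇ⇒≡ B 1 (true→T B≡1)))) (λ ())

      -- An up triangle of row `k` is identified with its base on line `k`, a down triangle with its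
      -- top edge on line `suc k`. Thus `d₀` and `d₁` join position `B` to `B` and `suc B` on the
      -- next line.
      dn-inside⁺ : ∀ k B → k < K → Position (suc k) B → inside (at dn k B) ≡ true
      dn-inside⁺ k B k<K (k< , wall , B<W) = cong₂ _∧_
        (cong₂ _∧_ (inH⁺ (column B ℤ.+ + 1) (c + 1) B k (column₁ B) (mkInH (ℕP.<⇒≤ k<K) (ℕP.≤-trans west (ℕP.+-monoˡ-≤ (suc a) (ℕP.m≤m+n c 1))) east₁ (ℕP.≤-trans south (ℕP.≤-reflexive (sym (swap c k))))
                      (ℕP.≤-trans (ℕP.≤-reflexive (swap c k)) (ℕP.≤-trans (ℕP.+-monoʳ-≤ (c + k) (s≤s z≤n)) north))))
        (cong₂ _∧_ (inH⁺ (column B) c B (k + 1) (column₀ B) (mkInH k+1≤K west (ℕP.m≤n⇒m≤n+o B (ℕP.n≤1+n c))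
                      (ℕP.≤-trans south (ℕP.≤-reflexive (ℕP.+-assoc c k 1))) (ℕP.≤-trans (ℕP.≤-reflexive (sym (ℕP.+-assoc c k 1))) (ℕP.≤-trans (ℕP.+-monoʳ-≤ (c + k) (s≤s z≤n)) north))))
                   (inH⁺ (column B ℤ.+ + 1) (c + 1) B (k + 1) (column₁ B) (mkInH k+1≤K (ℕP.≤-trans west (ℕP.+-monoˡ-≤ (suc a) (ℕP.m≤m+n c 1))) east₁
                      (ℕP.≤-trans south (ℕP.≤-trans (ℕP.≤-reflexive (ℕP.+-assoc c k 1)) (ℕP.+-monoˡ-≤ (k + 1) (ℕP.m≤m+n c 1))))
                      (ℕP.≤-trans (ℕP.≤-reflexive (solveℕ 2 (λ c k → c ⊕ κ 1 ⊕ (k ⊕ κ 1) ≐ c ⊕ k ⊕ κ 2) refl c k)) north)))))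
        (cong₂ _∧_ (eastOfZ-dn⁺ k B (begin
            B + B                   ≤⟨ ℕP.≤-pred wall ⟩
            k + 2 * suc c           ≡⟨ solveℕ 2 (λ k c → k ⊕ κ 2 ⊗ (κ 1 ⊕ c) ≐ c ⊕ c ⊕ k ⊕ κ 2) refl k c ⟩
            c + c + k + 2           ∎)) refl)
        where
        k+1≤K : k + 1 ≤ K
        k+1≤K = ℕP.≤-trans (ℕP.≤-reflexive (ℕP.+-comm k 1)) k<K
        swap : ∀ c k → c + 1 + k ≡ c + k + 1
        swap = solveℕ 2 (λ c k → c ⊕ κ 1 ⊕ k ≐ c ⊕ k ⊕ κ 1) refl
        east₁ : c + 1 ≤ suc c + B
        east₁ = ℕP.m≤n⇒m≤n+o B (ℕP.≤-reflexive (ℕP.+-comm c 1))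
        west : B ≤ c + suc a
        west = ℕP.≤-pred (ℕP.≤-trans B<W (ℕP.≤-reflexive (solveℕ 2 (λ a c → a ⊕ c ⊕ κ 2 ≐ κ 1 ⊕ (c ⊕ (κ 1 ⊕ a))) refl a c)))
        south : B ≤ c + k + 1
        south with B ℕP.≤? c + k + 1
        ... | yes p = p
        ... | no ¬p = contradiction wall (ℕP.≤⇒≯ (begin
            suc k + 2 * suc c                   ≤⟨ ℕP.m≤m+n _ (suc k) ⟩
            suc k + 2 * suc c + suc k           ≡⟨ solveℕ 2 (λ k c → κ 1 ⊕ k ⊕ κ 2 ⊗ (κ 1 ⊕ c) ⊕ (κ 1 ⊕ k) ≐ (κ 1 ⊕ (c ⊕ k ⊕ κ 1)) ⊕ (κ 1 ⊕ (c ⊕ k ⊕ κ 1))) refl k c ⟩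
            suc (c + k + 1) + suc (c + k + 1)   ≤⟨ ℕP.+-mono-≤ (ℕP.≰⇒> ¬p) (ℕP.≰⇒> ¬p) ⟩
            B + B                               ∎))
        north : c + k + 2 ≤ b + c + 1 + B
        north = begin
            c + k + 2         ≡⟨ solveℕ 2 (λ c k → c ⊕ k ⊕ κ 2 ≐ c ⊕ (κ 1 ⊕ k) ⊕ κ 1) refl c k ⟩
            c + suc k + 1     ≤⟨ ℕP.+-monoˡ-≤ 1 (ℕP.+-monoʳ-≤ c k<) ⟩
            c + (b + B) + 1   ≡⟨ solveℕ 3 (λ b c B → c ⊕ (b ⊕ B) ⊕ κ 1 ≐ b ⊕ c ⊕ κ 1 ⊕ B) refl b c B ⟩
            b + c + 1 + B     ∎

      private
        B<W : ∀ {B} → B ≤ c + suc a → B < W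
        B<W {B} west = begin
          suc B             ≤⟨ s≤s west ⟩
          suc (c + suc a)   ≡⟨ solveℕ 2 (λ a c → κ 1 ⊕ (c ⊕ (κ 1 ⊕ a)) ≐ a ⊕ c ⊕ κ 2) refl a c ⟩
          W                 ∎
        -- Above row `2 * a` the zigzag makes no test, but there the northwest side already forces
        -- the wall inequality; hence one formula in `Position` serves all rows.
        beyond : ∀ {B} k → B ≤ c + suc a → suc (2 * a) ≤ k → B + B < suc k + 2 * suc c × B + B < k + 2 * suc c
        beyond {B} k west 2a<k = ℕP.≤-trans lt (ℕP.n≤1+n _) , lt
          where
          lt : B + B < k + 2 * suc c
          lt = begin
            suc (B + B)                         ≤⟨ s≤s (ℕP.+-mono-≤ west west) ⟩
            suc ((c + suc a) + (c + suc a))     ≡⟨ solveℕ 2 (λ a c → κ 1 ⊕ ((c ⊕ (κ 1 ⊕ a)) ⊕ (c ⊕ (κ 1 ⊕ a))) ≐ κ 1 ⊕ (κ 2 ⊗ a) ⊕ κ 2 ⊗ (κ 1 ⊕ c)) refl a c ⟩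
            suc (2 * a) + 2 * suc c             ≤⟨ ℕP.+-monoˡ-≤ (2 * suc c) 2a<k ⟩
            k + 2 * suc c                       ∎

      up-inside⁻ : ∀ k B → inside (at up k B) ≡ true → k < K × Position k B × ¬ Hole k B
      up-inside⁻ k B h =
        let hH , h′ = ∧-true {triInH a b c (at up k B)} h
            hZ , hR = ∧-true {eastOfZ a (at up k B)} h′
            v₁ , v  = ∧-true {inH a b c (+ c ℤ.- + B) (+ k)} hH
            v₂ , v₃ = ∧-true {inH a b c (+ c ℤ.- + B ℤ.+ + 1) (+ k)} v
            h₁ = inH⁻ (column B) c B k (column₀ B) v₁
            h₂ = inH⁻ (column B ℤ.+ + 1) (c + 1) B k (column₁ B) v₂
            h₃ = inH⁻ (column B) c B (k + 1) (column₀ B) v₃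
        in ℕP.≤-trans (ℕP.≤-reflexive (ℕP.+-comm 1 k)) (InH.k≤K h₃)
         , (ℕP.+-cancelˡ-≤ (c + 1) k (b + B) (ℕP.≤-trans (InH.north h₂) (ℕP.≤-reflexive (solveℕ 3 (λ b c B → b ⊕ c ⊕ κ 1 ⊕ B ≐ c ⊕ κ 1 ⊕ (b ⊕ B)) refl b c B)))
           , wall hZ (InH.west h₁) , B<W (InH.west h₁))
         , hole hR
        where
        wall : eastOfZ a (at up k B) ≡ true → B ≤ c + suc a → B + B < k + 2 * suc c
        wall hZ west with k ℕP.≤? 2 * a
        ... | yes k≤2a = begin
            suc (B + B)     ≡⟨ ℕP.+-comm 1 (B + B) ⟩
            B + B + 1       ≤⟨ eastOfZ-up⁻ k B k≤2a hZ ⟩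
            c + c + k + 2   ≡⟨ solveℕ 2 (λ k c → c ⊕ c ⊕ k ⊕ κ 2 ≐ k ⊕ κ 2 ⊗ (κ 1 ⊕ c)) refl k c ⟩
            k + 2 * suc c   ∎
        ... | no k≰2a = proj₂ (beyond k west (ℕP.≰⇒> k≰2a))
        hole : not (at up k B ==T removedTri b c) ≡ true → ¬ Hole k B
        hole hR (refl , refl) with trans (sym hR) (cong not (trans (==T-at up (suc b) 1 up (suc b) 1) (T→true (ℕP.≡⇒≡ᵇ b b refl))))
        ... | ()

      dn-inside⁻ : ∀ k B → inside (at dn k B) ≡ true → k < K × Position (suc k) B
      dn-inside⁻ k B h =
        let hH , h′ = ∧-true {triInH a b c (at dn k B)} h
            hZ , hR = ∧-true {eastOfZ a (at dn k B)} h′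
            v₁ , v  = ∧-true {inH a b c (+ c ℤ.- + B ℤ.+ + 1) (+ k)} hH
            v₂ , v₃ = ∧-true {inH a b c (+ c ℤ.- + B) (+ k ℤ.+ + 1)} v
            h₂ = inH⁻ (column B) c B (k + 1) (column₀ B) v₂
            h₃ = inH⁻ (column B ℤ.+ + 1) (c + 1) B (k + 1) (column₁ B) v₃
        in ℕP.≤-trans (ℕP.≤-reflexive (ℕP.+-comm 1 k)) (InH.k≤K h₃)
         , (ℕP.+-cancelˡ-≤ (c + 1) (suc k) (b + B) (ℕP.≤-trans (ℕP.≤-reflexive (cong (λ x → c + 1 + x) (ℕP.+-comm 1 k))) (ℕP.≤-trans (InH.north h₃) (ℕP.≤-reflexive (solveℕ 3 (λ b c B → b ⊕ c ⊕ κ 1 ⊕ B ≐ c ⊕ κ 1 ⊕ (b ⊕ B)) refl b c B))))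
           , wall hZ (InH.west h₂) , B<W (InH.west h₂))
        where
        wall : eastOfZ a (at dn k B) ≡ true → B ≤ c + suc a → B + B < suc k + 2 * suc c
        wall hZ west with k ℕP.≤? 2 * a
        ... | yes k≤2a = s≤s (begin
            B + B           ≤⟨ eastOfZ-dn⁻ k B k≤2a hZ ⟩
            c + c + k + 2   ≡⟨ solveℕ 2 (λ k c → c ⊕ c ⊕ k ⊕ κ 2 ≐ k ⊕ κ 2 ⊗ (κ 1 ⊕ c)) refl k c ⟩
            k + 2 * suc c   ∎)
        ... | no k≰2a = proj₁ (beyond k west (ℕP.≰⇒> k≰2a))

  -- Filtered lists and membership tests.

  filterᵇ-++ : ∀ (p : A → Bool) xs ys → filterᵇ p (xs ++ ys) ≡ filterᵇ p xs ++ filterᵇ p ys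
  filterᵇ-++ p []       ys = refl
  filterᵇ-++ p (x ∷ xs) ys with p x
  ... | true  = cong (x ∷_) (filterᵇ-++ p xs ys)
  ... | false = filterᵇ-++ p xs ys

  ∈-filterᵇ : ∀ (p : A → Bool) {x xs} → x ∈ xs → p x ≡ true → x ∈ filterᵇ p xs
  ∈-filterᵇ p {xs = y ∷ ys} (here refl) px rewrite px = here refl
  ∈-filterᵇ p {xs = y ∷ ys} (there x∈) px with p y
  ... | true  = there (∈-filterᵇ p x∈ px)
  ... | false = ∈-filterᵇ p x∈ px

  All-filterᵇ : ∀ (p : A → Bool) {P : A → Set} xs → (∀ x → p x ≡ true → P x) → All P (filterᵇ p xs)
  All-filterᵇ p []       f = []
  All-filterᵇ p (x ∷ xs) f with p x in eq
  ... | true  = f x eq ∷ All-filterᵇ p xs f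
  ... | false = All-filterᵇ p xs f

  concatMap-filterᵇ : ∀ (g : B → List C) (p : B → Bool) (h : A → List B) xs →
    concatMap g (filterᵇ p (concatMap h xs)) ≡ concatMap (λ x → concatMap g (filterᵇ p (h x))) xs
  concatMap-filterᵇ g p h []       = refl
  concatMap-filterᵇ g p h (x ∷ xs) = begin
      concatMap g (filterᵇ p (h x ++ concatMap h xs))                        ≡⟨ cong (concatMap g) (filterᵇ-++ p (h x) (concatMap h xs)) ⟩
      concatMap g (filterᵇ p (h x) ++ filterᵇ p (concatMap h xs))            ≡⟨ ListP.concatMap-++ g (filterᵇ p (h x)) _ ⟩
      concatMap g (filterᵇ p (h x)) ++ concatMap g (filterᵇ p (concatMap h xs)) ≡⟨ cong (concatMap g (filterᵇ p (h x)) ++_) (concatMap-filterᵇ g p h xs) ⟩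
      concatMap g (filterᵇ p (h x)) ++ concatMap (λ x → concatMap g (filterᵇ p (h x))) xs ∎
    where open ≡-Reasoning

  concatMap-filterᵇ-pair : ∀ (g : A → List B) (p : A → Bool) x y → g y ≡ [] →
    concatMap g (filterᵇ p (x ∷ y ∷ [])) ≡ (if p x then g x else [])
  concatMap-filterᵇ-pair g p x y gy≡[] with p x | p y
  ... | true  | true  rewrite gy≡[] = ListP.++-identityʳ (g x)
  ... | true  | false = ListP.++-identityʳ (g x)
  ... | false | true  rewrite gy≡[] = refl
  ... | false | false = refl

  concatMap-upTo-suc : ∀ (f : ℕ → List A) n → concatMap f (upTo (suc n)) ≡ concatMap f (upTo n) ++ f n
  concatMap-upTo-suc f n = begin
      concatMap f (upTo (suc n))         ≡⟨ cong (concatMap f) (ListP.upTo-∷ʳ n) ⟨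
      concatMap f (upTo n ∷ʳ n)          ≡⟨ ListP.concatMap-++ f (upTo n) (n ∷ []) ⟩
      concatMap f (upTo n) ++ (f n ++ []) ≡⟨ cong (concatMap f (upTo n) ++_) (ListP.++-identityʳ (f n)) ⟩
      concatMap f (upTo n) ++ f n        ∎
    where open ≡-Reasoning

  All-concatMap-upTo : ∀ {P : A → Set} (f : ℕ → List A) n → (∀ {j} → j < n → All P (f j)) → All P (concatMap f (upTo n))
  All-concatMap-upTo f n h = AllP.concat⁺ (AllP.map⁺ (AllP.applyUpTo⁺₁ (λ j → j) n h))

  ==T-refl : ∀ t → (t ==T t) ≡ true
  ==T-refl (tri o i k) = cong₂ _∧_ (oo o) (cong₂ _∧_ (dec-true (i ℤ.≟ i) refl) (dec-true (k ℤ.≟ k) refl))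
    where
    oo : ∀ o → (o ≟O o) ≡ true
    oo up = refl
    oo dn = refl

  ==T-sound : ∀ t s → (t ==T s) ≡ true → t ≡ s
  ==T-sound (tri o i k) (tri o′ i′ k′) h with ∧-true {o ≟O o′} h
  ... | ho , h′ with ∧-true {i ==ℤ i′} h′
  ... | hi , hk = cong₂ (λ { o (i , k) → tri o i k }) (oo o o′ ho) (cong₂ _,_ (zz i i′ hi) (zz k k′ hk))
    where
    oo : ∀ o o′ → (o ≟O o′) ≡ true → o ≡ o′
    oo up up _ = refl
    oo dn dn _ = refl
    zz : ∀ x y → (x ==ℤ y) ≡ true → x ≡ y
    zz x y h with x ℤ.≟ y
    ... | yes eq = eq

  ∈⇒∈ᵇ : ∀ {t R} → t ∈ R → (t ∈ᵇ R) ≡ true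
  ∈⇒∈ᵇ {t} (here refl) rewrite ==T-refl t = refl
  ∈⇒∈ᵇ {t} {s ∷ R} (there t∈R) with t ==T s
  ... | true  = refl
  ... | false = ∈⇒∈ᵇ t∈R

  ∈ᵇ⇒∈ : ∀ {t} R → (t ∈ᵇ R) ≡ true → t ∈ R
  ∈ᵇ⇒∈ {t} (s ∷ R) h with t ==T s in eq
  ... | true  = here (==T-sound t s eq)
  ... | false = there (∈ᵇ⇒∈ R h)

  ==ℤ-false : ∀ {x y} → x ≢ y → (x ==ℤ y) ≡ false
  ==ℤ-false {x} {y} x≢y = dec-false (x ℤ.≟ y) x≢y

  -- Coverage during the sweep.

  member : ℕ → List ℕ → Bool
  member x []       = false
  member x (y ∷ ys) = (x ℕ.≡ᵇ y) ∨ member x ys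

  ≡ᵇ-false : ∀ {x y} → x ≢ y → (x ℕ.≡ᵇ y) ≡ false
  ≡ᵇ-false {x} {y} x≢y = dec-false (x ℕP.≟ y) x≢y

  -- What is covered after placing the lozenges of all up triangles in rows above k and in the columns
  -- c - B′, B′ < B, of row k: q lists the down triangles of row k still to be covered from row k, and
  -- r the ones of row k - 1 with B′ < B to be covered from row k - 1.
  coverage : ℕ → ℕ → List ℕ → List ℕ → Orient → ℕ → ℕ → ℕ
  coverage zero          B q r o  (suc k′) B′ = 1
  coverage (suc k)       B q r o  (suc k′) B′ = coverage k B q r o k′ B′
  coverage (suc (suc k)) B q r o  zero     B′ = 0
  coverage zero          B q r up zero     B′ = bit (B′ ℕ.<ᵇ B)
  coverage zero          B q r dn zero     B′ = bit (not (member B′ q))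
  coverage (suc zero)    B q r up zero     B′ = 0
  coverage (suc zero)    B q r dn zero     B′ = bit (not ((B ℕ.≤ᵇ B′) ∨ member B′ r))

  touches : ℕ → ℕ → Dir → Orient → ℕ → ℕ → Bool
  touches k       B d  up k′ B′ = (k′ ℕ.≡ᵇ k) ∧ (B′ ℕ.≡ᵇ B)
  touches k       B d₀ dn k′ B′ = (k′ ℕ.≡ᵇ k) ∧ (B′ ℕ.≡ᵇ B)
  touches k       B d₁ dn k′ B′ = (k′ ℕ.≡ᵇ k) ∧ (B′ ℕ.≡ᵇ suc B)
  touches zero    B d₂ dn k′ B′ = false
  touches (suc k) B d₂ dn k′ B′ = (k′ ℕ.≡ᵇ k) ∧ (B′ ℕ.≡ᵇ B)

  <ᵇ-suc : ∀ x y → bit (x ℕ.<ᵇ suc y) ≡ bit (x ℕ.≡ᵇ y) + bit (x ℕ.<ᵇ y)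
  <ᵇ-suc zero    zero    = refl
  <ᵇ-suc zero    (suc y) = refl
  <ᵇ-suc (suc x) zero    = refl
  <ᵇ-suc (suc x) (suc y) = <ᵇ-suc x y

  ≤ᵇ-suc : ∀ x y → (x ℕ.≤ᵇ y) ≡ (suc x ℕ.≤ᵇ y) ∨ (y ℕ.≡ᵇ x)
  ≤ᵇ-suc zero    zero    = refl
  ≤ᵇ-suc zero    (suc y) = refl
  ≤ᵇ-suc (suc x) zero    = refl
  ≤ᵇ-suc (suc zero) (suc y) = ≤ᵇ-suc zero y
  ≤ᵇ-suc (suc (suc x)) (suc y) = ≤ᵇ-suc (suc x) y

  member-remove : ∀ x y q → member y q ≡ false →
    bit (not (member x q)) ≡ bit (x ℕ.≡ᵇ y) + bit (not ((x ℕ.≡ᵇ y) ∨ member x q))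
  member-remove x y q h with x ℕ.≡ᵇ y in eq
  ... | false = refl
  ... | true with refl ← ℕP.≡ᵇ⇒≡ x y (true→T eq) rewrite h = refl

  pending-keep : ∀ B x r → ((suc B ℕ.≤ᵇ x) ∨ ((x ℕ.≡ᵇ B) ∨ member x r)) ≡ ((B ℕ.≤ᵇ x) ∨ member x r)
  pending-keep B x r = trans (sym (BoolP.∨-assoc (suc B ℕ.≤ᵇ x) (x ℕ.≡ᵇ B) (member x r))) (cong (_∨ member x r) (sym (≤ᵇ-suc B x)))

  pending-drop : ∀ B x r → x ≢ B → ((suc B ℕ.≤ᵇ x) ∨ member x r) ≡ ((B ℕ.≤ᵇ x) ∨ member x r)
  pending-drop B x r x≢B = trans (cong (λ z → (suc B ℕ.≤ᵇ x) ∨ (z ∨ member x r)) (sym (≡ᵇ-false x≢B))) (pending-keep B x r)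

  pending-cover : ∀ B x r → member B r ≡ false →
    bit (not ((suc B ℕ.≤ᵇ x) ∨ member x r)) ≡ bit (x ℕ.≡ᵇ B) + bit (not ((B ℕ.≤ᵇ x) ∨ member x r))
  pending-cover B x r h with x ℕP.≟ B
  ... | no x≢B rewrite ≡ᵇ-false x≢B = cong (bit ∘ not) (pending-drop B x r x≢B)
  ... | yes refl rewrite T→true (ℕP.≡⇒≡ᵇ x x refl) | T→true (ℕP.≤⇒≤ᵇ (ℕP.≤-refl {x})) | h
                       | BoolP.¬-not {suc x ℕ.≤ᵇ x} (λ eq → ℕP.<-irrefl refl (ℕP.≤ᵇ⇒≤ (suc x) x (true→T eq))) = refl

  -- This lozenge meets the demand `B` of `q`. It occupies the up triangle at `B`, so the down
  -- triangle below that must be covered from its own row, which is why `B` enters `r`. With `d₂`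
  -- that lower triangle is the one covered, and `r` stays.
  coverage-d₀ : ∀ k B q r o k′ B′ → member B q ≡ false →
    coverage k (suc B) q (B ∷ r) o k′ B′ ≡ bit (touches k B d₀ o k′ B′) + coverage k B (B ∷ q) r o k′ B′
  coverage-d₀ zero          B q r up zero     B′ h = <ᵇ-suc B′ B
  coverage-d₀ zero          B q r dn zero     B′ h = member-remove B′ B q h
  coverage-d₀ zero          B q r up (suc k′) B′ h = refl
  coverage-d₀ zero          B q r dn (suc k′) B′ h = refl
  coverage-d₀ (suc k)       B q r up (suc k′) B′ h = coverage-d₀ k B q r up k′ B′ h
  coverage-d₀ (suc k)       B q r dn (suc k′) B′ h = coverage-d₀ k B q r dn k′ B′ h
  coverage-d₀ (suc zero)    B q r up zero     B′ h = refl
  coverage-d₀ (suc zero)    B q r dn zero     B′ h = cong (bit ∘ not) (pending-keep B B′ r)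
  coverage-d₀ (suc (suc k)) B q r up zero     B′ h = refl
  coverage-d₀ (suc (suc k)) B q r dn zero     B′ h = refl

  coverage-d₁ : ∀ k B q r o k′ B′ → member (suc B) q ≡ false →
    coverage k (suc B) q (B ∷ r) o k′ B′ ≡ bit (touches k B d₁ o k′ B′) + coverage k B (suc B ∷ q) r o k′ B′
  coverage-d₁ zero          B q r up zero     B′ h = <ᵇ-suc B′ B
  coverage-d₁ zero          B q r dn zero     B′ h = member-remove B′ (suc B) q h
  coverage-d₁ zero          B q r up (suc k′) B′ h = refl
  coverage-d₁ zero          B q r dn (suc k′) B′ h = refl
  coverage-d₁ (suc k)       B q r up (suc k′) B′ h = coverage-d₁ k B q r up k′ B′ h
  coverage-d₁ (suc k)       B q r dn (suc k′) B′ h = coverage-d₁ k B q r dn k′ B′ h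
  coverage-d₁ (suc zero)    B q r up zero     B′ h = refl
  coverage-d₁ (suc zero)    B q r dn zero     B′ h = cong (bit ∘ not) (pending-keep B B′ r)
  coverage-d₁ (suc (suc k)) B q r up zero     B′ h = refl
  coverage-d₁ (suc (suc k)) B q r dn zero     B′ h = refl

  coverage-d₂ : ∀ k B q r o k′ B′ → member B r ≡ false →
    coverage (suc k) (suc B) q r o k′ B′ ≡ bit (touches (suc k) B d₂ o k′ B′) + coverage (suc k) B q r o k′ B′
  coverage-d₂ zero    B q r up zero           B′ h = refl
  coverage-d₂ zero    B q r dn zero           B′ h = pending-cover B B′ r h
  coverage-d₂ zero    B q r up (suc zero)     B′ h = <ᵇ-suc B′ B
  coverage-d₂ zero    B q r up (suc (suc k′)) B′ h = refl
  coverage-d₂ zero    B q r dn (suc zero)     B′ h = refl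
  coverage-d₂ zero    B q r dn (suc (suc k′)) B′ h = refl
  coverage-d₂ (suc k) B q r up zero           B′ h = refl
  coverage-d₂ (suc k) B q r dn zero           B′ h = refl
  coverage-d₂ (suc k) B q r up (suc k′)       B′ h = coverage-d₂ k B q r up k′ B′ h
  coverage-d₂ (suc k) B q r dn (suc k′)       B′ h = coverage-d₂ k B q r dn k′ B′ h

  coverage-skip : ∀ k B q r o k′ B′ → (o ≡ up → k′ ≡ k → B′ ≢ B) → (o ≡ dn → suc k′ ≡ k → B′ ≢ B) →
    coverage k (suc B) q r o k′ B′ ≡ coverage k B q r o k′ B′
  coverage-skip zero          B q r up zero     B′ h h′ = trans (<ᵇ-suc B′ B) (cong (λ z → bit z + bit (B′ ℕ.<ᵇ B)) (≡ᵇ-false (h refl refl)))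
  coverage-skip zero          B q r dn zero     B′ h h′ = refl
  coverage-skip zero          B q r o  (suc k′) B′ h h′ = refl
  coverage-skip (suc k)       B q r o  (suc k′) B′ h h′ = coverage-skip k B q r o k′ B′ (λ eq → h eq ∘ cong suc) (λ eq → h′ eq ∘ cong suc)
  coverage-skip (suc zero)    B q r up zero     B′ h h′ = refl
  coverage-skip (suc zero)    B q r dn zero     B′ h h′ = cong (bit ∘ not) (pending-drop B B′ r (h′ refl refl))
  coverage-skip (suc (suc k)) B q r o  zero     B′ h h′ = refl

  -- This models the removed triangle: no lozenge starts in column `B`, yet the down triangle under
  -- its base waits to be covered from its own row, so `B` enters `r`. In `coverage-skip` that down
  -- triangle is no concern either.
  coverage-keep : ∀ k B q r o k′ B′ → (o ≡ up → k′ ≡ k → B′ ≢ B) →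
    coverage k (suc B) q (B ∷ r) o k′ B′ ≡ coverage k B q r o k′ B′
  coverage-keep zero          B q r up zero     B′ h = trans (<ᵇ-suc B′ B) (cong (λ z → bit z + bit (B′ ℕ.<ᵇ B)) (≡ᵇ-false (h refl refl)))
  coverage-keep zero          B q r dn zero     B′ h = refl
  coverage-keep zero          B q r o  (suc k′) B′ h = refl
  coverage-keep (suc k)       B q r o  (suc k′) B′ h = coverage-keep k B q r o k′ B′ (λ eq → h eq ∘ cong suc)
  coverage-keep (suc zero)    B q r up zero     B′ h = refl
  coverage-keep (suc zero)    B q r dn zero     B′ h = cong (bit ∘ not) (pending-keep B B′ r)
  coverage-keep (suc (suc k)) B q r o  zero     B′ h = refl

  -- What a finished row leaves in `r` is the demand of the row below. Only membership matters, so
  -- `r` may be reversed on the way.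
  coverage-next-row : ∀ k W q r o k′ B′ → B′ < W → member B′ r ≡ member B′ q →
    coverage (suc k) W [] r o k′ B′ ≡ coverage k 0 q [] o k′ B′
  coverage-next-row zero    W q r up zero           B′ lt h = refl
  coverage-next-row zero    W q r dn zero           B′ lt h
    rewrite BoolP.¬-not {W ℕ.≤ᵇ B′} (λ eq → ℕP.<⇒≱ lt (ℕP.≤ᵇ⇒≤ W B′ (true→T eq))) = cong (bit ∘ not) h
  coverage-next-row zero    W q r up (suc zero)     B′ lt h = cong bit (T→true (ℕP.<⇒<ᵇ lt))
  coverage-next-row zero    W q r dn (suc zero)     B′ lt h = refl
  coverage-next-row zero    W q r o  (suc (suc k′)) B′ lt h = refl
  coverage-next-row (suc k) W q r o  (suc k′)       B′ lt h = coverage-next-row k W q r o k′ B′ lt h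
  coverage-next-row (suc zero)    W q r up zero     B′ lt h = refl
  coverage-next-row (suc zero)    W q r dn zero     B′ lt h = refl
  coverage-next-row (suc (suc k)) W q r o  zero     B′ lt h = refl

  coverage-up : ∀ k B q r → coverage k B q r up k B ≡ 0
  coverage-up zero    B q r = cong bit (BoolP.¬-not {B ℕ.<ᵇ B} (λ eq → ℕP.<-irrefl refl (ℕP.<ᵇ⇒< B B (true→T eq))))
  coverage-up (suc k) B q r = coverage-up k B q r

  coverage-dn : ∀ k B q r x → coverage k B q r dn k x ≡ bit (not (member x q))
  coverage-dn zero    B q r x = refl
  coverage-dn (suc k) B q r x = coverage-dn k B q r x

  -- The list of lozenges in row order.

  module Lozenges (a b c : ℕ) where

    open Geometry a b c

    R : Region
    R = S a b c

    -- Rows are at least 0 and `i + 1` is at most `c + 1`, which gives natural indices; all later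
    -- arguments can therefore be made for triangles of the form `at o k B`.
    locate : ∀ o i k → inside (tri o i k) ≡ true → ∃₂ λ k′ B → i ≡ column B × k ≡ + k′
    locate o i k h = k′ , ℤ.∣ + c ℤ.- i ∣ , i≡ , k≡
      where
      open ℤS.+-*-Solver
      bounds : ∀ o → inside (tri o i k) ≡ true → (+ 0 ℤ.≤ᵇ k) ≡ true × (i ℤ.+ + 1 ℤ.≤ᵇ + suc c) ≡ true
      bounds up h =
        let hH , _  = ∧-true {triInH a b c (tri up i k)} h
            _  , v  = ∧-true {inH a b c i k} hH
            v₂ , _  = ∧-true {inH a b c (i ℤ.+ + 1) k} v
            h₁ , h₂ = ∧-true {+ 0 ℤ.≤ᵇ k} v₂
            _  , h₃ = ∧-true {k ℤ.≤ᵇ + K} h₂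
            _  , h₄ = ∧-true {ℤ.- (+ suc a) ℤ.≤ᵇ (i ℤ.+ + 1)} h₃
        in h₁ , proj₁ (∧-true {i ℤ.+ + 1 ℤ.≤ᵇ + suc c} h₄)
      bounds dn h =
        let hH , _  = ∧-true {triInH a b c (tri dn i k)} h
            v₂ , _  = ∧-true {inH a b c (i ℤ.+ + 1) k} hH
            h₁ , h₂ = ∧-true {+ 0 ℤ.≤ᵇ k} v₂
            _  , h₃ = ∧-true {k ℤ.≤ᵇ + K} h₂
            _  , h₄ = ∧-true {ℤ.- (+ suc a) ℤ.≤ᵇ (i ℤ.+ + 1)} h₃
        in h₁ , proj₁ (∧-true {i ℤ.+ + 1 ℤ.≤ᵇ + suc c} h₄)
      nonneg : ∀ k → (+ 0 ℤ.≤ᵇ k) ≡ true → ∃ λ m → k ≡ + m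
      nonneg (+ m) _ = m , refl
      k′ = proj₁ (nonneg k (proj₁ (bounds o h)))
      k≡ = proj₂ (nonneg k (proj₁ (bounds o h)))
      0≤c-i : + 0 ℤ.≤ + c ℤ.- i
      0≤c-i = subst₂ ℤ._≤_ (solve 1 (λ i → i :+ con (+ 1) :+ (:- i :- con (+ 1)) := con (+ 0)) refl i)
        (solve 2 (λ i c → con (+ 1) :+ c :+ (:- i :- con (+ 1)) := c :- i) refl i (+ c))
        (ℤP.+-monoˡ-≤ (ℤ.- i ℤ.- + 1) (ℤP.≤ᵇ⇒≤ {i ℤ.+ + 1} {+ suc c} (true→T (proj₂ (bounds o h)))))
      i≡ : i ≡ column ℤ.∣ + c ℤ.- i ∣
      i≡ = trans (solve 2 (λ i c → i := c :- (c :- i)) refl i (+ c)) (cong (λ z → + c ℤ.- z) (sym (ℤP.0≤i⇒+∣i∣≡i 0≤c-i)))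

    -- The list runs through the columns from the west, whereas `B` counts from the east.
    column-index : ∀ j B → j + B ≡ a + c + 1 → + j ℤ.- + suc a ≡ column B
    column-index j B eq = begin
        + j ℤ.- + suc a                      ≡⟨ solve 3 (λ j B a → j :- a := (j :+ B) :- B :- a) refl (+ j) (+ B) (+ suc a) ⟩
        + (j + B) ℤ.- + B ℤ.- + suc a        ≡⟨ cong (λ z → + z ℤ.- + B ℤ.- + suc a) eq ⟩
        + (a + c + 1) ℤ.- + B ℤ.- + suc a    ≡⟨ solve 3 (λ a c B → (a :+ c :+ con (+ 1)) :- B :- (con (+ 1) :+ a) := c :- B) refl (+ a) (+ c) (+ B) ⟩
        + c ℤ.- + B                          ∎
      where
      open ℤS.+-*-Solver
      open ≡-Reasoning

    inside-bounds : ∀ o k B → inside (at o k B) ≡ true → k < K × B < W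
    inside-bounds up k B h = let k<K , (_ , _ , B<W) , _ = up-inside⁻ k B h in k<K , B<W
    inside-bounds dn k B h = let k<K , (_ , _ , B<W) = dn-inside⁻ k B h in k<K , B<W

    inside⇒∈ : ∀ o k B → inside (at o k B) ≡ true → at o k B ∈ R
    inside⇒∈ o k B h = ∈-filterᵇ inside (∈P.∈-concatMap⁺ _ (lose (∈P.∈-upTo⁺ k<) (∈P.∈-concatMap⁺ _ (lose (∈P.∈-upTo⁺ j<) (cell o))))) h
      where
      k< : k < a + b + 3
      k< = ℕP.≤-trans (proj₁ (inside-bounds o k B h)) (ℕP.+-monoʳ-≤ (a + b) (s≤s (s≤s z≤n)))
      B≤ : B ≤ a + c + 1
      B≤ = ℕP.≤-pred (ℕP.≤-trans (proj₂ (inside-bounds o k B h)) (ℕP.≤-reflexive (ℕP.+-suc (a + c) 1)))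
      j : ℕ
      j = a + c + 1 ∸ B
      j< : j < a + c + 3
      j< = ℕP.≤-<-trans (ℕP.m∸n≤m (a + c + 1) B) (ℕP.+-monoʳ-< (a + c) (s≤s (s≤s z≤n)))
      i≡ : + j ℤ.- + suc a ≡ column B
      i≡ = column-index j B (ℕP.m∸n+n≡m B≤)
      cell : ∀ o → at o k B ∈ (tri up (+ j ℤ.- + suc a) (+ k) ∷ tri dn (+ j ℤ.- + suc a) (+ k) ∷ [])
      cell up = here (cong (λ z → tri up z (+ k)) (sym i≡))
      cell dn = there (here (cong (λ z → tri dn z (+ k)) (sym i≡)))

    ∈ᵇ-inside : ∀ t → (t ∈ᵇ R) ≡ inside t
    ∈ᵇ-inside t@(tri o i k) = bool-ext
      (λ h → All.lookup (All-filterᵇ inside (box a b c) (λ _ eq → eq)) (∈ᵇ⇒∈ R h))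
      (λ h → ∈⇒∈ᵇ (mem h))
      where
      mem : inside t ≡ true → t ∈ R
      mem h with locate o i k h
      ... | k′ , B , refl , refl = inside⇒∈ o k′ B h

    keep : ℤ → ℤ → Dir → List Lozenge → List Lozenge
    keep i k d ls = if inside (partner i k d) then loz i k d ∷ ls else ls

    lozengesAt : ℤ → ℤ → List Lozenge
    lozengesAt i k = if inside (tri up i k) then keep i k d₀ (keep i k d₁ (keep i k d₂ [])) else []

    row : ℕ → ℕ → List Lozenge
    row k n = concatMap (λ j → lozengesAt (+ j ℤ.- + suc a) (+ k)) (upTo n)

    below : ℕ → List Lozenge
    below k = concatMap (λ k → row k (a + c + 3)) (upTo k)

    -- Filtering keeps the row order of `box`, and down triangles contribute no lozenges. In this
    -- form rows, and columns within a row, can be split off at the end of the list.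
    lozengesIn≡below : lozengesIn R ≡ below (a + b + 3)
    lozengesIn≡below = begin
        lozengesIn R
          ≡⟨ ListP.concatMap-cong {g = lozengesOf} (λ { (tri dn _ _) → refl ; (tri up i k) → kept i k d₀ (kept i k d₁ (kept i k d₂ refl)) }) R ⟩
        concatMap lozengesOf R
          ≡⟨ concatMap-filterᵇ lozengesOf inside _ (upTo (a + b + 3)) ⟩
        concatMap (λ k → concatMap lozengesOf (filterᵇ inside (boxRow k))) (upTo (a + b + 3))
          ≡⟨ ListP.concatMap-cong (λ k → trans (concatMap-filterᵇ lozengesOf inside _ (upTo (a + c + 3)))
               (ListP.concatMap-cong (λ j → cell (+ j ℤ.- + suc a) (+ k)) (upTo (a + c + 3)))) (upTo (a + b + 3)) ⟩
        below (a + b + 3) ∎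
      where
      open ≡-Reasoning
      boxRow : ℕ → List Tri
      boxRow k = concatMap (λ j → tri up (+ j ℤ.- + suc a) (+ k) ∷ tri dn (+ j ℤ.- + suc a) (+ k) ∷ []) (upTo (a + c + 3))
      lozengesOf : Tri → List Lozenge
      lozengesOf (tri dn _ _) = []
      lozengesOf (tri up i k) = keep i k d₀ (keep i k d₁ (keep i k d₂ []))
      keep-cong : ∀ {x y} (l : Lozenge) {ls ls′} → x ≡ y → ls ≡ ls′ → (if x then l ∷ ls else ls) ≡ (if y then l ∷ ls′ else ls′)
      keep-cong l refl refl = refl
      kept : ∀ i k d {ls ls′} → ls ≡ ls′ → (if partner i k d ∈ᵇ R then loz i k d ∷ ls else ls) ≡ keep i k d ls′
      kept i k d = keep-cong (loz i k d) (∈ᵇ-inside (partner i k d))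
      cell : ∀ i k → concatMap lozengesOf (filterᵇ inside (tri up i k ∷ tri dn i k ∷ [])) ≡ lozengesAt i k
      cell i k = concatMap-filterᵇ-pair lozengesOf inside (tri up i k) (tri dn i k) refl

  -- Monotone lists of positions.

  ≤ᵇ-false : ∀ {x y} → ¬ x ≤ y → (x ℕ.≤ᵇ y) ≡ false
  ≤ᵇ-false {x} {y} x≰y = BoolP.¬-not (λ eq → x≰y (ℕP.≤ᵇ⇒≤ x y (true→T eq)))

  member-increasing : ∀ {lo x} q → Increasing lo q → x < lo → member x q ≡ false
  member-increasing []       inc          x<lo = refl
  member-increasing (y ∷ ys) (lo≤y , inc) x<lo = cong₂ _∨_ (≡ᵇ-false (ℕP.<⇒≢ (ℕP.≤-trans x<lo lo≤y)))
    (member-increasing ys inc (ℕP.≤-trans x<lo (ℕP.m≤n⇒m≤1+n lo≤y)))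

  Decreasing : ℕ → List ℕ → Set
  Decreasing hi []       = ⊤
  Decreasing hi (x ∷ xs) = x < hi × Decreasing x xs

  member-decreasing : ∀ {hi x} r → Decreasing hi r → hi ≤ x → member x r ≡ false
  member-decreasing []       dec          hi≤x = refl
  member-decreasing (y ∷ ys) (y<hi , dec) hi≤x = cong₂ _∨_ (≡ᵇ-false (ℕP.<⇒≢ (ℕP.≤-trans y<hi hi≤x) ∘ sym))
    (member-decreasing ys dec (ℕP.≤-trans (ℕP.<⇒≤ y<hi) hi≤x))

  Decreasing-weaken : ∀ {l m} r → l ≤ m → Decreasing l r → Decreasing m r
  Decreasing-weaken []       l≤m _          = tt
  Decreasing-weaken (z ∷ zs) l≤m (z<l , dec) = ℕP.≤-trans z<l l≤m , dec

  Increasing-ʳ++ : ∀ {hi} r p → Decreasing hi r → Increasing hi p → Increasing 0 (r ʳ++ p)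
  Increasing-ʳ++ []      p dec          inc = Increasing-weaken p z≤n inc
  Increasing-ʳ++ (x ∷ r) p (x<hi , dec) inc = Increasing-ʳ++ r (x ∷ p) dec (ℕP.≤-refl , Increasing-weaken p x<hi inc)

  member-ʳ++ : ∀ x r p → member x (r ʳ++ p) ≡ member x r ∨ member x p
  member-ʳ++ x []      p = refl
  member-ʳ++ x (y ∷ r) p = trans (member-ʳ++ x r (y ∷ p)) (swap (member x r) (x ℕ.≡ᵇ y) (member x p))
    where
    swap : ∀ u v w → u ∨ (v ∨ w) ≡ (v ∨ u) ∨ w
    swap u v w = trans (sym (BoolP.∨-assoc u v w)) (cong (_∨ w) (BoolP.∨-comm u v))

  All-ʳ++ : ∀ {P : ℕ → Set} {r p} → All P r → All P p → All P (r ʳ++ p)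
  All-ʳ++ []        ps = ps
  All-ʳ++ (px ∷ pr) ps = All-ʳ++ pr (px ∷ ps)

  -- The sweep of a row goes through growing `B`, and from that row the down triangle at `B` can be
  -- covered only by the up triangles at `B` and `B - 1`. So a demand at `B` (`here`) forces `d₀`, a
  -- demand at `suc B` (`next`) leaves `d₁` or `d₂`, and otherwise (`far`) only `d₂` remains.
  data HeadView (B : ℕ) : List ℕ → Set where
    here : ∀ {q} → Increasing (suc B) q → HeadView B (B ∷ q)
    next : ∀ {q} → Increasing (2 + B) q → HeadView B (suc B ∷ q)
    far  : ∀ {q} → Increasing (2 + B) q → HeadView B q

  headView : ∀ B q → Increasing B q → HeadView B q
  headView B []      inc = far tt
  headView B (y ∷ q) (B≤y , inc) with ℕP.m≤n⇒m<n∨m≡n B≤y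
  ... | inj₂ refl = here inc
  ... | inj₁ B<y with ℕP.m≤n⇒m<n∨m≡n B<y
  ...   | inj₂ refl = next inc
  ...   | inj₁ B+1<y = far (B+1<y , inc)

  strictSum-here : ∀ B h q → strictSum B h (B ∷ q) ≡ strictSum (suc B) (h ∘ (B ∷_)) q
  strictSum-here zero    h q = refl
  strictSum-here (suc B) h q rewrite ≤ᵇ-false (ℕP.<-irrefl (refl {x = B})) = ℚP.+-identityˡ _

  strictSum-next : ∀ B h q → strictSum B h (suc B ∷ q) ≡ strictSum (suc B) (h ∘ (B ∷_)) q ℚ.+ strictSum (suc B) h (suc B ∷ q)
  strictSum-next B h q rewrite T→true (ℕP.≤⇒≤ᵇ (ℕP.≤-refl {B})) = cong (ℚ._+_ (strictSum (suc B) (h ∘ (B ∷_)) q)) (sym (strictSum-here (suc B) h q))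

  strictSum-far : ∀ B h q → Increasing (2 + B) q → strictSum B h q ≡ strictSum (suc B) h q
  strictSum-far B h []          inc = refl
  strictSum-far B h (suc y ∷ q) (s≤s B<y , inc)
    rewrite T→true (ℕP.≤⇒≤ᵇ (ℕP.<⇒≤ B<y)) | T→true (ℕP.≤⇒≤ᵇ B<y) = refl

  -- Every argument at which `strictSum` evaluates `h` is again increasing from `lo`, of the same
  -- length and below the same bound, so vanishing on those is enough.
  strictSum-zero : ∀ lo h q {m} → Increasing lo q → All (_≤ m) q →
    (∀ p → Increasing lo p → length p ≡ length q → All (_≤ m) p → h p ≡ 0ℚ) → strictSum lo h q ≡ 0ℚ
  strictSum-zero lo h []          inc          []          h≗0 = h≗0 [] tt refl []
  strictSum-zero lo h (zero ∷ q)  (lo≤ , inc)  (_ ∷ q≤m)   h≗0 = strictSum-zero 1 (h ∘ (0 ∷_)) q inc q≤m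
    (λ p incp len p≤m → h≗0 (0 ∷ p) (lo≤ , incp) (cong suc len) (z≤n ∷ p≤m))
  strictSum-zero lo h (suc y ∷ q) (lo≤ , inc)  (y<m ∷ q≤m) h≗0 = cong₂ ℚ._+_ first
    (strictSum-zero (2 + y) (h ∘ (suc y ∷_)) q inc q≤m (λ p incp len p≤m → h≗0 (suc y ∷ p) (lo≤ , incp) (cong suc len) (y<m ∷ p≤m)))
    where
    first : (if lo ℕ.≤ᵇ y then strictSum (suc y) (h ∘ (y ∷_)) q else 0ℚ) ≡ 0ℚ
    first with lo ℕ.≤ᵇ y in eq
    ... | false = refl
    ... | true  = strictSum-zero (suc y) (h ∘ (y ∷_)) q (Increasing-weaken q (ℕP.n≤1+n (suc y)) inc) q≤m
      (λ p incp len p≤m → h≗0 (y ∷ p) (ℕP.≤ᵇ⇒≤ lo y (true→T eq) , incp) (cong suc len) (ℕP.<⇒≤ y<m ∷ p≤m))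

  Increasing-length : ∀ lo p {m} → Increasing lo p → All (_< m) p → lo ≤ m → lo + length p ≤ m
  Increasing-length lo []      inc          []          lo≤m = ℕP.≤-trans (ℕP.≤-reflexive (ℕP.+-identityʳ lo)) lo≤m
  Increasing-length lo (x ∷ p) (lo≤x , inc) (x<m ∷ p<m) lo≤m =
    ℕP.≤-trans (ℕP.≤-reflexive (ℕP.+-suc lo (length p))) (ℕP.≤-trans (ℕP.+-monoˡ-≤ (length p) (s≤s lo≤x)) (Increasing-length (suc x) p inc p<m x<m))

  -- Pigeonhole: as many entries as the interval has points leave no gap. On the bottom line this
  -- identifies the positions with the starting points.
  Increasing-range : ∀ lo p → Increasing lo p → All (_< lo + length p) p → p ≡ range lo (length p)
  Increasing-range lo []      inc          []        = refl
  Increasing-range lo (x ∷ p) (lo≤x , inc) (x< ∷ p<) = cong₂ _∷_ (sym lo≡x)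
    (trans (Increasing-range (suc x) p inc (All.map (λ y< → ℕP.≤-trans y< (ℕP.≤-reflexive (trans (cong (_+ suc (length p)) lo≡x) (ℕP.+-suc x (length p))))) p<))
           (cong (λ z → range (suc z) (length p)) (sym lo≡x)))
    where
    lo≡x : lo ≡ x
    lo≡x = ℕP.≤-antisym lo≤x (ℕP.≤-pred (ℕP.+-cancelʳ-≤ (length p) (suc x) (suc lo)
      (ℕP.≤-trans (Increasing-length (suc x) p inc p< x<) (ℕP.≤-reflexive (ℕP.+-suc lo (length p))))))

  member-range : ∀ lo n x → lo ≤ x → x < lo + n → member x (range lo n) ≡ true
  member-range lo zero    x lo≤x x< = contradiction lo≤x (ℕP.<⇒≱ (ℕP.≤-trans x< (ℕP.≤-reflexive (ℕP.+-identityʳ lo))))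
  member-range lo (suc n) x lo≤x x< with ℕP.m≤n⇒m<n∨m≡n lo≤x
  ... | inj₂ refl rewrite T→true (ℕP.≡⇒≡ᵇ x x refl) = refl
  ... | inj₁ lo<x = trans (cong ((x ℕ.≡ᵇ lo) ∨_) (member-range (suc lo) n x lo<x (ℕP.≤-trans x< (ℕP.≤-reflexive (ℕP.+-suc lo n))))) (BoolP.∨-zeroʳ (x ℕ.≡ᵇ lo))

  split-max : ∀ {m} p → All (_≤ m) p → (∃₂ λ rs ys → p ≡ rs ++ m ∷ ys) ⊎ All (_< m) p
  split-max []      []          = inj₂ []
  split-max (x ∷ p) (x≤m ∷ p≤m) with ℕP.m≤n⇒m<n∨m≡n x≤m
  ... | inj₂ refl = inj₁ ([] , p , refl)
  ... | inj₁ x<m with split-max p p≤m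
  ...   | inj₁ (rs , ys , eq) = inj₁ (x ∷ rs , ys , cong (x ∷_) eq)
  ...   | inj₂ p<m = inj₂ (x<m ∷ p<m)

  -- Branching at one up triangle.

  Earlier : ℕ → ℤ → Lozenge → Set
  Earlier k i (loz i′ k′ d) = k′ ℤ.< + k ⊎ (k′ ≡ + k × i′ ℤ.< i)

  pred-≢ : ∀ {x y} → x ℤ.≤ y → x ℤ.- + 1 ≢ y
  pred-≢ {x} {y} x≤y refl = ℤP.<-irrefl refl (ℤP.<-≤-trans (subst₂ ℤ._<_ (ℤP.+-identityʳ (x ℤ.- + 1)) minus-plus (ℤP.+-monoʳ-< (x ℤ.- + 1) (ℤ.+<+ (s≤s z≤n)))) x≤y)
    where
    minus-plus : x ℤ.- + 1 ℤ.+ + 1 ≡ x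
    minus-plus = solve 1 (λ x → x :- con (+ 1) :+ con (+ 1) := x) refl x
      where open ℤS.+-*-Solver

  -- The partner of an up triangle has the same coordinates, or lies one column to the west or one
  -- row below, hence never later in the order. Lozenges left in the list therefore cannot reach the
  -- current triangles.
  earlier-covers : ∀ k i l → Earlier k i l → ∀ o → covers l (tri o i (+ k)) ≡ false
  earlier-covers k i (loz i′ k′ d) ear up = cong₂ _∨_ (first ear) (other d)
    where
    first : Earlier k i (loz i′ k′ d) → (tri up i (+ k) ==T tri up i′ k′) ≡ false
    first (inj₁ k′<k) = trans (cong ((i ==ℤ i′) ∧_) (==ℤ-false (ℤP.<⇒≢ k′<k ∘ sym))) (BoolP.∧-zeroʳ _)
    first (inj₂ (_ , i′<i)) = cong (_∧ ((+ k) ==ℤ k′)) (==ℤ-false (ℤP.<⇒≢ i′<i ∘ sym))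
    other : ∀ d → (tri up i (+ k) ==T partner i′ k′ d) ≡ false
    other d₀ = refl
    other d₁ = refl
    other d₂ = refl
  earlier-covers k i (loz i′ k′ d₀) (inj₁ k′<k) dn = trans (cong ((i ==ℤ i′) ∧_) (==ℤ-false (ℤP.<⇒≢ k′<k ∘ sym))) (BoolP.∧-zeroʳ _)
  earlier-covers k i (loz i′ k′ d₁) (inj₁ k′<k) dn = trans (cong ((i ==ℤ (i′ ℤ.- + 1)) ∧_) (==ℤ-false (ℤP.<⇒≢ k′<k ∘ sym))) (BoolP.∧-zeroʳ _)
  earlier-covers k i (loz i′ k′ d₂) (inj₁ k′<k) dn = trans (cong ((i ==ℤ i′) ∧_) (==ℤ-false (pred-≢ (ℤP.<⇒≤ k′<k) ∘ sym))) (BoolP.∧-zeroʳ _)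
  earlier-covers k i (loz i′ k′ d₀) (inj₂ (_ , i′<i)) dn = cong (_∧ ((+ k) ==ℤ k′)) (==ℤ-false (ℤP.<⇒≢ i′<i ∘ sym))
  earlier-covers k i (loz i′ k′ d₁) (inj₂ (_ , i′<i)) dn = cong (_∧ ((+ k) ==ℤ k′)) (==ℤ-false (pred-≢ (ℤP.<⇒≤ i′<i) ∘ sym))
  earlier-covers k i (loz i′ k′ d₂) (inj₂ (k′≡k , _)) dn = trans (cong ((i ==ℤ i′) ∧_) (==ℤ-false (pred-≢ (ℤP.≤-reflexive k′≡k) ∘ sym))) (BoolP.∧-zeroʳ _)

  module Transfer (a b c : ℕ) where

    open Geometry a b c
    open Lozenges a b c

    -- Agreement is asked on triangles of the region only: `coverage` counts whole rows as covered,
    -- also where they leave the region.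
    Represents : (Tri → ℕ) → (Orient → ℕ → ℕ → ℕ) → Set
    Represents e f = ∀ o k B → inside (at o k B) ≡ true → e (at o k B) ≡ f o k B

    column-suc : ∀ B → column B ℤ.- + 1 ≡ column (suc B)
    column-suc B = solve 2 (λ c B → c :- B :- con (+ 1) := c :- (con (+ 1) :+ B)) refl (+ c) (+ B)
      where open ℤS.+-*-Solver

    covers-at : ∀ k B d o k′ B′ → covers (loz (column B) (+ k) d) (at o k′ B′) ≡ touches k B d o k′ B′
    covers-at k B d up k′ B′ = trans (cong₂ _∨_ (trans (==T-at up k′ B′ up k B) (BoolP.∧-comm (B′ ℕ.≡ᵇ B) (k′ ℕ.≡ᵇ k))) (other d)) (BoolP.∨-identityʳ _)
      where
      other : ∀ d → (at up k′ B′ ==T partner (column B) (+ k) d) ≡ false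
      other d₀ = refl
      other d₁ = refl
      other d₂ = refl
    covers-at k B d₀ dn k′ B′ = trans (==T-at dn k′ B′ dn k B) (BoolP.∧-comm (B′ ℕ.≡ᵇ B) (k′ ℕ.≡ᵇ k))
    covers-at k B d₁ dn k′ B′ = trans (cong (λ i → at dn k′ B′ ==T tri dn i (+ k)) (column-suc B))
      (trans (==T-at dn k′ B′ dn k (suc B)) (BoolP.∧-comm (B′ ℕ.≡ᵇ suc B) (k′ ℕ.≡ᵇ k)))
    covers-at zero    B d₂ dn k′ B′ = BoolP.∧-zeroʳ (column B′ ==ℤ column B)
    covers-at (suc k) B d₂ dn k′ B′ = trans (==T-at dn k′ B′ dn k B) (BoolP.∧-comm (B′ ℕ.≡ᵇ B) (k′ ℕ.≡ᵇ k))

    represents-cover : ∀ e {f} k B d g → Represents e f → (∀ o k′ B′ → g o k′ B′ ≡ bit (touches k B d o k′ B′) + f o k′ B′) →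
      Represents (cover (loz (column B) (+ k) d) e) g
    represents-cover e k B d g rep eq o k′ B′ ins = trans (cong₂ (λ x y → bit x + y) (covers-at k B d o k′ B′) (rep o k′ B′ ins)) (sym (eq o k′ B′))

    completions-at : ∀ ls {e e′} → (∀ o k B → inside (at o k B) ≡ true → e (at o k B) ≡ e′ (at o k B)) → completions R ls e ≡ completions R ls e′
    completions-at ls {e} {e′} h = completions-cong ls (All-filterᵇ inside (box a b c) λ { (tri o i k) ins → aux o i k ins })
      where
      aux : ∀ o i k → inside (tri o i k) ≡ true → e (tri o i k) ≡ e′ (tri o i k)
      aux o i k ins with locate o i k ins
      ... | k′ , B , refl , refl = h o k′ B ins

    All-keep : ∀ {P : Lozenge → Set} i k d {ls} → P (loz i k d) → All P ls → All P (keep i k d ls)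
    All-keep i k d pl pls with inside (partner i k d)
    ... | true  = pl ∷ pls
    ... | false = pls

    All-kept : ∀ {P : Lozenge → Set} i k → (∀ d → P (loz i k d)) → All P (keep i k d₀ (keep i k d₁ (keep i k d₂ [])))
    All-kept i k h = All-keep i k d₀ (h d₀) (All-keep i k d₁ (h d₁) (All-keep i k d₂ (h d₂) []))

    All-lozengesAt : ∀ {P : Lozenge → Set} i k → (∀ d → P (loz i k d)) → All P (lozengesAt i k)
    All-lozengesAt {P} i k h = aux (inside (tri up i k))
      where
      aux : ∀ x → All P (if x then keep i k d₀ (keep i k d₁ (keep i k d₂ [])) else [])
      aux true  = All-kept i k h
      aux false = []

    remaining : ℕ → ℕ → List Lozenge
    remaining k n = below k ++ row k n

    remaining-suc : ∀ k n B → n + B ≡ a + c + 1 → remaining k (suc n) ≡ remaining k n ++ lozengesAt (column B) (+ k)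
    remaining-suc k n B eq = begin
        below k ++ row k (suc n)                                            ≡⟨ cong (below k ++_) (concatMap-upTo-suc _ n) ⟩
        below k ++ (row k n ++ lozengesAt (+ n ℤ.- + suc a) (+ k))          ≡⟨ ListP.++-assoc (below k) (row k n) _ ⟨
        remaining k n ++ lozengesAt (+ n ℤ.- + suc a) (+ k)                 ≡⟨ cong (λ i → remaining k n ++ lozengesAt i (+ k)) (column-index n B eq) ⟩
        remaining k n ++ lozengesAt (column B) (+ k)                        ∎
      where open ≡-Reasoning

    remaining-earlier : ∀ k n B → n + B ≡ a + c + 1 → All (Earlier k (column B)) (remaining k n)
    remaining-earlier k n B eq = AllP.++⁺
      (All-concatMap-upTo _ k (λ {k′} k′<k → All-concatMap-upTo _ (a + c + 3) (λ {j} _ → All-lozengesAt _ _ (λ d → inj₁ (ℤ.+<+ k′<k)))))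
      (All-concatMap-upTo _ n (λ {j} j<n → All-lozengesAt _ _ (λ d → inj₂ (refl ,
        subst (+ j ℤ.- + suc a ℤ.<_) (column-index n B eq) (ℤP.+-monoˡ-< (ℤ.- (+ suc a)) (ℤ.+<+ j<n))))))

    remaining-covers : ∀ o k n B → n + B ≡ a + c + 1 → All (λ l → covers l (at o k B) ≡ false) (remaining k n)
    remaining-covers o k n B eq = All.map (λ {l} ear → earlier-covers k (column B) l ear o) (remaining-earlier k n B eq)

    option : ℕ → ℕ → Dir → List Lozenge → (Tri → ℕ) → ℕ
    option k B d ls e = if inside (partner (column B) (+ k) d) then completions R ls (cover (loz (column B) (+ k) d) e) else 0

    completions-options : ∀ k n B e → n + B ≡ a + c + 1 → inside (at up k B) ≡ true → e (at up k B) ≡ 0 →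
      completions R (remaining k (suc n)) e ≡ option k B d₀ (remaining k n) e + (option k B d₁ (remaining k n) e + option k B d₂ (remaining k n) e)
    completions-options k n B e eq ins e≡0 = begin
        completions R (remaining k (suc n)) e                                 ≡⟨ cong (λ ls → completions R ls e) (remaining-suc k n B eq) ⟩
        completions R (remaining k n ++ lozengesAt (column B) (+ k)) e        ≡⟨ cong (λ x → completions R (remaining k n ++ (if x then kept else [])) e) ins ⟩
        completions R (remaining k n ++ kept) e                               ≡⟨ completions-block (remaining k n) kept (inside⇒∈ up k B ins) (remaining-covers up k n B eq) kept-covers e≡0 ⟩
        sum (map v kept)                                                      ≡⟨ trans (sum-keep d₀ _) (cong (λ z → o d₀ + z) (trans (sum-keep d₁ _) (cong (λ z → o d₁ + z) (trans (sum-keep d₂ []) (ℕP.+-identityʳ (o d₂)))))) ⟩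
        option k B d₀ (remaining k n) e + (option k B d₁ (remaining k n) e + option k B d₂ (remaining k n) e) ∎
      where
      open ≡-Reasoning
      kept = keep (column B) (+ k) d₀ (keep (column B) (+ k) d₁ (keep (column B) (+ k) d₂ []))
      o : Dir → ℕ
      o d = option k B d (remaining k n) e
      v : Lozenge → ℕ
      v l = completions R (remaining k n) (cover l e)
      kept-covers : All (λ l → covers l (at up k B) ≡ true) kept
      kept-covers = All-kept (column B) (+ k) (λ d → trans (covers-at k B d up k B) (cong₂ _∧_ (T→true (ℕP.≡⇒≡ᵇ k k refl)) (T→true (ℕP.≡⇒≡ᵇ B B refl))))
      sum-if : ∀ x l ls → sum (map v (if x then l ∷ ls else ls)) ≡ (if x then v l else 0) + sum (map v ls)
      sum-if true  l ls = refl
      sum-if false l ls = refl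
      sum-keep : ∀ d ls → sum (map v (keep (column B) (+ k) d ls)) ≡ option k B d (remaining k n) e + sum (map v ls)
      sum-keep d ls = sum-if (inside (partner (column B) (+ k) d)) (loz (column B) (+ k) d) ls

    option-inside : ∀ k B d ls e → inside (partner (column B) (+ k) d) ≡ true → option k B d ls e ≡ completions R ls (cover (loz (column B) (+ k) d) e)
    option-inside k B d ls e ins = cong (λ x → if x then completions R ls (cover (loz (column B) (+ k) d) e) else 0) ins

    option-covered : ∀ k B d ls e → (inside (partner (column B) (+ k) d) ≡ true → e (partner (column B) (+ k) d) ≡ 1) → option k B d ls e ≡ 0
    option-covered k B d ls e h = aux (inside t) refl
      where
      t = partner (column B) (+ k) d
      self : covers (loz (column B) (+ k) d) t ≡ true
      self = trans (cong ((t ==T tri up (column B) (+ k)) ∨_) (==T-refl t)) (BoolP.∨-zeroʳ _)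
      aux : ∀ x → inside t ≡ x → (if x then completions R ls (cover (loz (column B) (+ k) d) e) else 0) ≡ 0
      aux false _   = refl
      aux true  ins = completions-over ls (∈ᵇ⇒∈ R (trans (∈ᵇ-inside t) ins)) (ℕP.≤-reflexive (sym (cong₂ _+_ (cong bit self) (h ins))))

    -- The list left over holds only earlier lozenges, none of which covers the down triangle at
    -- `B`; it would stay bare.
    option-dead : ∀ k B d n e → n + B ≡ a + c + 1 → inside (at dn k B) ≡ true → e (at dn k B) ≡ 0 → touches k B d dn k B ≡ false →
      option k B d (remaining k n) e ≡ 0
    option-dead k B d n e eq ins e≡0 t≡false = aux (inside (partner (column B) (+ k) d))
      where
      aux : ∀ x → (if x then completions R (remaining k n) (cover (loz (column B) (+ k) d) e) else 0) ≡ 0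
      aux false = refl
      aux true  = completions-dead (remaining k n) (inside⇒∈ dn k B ins) (remaining-covers dn k n B eq) (cong₂ _+_ (cong bit (trans (covers-at k B d dn k B) t≡false)) e≡0)

  double-cancel-< : ∀ x m → x + x < 2 * m → x < m
  double-cancel-< x m lt = ℕP.*-cancelˡ-< 2 x m (ℕP.≤-trans (s≤s (ℕP.≤-reflexive (cong (λ z → x + z) (ℕP.+-identityʳ x)))) lt)

  double-cancel-≤ : ∀ x m → x + x ≤ 2 * m → x ≤ m
  double-cancel-≤ x m le = ℕP.*-cancelˡ-≤ 2 (ℕP.≤-trans (ℕP.≤-reflexive (cong (λ z → x + z) (ℕP.+-identityʳ x))) le)

  concatMap-[] : ∀ {A B : Set} (f : A → List B) xs → (∀ x → f x ≡ []) → concatMap f xs ≡ []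
  concatMap-[] f []       h = refl
  concatMap-[] f (x ∷ xs) h = cong₂ _++_ (h x) (concatMap-[] f xs h)

  Increasing-raise : ∀ {l m} q → Increasing l q → All (m ≤_) q → Increasing m q
  Increasing-raise []      inc       []        = tt
  Increasing-raise (x ∷ q) (_ , inc) (m≤x ∷ _) = m≤x , inc

  coverage-initial : ∀ k q o k′ B′ → k′ ≤ k → (o ≡ dn → k′ ≡ k → member B′ q ≡ true) → coverage k 0 q [] o k′ B′ ≡ 0
  coverage-initial zero          q up zero     B′ _         h = refl
  coverage-initial zero          q dn zero     B′ _         h = cong (bit ∘ not) (h refl refl)
  coverage-initial (suc k)       q o  (suc k′) B′ (s≤s k′≤k) h = coverage-initial k q o k′ B′ k′≤k (λ eq → h eq ∘ cong suc)
  coverage-initial (suc zero)    q up zero     B′ _         h = refl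
  coverage-initial (suc zero)    q dn zero     B′ _         h = refl
  coverage-initial (suc (suc k)) q o  zero     B′ _         h = refl

  -- The sweep through one row.

  module Counting (a b c : ℕ) where

    open Geometry a b c
    open Lozenges a b c
    open Transfer a b c

    Position-pred : ∀ k B → Position (suc k) (suc B) → Position k B
    Position-pred k B (k< , wall , B<W) =
        ℕP.≤-pred (ℕP.≤-trans k< (ℕP.≤-reflexive (ℕP.+-suc b B)))
      , ℕP.≤-trans (s≤s (ℕP.+-monoʳ-≤ B (ℕP.n≤1+n B))) (ℕP.≤-pred wall)
      , ℕP.<-trans (ℕP.n<1+n B) B<W

    -- Among the conditions of `Position` only the wall tightens when going down one line, and it
    -- does so by one unit.
    Position-wall : ∀ k B → Position (suc k) B → ¬ Position k B → B + B ≡ k + 2 * suc c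
    Position-wall k B (k< , wall , B<W) ¬pos with ℕP.m≤n⇒m<n∨m≡n (ℕP.≤-pred wall)
    ... | inj₁ lt = contradiction (ℕP.<⇒≤ k< , lt , B<W) ¬pos
    ... | inj₂ eq = eq

    Position-bound : ∀ k {B} → Position (suc k) B → B ≤ k + 2 * suc c
    Position-bound k {B} (_ , wall , _) = ℕP.≤-trans (ℕP.m≤m+n B B) (ℕP.≤-pred wall)

    -- Here `q` holds the path positions on line `suc k` still to be traced, and `r` those already
    -- found on line `k`, in reverse order. Each lozenge `d₀` or `d₁` moves one path from `q` to
    -- `r`, so `total` is preserved.
    record State (k N B : ℕ) (q r : List ℕ) : Set where
      field
        increasing  : Increasing B q
        positions-q : All (Position (suc k)) q
        decreasing  : Decreasing B r
        positions-r : All (Position k) r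
        total       : length r + length q ≡ N

    skip-column : ∀ k n B e → n + B ≡ a + c + 1 → inside (at up k B) ≡ false →
      completions R (remaining k (suc n)) e ≡ completions R (remaining k n) e
    skip-column k n B e eq out = cong (λ ls → completions R ls e) (begin
        remaining k (suc n)                              ≡⟨ remaining-suc k n B eq ⟩
        remaining k n ++ lozengesAt (column B) (+ k)     ≡⟨ cong (λ x → remaining k n ++ (if x then kept else [])) out ⟩
        remaining k n ++ []                              ≡⟨ ListP.++-identityʳ (remaining k n) ⟩
        remaining k n                                    ∎)
      where
      open ≡-Reasoning
      kept = keep (column B) (+ k) d₀ (keep (column B) (+ k) d₁ (keep (column B) (+ k) d₂ []))

    -- Rows differ only in the lozenges `d₂`, which reach into the row below: on upper rows they are
    -- available at every position, on the bottom row never. The parameter `descend` abstracts this,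
    -- and `finish` says that `F` counts the completions by the rows below.
    module Row (k N : ℕ) (k<K : k < K) (F : List ℕ → ℚ)
      (wall : ∀ rs y ys → y + y ≡ k + 2 * suc c → F (rs ++ y ∷ ys) ≡ 0ℚ)
      (finish : ∀ r e → State k N W [] r → Represents e (coverage k W [] r) → fromℕ (completions R (below k) e) ≡ F (r ʳ++ []))
      (descend : ∀ n B q r e → Position k B → State k N (suc B) q r → Decreasing B r → Represents e (coverage k B q r) →
        (∀ e′ → Represents e′ (coverage k (suc B) q r) → fromℕ (completions R (remaining k n) e′) ≡ strictSum (suc B) (λ p → F (r ʳ++ p)) q) →
        fromℕ (option k B d₂ (remaining k n) e) ≡ strictSum (suc B) (λ p → F (r ʳ++ p)) q)
      where

      wallʳ : ∀ r y p → y + y ≡ k + 2 * suc c → F (r ʳ++ (y ∷ p)) ≡ 0ℚ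
      wallʳ r y p eq = trans (cong F (ListP.ʳ++-defn r)) (wall (reverse r) y p eq)

      -- Each column reproduces one unfolding of `strictSum`: the case of `HeadView` decides both
      -- the possible lozenges and the summands that occur. By `no-hole`, an up triangle is absent
      -- only where `B` is no position of line `k`.
      transfer : ∀ n B q r e → n + B ≡ W → (∀ B′ → B ≤ B′ → ¬ Hole k B′) → State k N B q r → Represents e (coverage k B q r) →
        fromℕ (completions R (remaining k n) e) ≡ strictSum B (λ p → F (r ʳ++ p)) q
      transfer zero B [] r e refl no-hole st rep =
        trans (cong (λ ls → fromℕ (completions R ls e)) (ListP.++-identityʳ (below k))) (finish r e st rep)
      transfer zero B (y ∷ q) r e refl no-hole st rep =
        contradiction (proj₁ (State.increasing st)) (ℕP.<⇒≱ (proj₂ (proj₂ (All.head (State.positions-q st)))))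
      transfer (suc n) B q r e eq no-hole st rep = by-inside (inside (at up k B)) refl
        where
        open ≡-Reasoning
        index : n + B ≡ a + c + 1
        index = ℕP.suc-injective (trans eq (ℕP.+-suc (a + c) 1))
        eq′ : n + suc B ≡ W
        eq′ = trans (ℕP.+-suc n B) eq
        no-hole′ : ∀ B′ → suc B ≤ B′ → ¬ Hole k B′
        no-hole′ B′ B<B′ = no-hole B′ (ℕP.<⇒≤ B<B′)
        rem = remaining k n
        dec′ : ∀ {r} → Decreasing B r → Decreasing (suc B) r
        dec′ {r} = Decreasing-weaken r (ℕP.n≤1+n B)
        advance : ∀ q r → State k N B q r → Increasing (suc B) q → State k N (suc B) q r
        advance q r st inc = record { State st ; increasing = inc ; decreasing = dec′ (State.decreasing st) }
        recurse : ∀ q r → State k N (suc B) q r → ∀ e → Represents e (coverage k (suc B) q r) →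
          fromℕ (completions R rem e) ≡ strictSum (suc B) (λ p → F (r ʳ++ p)) q
        recurse q r st e rep = transfer n (suc B) q r e eq′ no-hole′ st rep

        module Used (ins : inside (at up k B) ≡ true) where
          pos : Position k B
          pos = proj₁ (proj₂ (up-inside⁻ k B ins))
          options : ∀ q r → Represents e (coverage k B q r) →
            completions R (remaining k (suc n)) e ≡ option k B d₀ rem e + (option k B d₁ rem e + option k B d₂ rem e)
          options q r rep = completions-options k n B e index ins (trans (rep up k B ins) (coverage-up k B q r))
          no-d₀ : ∀ q r → Represents e (coverage k B q r) → Increasing (suc B) q → option k B d₀ rem e ≡ 0
          no-d₀ q r rep inc = option-covered k B d₀ rem e (λ insd → trans (rep dn k B insd)
            (trans (coverage-dn k B q r B) (cong (bit ∘ not) (member-increasing q inc ℕP.≤-refl))))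
          no-d₁ : ∀ q r → Represents e (coverage k B q r) → Increasing (2 + B) q → option k B d₁ rem e ≡ 0
          no-d₁ q r rep inc = option-covered k B d₁ rem e (λ insd → trans (cong e p≡) (trans (rep dn k (suc B) (trans (cong inside (sym p≡)) insd))
            (trans (coverage-dn k B q r (suc B)) (cong (bit ∘ not) (member-increasing q inc ℕP.≤-refl)))))
            where p≡ = cong (λ i → tri dn i (+ k)) (column-suc B)

          used : ∀ q → HeadView B q → State k N B q r → Represents e (coverage k B q r) →
            fromℕ (completions R (remaining k (suc n)) e) ≡ strictSum B (λ p → F (r ʳ++ p)) q
          used (.B ∷ q) (here inc) st rep = begin
              fromℕ (completions R (remaining k (suc n)) e)       ≡⟨ cong fromℕ (options (B ∷ q) r rep) ⟩
              fromℕ (option k B d₀ rem e + (option k B d₁ rem e + option k B d₂ rem e))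
                ≡⟨ cong₂ (λ x y → fromℕ (option k B d₀ rem e + (x + y))) (dead d₁ (trans (cong ((k ℕ.≡ᵇ k) ∧_) (≡ᵇ-false (ℕP.<⇒≢ (ℕP.n<1+n B)))) (BoolP.∧-zeroʳ (k ℕ.≡ᵇ k)))) (dead d₂ (d₂-misses k)) ⟩
              fromℕ (option k B d₀ rem e + 0)                     ≡⟨ cong fromℕ (trans (ℕP.+-identityʳ _) (option-inside k B d₀ rem e insd)) ⟩
              fromℕ (completions R rem (cover (loz (column B) (+ k) d₀) e))
                ≡⟨ recurse q (B ∷ r) (record
                     { increasing = inc ; positions-q = All.tail (State.positions-q st) ; decreasing = ℕP.≤-refl , State.decreasing st
                     ; positions-r = pos ∷ State.positions-r st ; total = trans (sym (ℕP.+-suc (length r) (length q))) (State.total st) }) _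
                     (represents-cover e k B d₀ _ rep (λ o k′ B′ → coverage-d₀ k B q r o k′ B′ (member-increasing q inc ℕP.≤-refl))) ⟩
              strictSum (suc B) (λ p → F (r ʳ++ (B ∷ p))) q       ≡⟨ strictSum-here B (λ p → F (r ʳ++ p)) q ⟨
              strictSum B (λ p → F (r ʳ++ p)) (B ∷ q)             ∎
            where
            insd : inside (at dn k B) ≡ true
            insd = dn-inside⁺ k B k<K (All.head (State.positions-q st))
            e≡0 : e (at dn k B) ≡ 0
            e≡0 = trans (rep dn k B insd) (trans (coverage-dn k B (B ∷ q) r B) (cong (λ x → bit (not (x ∨ member B q))) (T→true (ℕP.≡⇒≡ᵇ B B refl))))
            dead : ∀ d → touches k B d dn k B ≡ false → option k B d rem e ≡ 0
            dead d = option-dead k B d n e index insd e≡0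
            d₂-misses : ∀ k → touches k B d₂ dn k B ≡ false
            d₂-misses zero    = refl
            d₂-misses (suc k) = cong (_∧ (B ℕ.≡ᵇ B)) (≡ᵇ-false {suc k} {k} (ℕP.<⇒≢ (ℕP.n<1+n k) ∘ sym))
          used (.(suc B) ∷ q) (next inc) st rep = begin
              fromℕ (completions R (remaining k (suc n)) e)       ≡⟨ cong fromℕ (options (suc B ∷ q) r rep) ⟩
              fromℕ (option k B d₀ rem e + (option k B d₁ rem e + option k B d₂ rem e))
                ≡⟨ cong₂ (λ x y → fromℕ (x + (y + option k B d₂ rem e))) (no-d₀ (suc B ∷ q) r rep inc′) (option-inside k B d₁ rem e insd) ⟩
              fromℕ (completions R rem (cover (loz (column B) (+ k) d₁) e) + option k B d₂ rem e)
                ≡⟨ fromℕ-+ (completions R rem (cover (loz (column B) (+ k) d₁) e)) (option k B d₂ rem e) ⟩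
              fromℕ (completions R rem (cover (loz (column B) (+ k) d₁) e)) ℚ.+ fromℕ (option k B d₂ rem e)
                ≡⟨ cong₂ ℚ._+_
                     (recurse q (B ∷ r) (record
                       { increasing = Increasing-weaken q (ℕP.n≤1+n (suc B)) inc ; positions-q = All.tail (State.positions-q st)
                       ; decreasing = ℕP.≤-refl , State.decreasing st ; positions-r = pos ∷ State.positions-r st
                       ; total = trans (sym (ℕP.+-suc (length r) (length q))) (State.total st) }) _
                       (represents-cover e k B d₁ _ rep (λ o k′ B′ → coverage-d₁ k B q r o k′ B′ (member-increasing q inc ℕP.≤-refl))))
                     (descend n B (suc B ∷ q) r e pos st′ (State.decreasing st) rep (recurse (suc B ∷ q) r st′)) ⟩
              strictSum (suc B) (λ p → F (r ʳ++ (B ∷ p))) q ℚ.+ strictSum (suc B) (λ p → F (r ʳ++ p)) (suc B ∷ q)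
                ≡⟨ strictSum-next B (λ p → F (r ʳ++ p)) q ⟨
              strictSum B (λ p → F (r ʳ++ p)) (suc B ∷ q)         ∎
            where
            inc′ : Increasing (suc B) (suc B ∷ q)
            inc′ = ℕP.≤-refl , inc
            st′ = advance (suc B ∷ q) r st inc′
            insd : inside (partner (column B) (+ k) d₁) ≡ true
            insd = trans (cong (λ i → inside (tri dn i (+ k))) (column-suc B)) (dn-inside⁺ k (suc B) k<K (All.head (State.positions-q st)))
          used q (far inc) st rep = begin
              fromℕ (completions R (remaining k (suc n)) e)       ≡⟨ cong fromℕ (options q r rep) ⟩
              fromℕ (option k B d₀ rem e + (option k B d₁ rem e + option k B d₂ rem e))
                ≡⟨ cong₂ (λ x y → fromℕ (x + (y + option k B d₂ rem e))) (no-d₀ q r rep inc′) (no-d₁ q r rep inc) ⟩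
              fromℕ (option k B d₂ rem e)
                ≡⟨ descend n B q r e pos (advance q r st inc′) (State.decreasing st) rep (recurse q r (advance q r st inc′)) ⟩
              strictSum (suc B) (λ p → F (r ʳ++ p)) q             ≡⟨ strictSum-far B (λ p → F (r ʳ++ p)) q inc ⟨
              strictSum B (λ p → F (r ʳ++ p)) q                   ∎
            where
            inc′ : Increasing (suc B) q
            inc′ = Increasing-weaken q (ℕP.n≤1+n (suc B)) inc

        module Unused (out : inside (at up k B) ≡ false) where
          ¬pos : ¬ Position k B
          ¬pos pos with trans (sym out) (up-inside⁺ k B k<K pos (no-hole B ℕP.≤-refl))
          ... | ()
          unused : ∀ q → HeadView B q → State k N B q r → Represents e (coverage k B q r) →
            fromℕ (completions R rem e) ≡ strictSum B (λ p → F (r ʳ++ p)) q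
          -- Both sides vanish: the demanded triangle has lost its last possible cover, and its
          -- position lies on the wall of line `k`, where `F` is zero.
          unused (.B ∷ q) (here inc) st rep = trans (cong fromℕ (completions-dead rem (inside⇒∈ dn k B insd) (remaining-covers dn k n B index) e≡0))
            (sym (trans (strictSum-here B (λ p → F (r ʳ++ p)) q) (strictSum-zero (suc B) (λ p → F (r ʳ++ (B ∷ p))) q inc
              (All.map (Position-bound k) (All.tail (State.positions-q st)))
              (λ p _ _ _ → wallʳ r B p (Position-wall k B (All.head (State.positions-q st)) ¬pos)))))
            where
            insd : inside (at dn k B) ≡ true
            insd = dn-inside⁺ k B k<K (All.head (State.positions-q st))
            e≡0 : e (at dn k B) ≡ 0
            e≡0 = trans (rep dn k B insd) (trans (coverage-dn k B (B ∷ q) r B) (cong (λ x → bit (not (x ∨ member B q))) (T→true (ℕP.≡⇒≡ᵇ B B refl))))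
          unused (.(suc B) ∷ q) (next inc) st rep = contradiction (Position-pred k B (All.head (State.positions-q st))) ¬pos
          unused q (far inc) st rep = trans (recurse q r (advance q r st (Increasing-weaken q (ℕP.n≤1+n (suc B)) inc)) e rep′)
            (sym (strictSum-far B (λ p → F (r ʳ++ p)) q inc))
            where
            clash : true ≡ false → ⊥
            clash ()
            rep′ : Represents e (coverage k (suc B) q r)
            rep′ o k′ B′ ins = trans (rep o k′ B′ ins) (sym (coverage-skip k B q r o k′ B′
              (λ { refl refl refl → clash (trans (sym ins) out) })
              (λ { refl refl refl → ¬pos (proj₂ (dn-inside⁻ k′ B′ ins)) })))

        by-inside : ∀ x → inside (at up k B) ≡ x → fromℕ (completions R (remaining k (suc n)) e) ≡ strictSum B (λ p → F (r ʳ++ p)) q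
        by-inside true  ins = Used.used ins q (headView B q (State.increasing st)) st rep
        by-inside false out = trans (cong fromℕ (skip-column k n B e index out)) (Unused.unused out q (headView B q (State.increasing st)) st rep)

  -- Path families in the presence of the removed triangle.

  -- The number of path families ending at q on line κ + suc b whose rightmost path stops at position 1 of
  -- line suc b: those counted by the second term leave position 0 in one of the κ rows above that line.
  dented : ℕ → ℕ → ℕ → List ℕ → ℚ
  dented b n κ q = walks n (κ + suc b) (1 ∷ q) ℚ.- fromℕ κ ℚ.* walks n (κ + suc b) (0 ∷ q)

  dented-alternating : ∀ b n κ → Alternating (dented b n κ)
  dented-alternating b n κ rs x xs = trans
    (cong₂ (λ u v → u ℚ.- fromℕ κ ℚ.* v) (walks-alternating n (κ + suc b) (1 ∷ rs) x xs) (walks-alternating n (κ + suc b) (0 ∷ rs) x xs))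
    (solve 1 (λ k → con 0ℚ :- k :* con 0ℚ := con 0ℚ) refl (fromℕ κ))
    where open ℚS.+-*-Solver

  dented-wall : ∀ b n κ rs y ys → y + y ≡ κ + suc b + 2 * n → dented b n κ (rs ++ y ∷ ys) ≡ 0ℚ
  dented-wall b n κ rs y ys eq = trans
    (cong₂ (λ u v → u ℚ.- fromℕ κ ℚ.* v) (walks-wall n (κ + suc b) (1 ∷ rs) y ys eq) (walks-wall n (κ + suc b) (0 ∷ rs) y ys eq))
    (solve 1 (λ k → con 0ℚ :- k :* con 0ℚ := con 0ℚ) refl (fromℕ κ))
    where open ℚS.+-*-Solver

  -- Only the entries of `q` step; the first entry is frozen. On the next line `walks` at `1 ∷ q`
  -- sums over first entries 0 and 1, so freezing at 1 loses exactly the part with first entry 0,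
  -- which raises the coefficient from `κ` to `suc κ`.
  dented-stepSum : ∀ b n κ {q} → All (_≤ κ + suc b + 2 * n) q → stepSum (dented b n κ) q ≡ dented b n (suc κ) q
  dented-stepSum b n κ {q} q≤ = begin
      stepSum (dented b n κ) q
        ≡⟨ stepSum-cong q (λ p → solve 3 (λ u k v → u :- k :* v := u :+ (:- k) :* v) refl (walks n k (1 ∷ p)) (fromℕ κ) (walks n k (0 ∷ p))) ⟩
      stepSum (λ p → walks n k (1 ∷ p) ℚ.+ (ℚ.- fromℕ κ) ℚ.* walks n k (0 ∷ p)) q
        ≡⟨ stepSum-+ (λ p → walks n k (1 ∷ p)) (λ p → (ℚ.- fromℕ κ) ℚ.* walks n k (0 ∷ p)) q ⟩
      S₁ ℚ.+ stepSum (λ p → (ℚ.- fromℕ κ) ℚ.* walks n k (0 ∷ p)) q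
        ≡⟨ cong (ℚ._+_ S₁) (stepSum-* (ℚ.- fromℕ κ) (λ p → walks n k (0 ∷ p)) q) ⟩
      S₁ ℚ.+ (ℚ.- fromℕ κ) ℚ.* S₀
        ≡⟨ solve 3 (λ x y k → y :+ (:- k) :* x := (x :+ y) :- (con 1ℚ :+ k) :* x) refl S₀ S₁ (fromℕ κ) ⟩
      (S₀ ℚ.+ S₁) ℚ.- (1ℚ ℚ.+ fromℕ κ) ℚ.* S₀
        ≡⟨ cong₂ (λ u v → u ℚ.- (1ℚ ℚ.+ fromℕ κ) ℚ.* v) (walks-stepSum n k (1≤ ∷ q≤)) (walks-stepSum n k (z≤n ∷ q≤)) ⟩
      walks n (suc k) (1 ∷ q) ℚ.- (1ℚ ℚ.+ fromℕ κ) ℚ.* walks n (suc k) (0 ∷ q)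
        ≡⟨ cong (λ z → walks n (suc k) (1 ∷ q) ℚ.- z ℚ.* walks n (suc k) (0 ∷ q)) (sym (fromℕ-suc κ)) ⟩
      dented b n (suc κ) q ∎
    where
    open ≡-Reasoning
    open ℚS.+-*-Solver
    k = κ + suc b
    S₀ S₁ : ℚ
    S₀ = stepSum (λ p → walks n k (0 ∷ p)) q
    S₁ = stepSum (λ p → walks n k (1 ∷ p)) q
    1≤ : 1 ≤ κ + suc b + 2 * n
    1≤ = ℕP.≤-trans (s≤s z≤n) (ℕP.≤-trans (ℕP.≤-reflexive (sym (ℕP.+-suc κ b))) (ℕP.m≤m+n (κ + suc b) (2 * n)))

  -- The last position of the block could stay only on the wall, where `h` vanishes, so it moves;
  -- that takes the room of the next one, and so on through the block.
  stepSum-tight : ∀ lo m h → Alternating h → (∀ rs → h (rs ++ lo + m ∷ []) ≡ 0ℚ) → stepSum h (range (suc lo) m) ≡ h (range lo m)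
  stepSum-tight lo zero    h alt wall = refl
  stepSum-tight lo (suc m) h alt wall = trans
    (cong₂ ℚ._+_ (stepSum-tight (suc lo) m (h ∘ (lo ∷_)) (alt ∘ (lo ∷_)) (wall′ ∘ (lo ∷_)))
      (trans (stepSum-tight (suc lo) m (h ∘ (suc lo ∷_)) (alt ∘ (suc lo ∷_)) (wall′ ∘ (suc lo ∷_))) (vanish m wall′)))
    (ℚP.+-identityʳ _)
    where
    wall′ : ∀ rs → h (rs ++ suc lo + m ∷ []) ≡ 0ℚ
    wall′ rs = trans (cong (λ z → h (rs ++ z ∷ [])) (sym (ℕP.+-suc lo m))) (wall rs)
    -- An entry staying at `suc lo` collides with its neighbour, which has moved there; if there is
    -- no neighbour, `suc lo` itself is on the wall.
    vanish : ∀ m → (∀ rs → h (rs ++ suc lo + m ∷ []) ≡ 0ℚ) → h (suc lo ∷ range (suc lo) m) ≡ 0ℚ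
    vanish zero    w = trans (cong (λ z → h (z ∷ [])) (sym (ℕP.+-identityʳ (suc lo)))) (w [])
    vanish (suc m) w = alt [] (suc lo) _

  -- Induction over the rows.

  module Phases (a b c : ℕ) where

    open Geometry a b c
    open Lozenges a b c
    open Transfer a b c
    open Counting a b c

    last-column-outside : ∀ k → inside (tri up (+ W ℤ.- + suc a) (+ k)) ≡ false
    last-column-outside k = BoolP.¬-not λ ins → absurd (locate up (+ W ℤ.- + suc a) (+ k) ins)
      where
      absurd : (∃₂ λ k′ B → + W ℤ.- + suc a ≡ column B × + k ≡ + k′) → ⊥
      absurd (k′ , B , eq , _) = ℕP.<-irrefl W+B≡ (ℕP.≤-trans (s≤s (ℕP.≤-reflexive (ℕP.+-comm c (suc a))))
          (ℕP.≤-trans (ℕP.≤-reflexive (trans (cong (λ z → suc (suc z)) (sym (ℕP.+-identityʳ (a + c)))) (trans (cong suc (sym (ℕP.+-suc (a + c) 0))) (sym (ℕP.+-suc (a + c) 1))))) (ℕP.m≤m+n W B)))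
        where
        open ℤS.+-*-Solver
        W+B≡ : c + suc a ≡ W + B
        W+B≡ = ℤP.+-injective (sym (trans (solve 3 (λ W s B → W :+ B := (W :- s) :+ (s :+ B)) refl (+ W) (+ suc a) (+ B))
          (trans (cong (ℤ._+ (+ suc a ℤ.+ + B)) eq) (solve 3 (λ c s B → (c :- B) :+ (s :+ B) := c :+ s) refl (+ c) (+ suc a) (+ B)))))

    -- The box extends to column `c + 1`, one beyond the range of `B`; up triangles there are
    -- outside the region.
    row-full : ∀ k → row k (a + c + 3) ≡ row k W
    row-full k = begin
        row k (a + c + 3)                                    ≡⟨ cong (row k) (ℕP.+-suc (a + c) 2) ⟩
        row k (suc W)                                        ≡⟨ concatMap-upTo-suc _ W ⟩
        row k W ++ lozengesAt (+ W ℤ.- + suc a) (+ k)        ≡⟨ cong (λ x → row k W ++ (if x then kept else [])) (last-column-outside k) ⟩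
        row k W ++ []                                        ≡⟨ ListP.++-identityʳ (row k W) ⟩
        row k W                                              ∎
      where
      open ≡-Reasoning
      i = + W ℤ.- + suc a
      kept = keep i (+ k) d₀ (keep i (+ k) d₁ (keep i (+ k) d₂ []))

    below-suc : ∀ k → below (suc k) ≡ remaining k W
    below-suc k = trans (concatMap-upTo-suc _ k) (cong (below k ++_) (row-full k))

    Count : ℕ → ℕ → (List ℕ → ℚ) → Set
    Count k N F = ∀ q e → Increasing 0 q → All (Position (suc k)) q → length q ≡ N → Represents e (coverage k 0 q []) →
      fromℕ (completions R (below (suc k)) e) ≡ F q

    module UpperRow (k N : ℕ) (k<K : suc k < K) (F : List ℕ → ℚ)
      (wall : ∀ rs y ys → y + y ≡ suc k + 2 * suc c → F (rs ++ y ∷ ys) ≡ 0ℚ) (count : Count k N F) where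

      finish : ∀ r e → State (suc k) N W [] r → Represents e (coverage (suc k) W [] r) →
        fromℕ (completions R (below (suc k)) e) ≡ F (r ʳ++ [])
      finish r e st rep = count (r ʳ++ []) e (Increasing-ʳ++ r [] (State.decreasing st) tt) (All-ʳ++ (State.positions-r st) [])
        (trans (ListP.length-ʳ++ r) (State.total st))
        (λ o k′ B′ ins → trans (rep o k′ B′ ins) (coverage-next-row k W (r ʳ++ []) r o k′ B′ (proj₂ (inside-bounds o k′ B′ ins))
          (sym (trans (member-ʳ++ B′ r []) (BoolP.∨-identityʳ (member B′ r))))))

      descend : ∀ n B q r e → Position (suc k) B → State (suc k) N (suc B) q r → Decreasing B r → Represents e (coverage (suc k) B q r) →
        (∀ e′ → Represents e′ (coverage (suc k) (suc B) q r) → fromℕ (completions R (remaining (suc k) n) e′) ≡ strictSum (suc B) (λ p → F (r ʳ++ p)) q) →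
        fromℕ (option (suc k) B d₂ (remaining (suc k) n) e) ≡ strictSum (suc B) (λ p → F (r ʳ++ p)) q
      descend n B q r e pos st dec rep recurse = trans
        (cong fromℕ (option-inside (suc k) B d₂ (remaining (suc k) n) e (dn-inside⁺ k B (ℕP.<-trans (ℕP.n<1+n k) k<K) pos)))
        (recurse _ (represents-cover e (suc k) B d₂ _ rep (λ o k′ B′ → coverage-d₂ k B q r o k′ B′ (member-decreasing r dec ℕP.≤-refl))))

      open Row (suc k) N k<K F wall finish descend public

    module BottomRow where

      n : ℕ
      n = suc c

      finish : ∀ r e → State 0 n W [] r → Represents e (coverage 0 W [] r) → fromℕ (completions R (below 0) e) ≡ walks n 0 (r ʳ++ [])
      finish r e st rep = trans
        (cong fromℕ (trans (completions-at [] {e} {λ _ → 1} (λ o k B ins → trans (rep o k B ins) (full o k B (proj₂ (inside-bounds o k B ins))))) (cong bit (all-true R (λ _ → refl)))))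
        (sym (trans (cong (walks n 0) r≡range) (walks-initial n)))
        where
        full : ∀ o k B → B < W → coverage 0 W [] r o k B ≡ 1
        full up zero    B B<W = cong bit (T→true (ℕP.<⇒<ᵇ B<W))
        full dn zero    B B<W = refl
        full o  (suc k) B B<W = refl
        len : length (r ʳ++ []) ≡ n
        len = trans (ListP.length-ʳ++ r) (State.total st)
        r≡range : r ʳ++ [] ≡ range 0 n
        r≡range = trans (Increasing-range 0 (r ʳ++ []) (Increasing-ʳ++ r [] (State.decreasing st) tt)
            (subst (λ m → All (_< m) (r ʳ++ [])) (sym len) (All-ʳ++ (All.map (λ {y} (_ , lt , _) → double-cancel-< y n lt) (State.positions-r st)) [])))
          (cong (range 0) len)

      descend : ∀ m B q r e → Position 0 B → State 0 n (suc B) q r → Decreasing B r → Represents e (coverage 0 B q r) →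
        (∀ e′ → Represents e′ (coverage 0 (suc B) q r) → fromℕ (completions R (remaining 0 m) e′) ≡ strictSum (suc B) (λ p → walks n 0 (r ʳ++ p)) q) →
        fromℕ (option 0 B d₂ (remaining 0 m) e) ≡ strictSum (suc B) (λ p → walks n 0 (r ʳ++ p)) q
      descend m B q r e (_ , B<n , _) st dec rep _ = trans (cong fromℕ (no-d₂ (remaining 0 m))) (sym (strictSum-zero (suc B) (λ p → walks n 0 (r ʳ++ p)) q (State.increasing st)
          (All.map (λ {y} (_ , lt , _) → double-cancel-≤ y n (ℕP.≤-pred lt)) (State.positions-q st)) vanish))
        where
        no-d₂ : ∀ ls → option 0 B d₂ ls e ≡ 0
        no-d₂ ls = refl
        vanish : ∀ p → Increasing (suc B) p → length p ≡ length q → All (_≤ n) p → walks n 0 (r ʳ++ p) ≡ 0ℚ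
        vanish p inc len p≤n = cases (split-max (r ʳ++ p) (All-ʳ++ (All.map (λ {y} (_ , lt , _) → ℕP.<⇒≤ (double-cancel-< y n lt)) (State.positions-r st)) p≤n))
          where
          absurd : false ≡ true → ⊥
          absurd ()
          total : length (r ʳ++ p) ≡ n
          total = trans (ListP.length-ʳ++ r) (trans (cong (λ z → length r + z) len) (State.total st))
          eq : All (_< n) (r ʳ++ p) → r ʳ++ p ≡ range 0 n
          eq all< = trans (Increasing-range 0 (r ʳ++ p) (Increasing-ʳ++ r p (State.decreasing st) inc) (subst (λ m → All (_< m) (r ʳ++ p)) (sym total) all<)) (cong (range 0) total)
          missing : member B (r ʳ++ p) ≡ false
          missing = trans (member-ʳ++ B r p) (cong₂ _∨_ (member-decreasing r dec ℕP.≤-refl) (member-increasing p inc ℕP.≤-refl))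
          present : All (_< n) (r ʳ++ p) → member B (r ʳ++ p) ≡ true
          present all< = trans (cong (member B) (eq all<)) (member-range 0 n B z≤n (double-cancel-< B n B<n))
          cases : (∃₂ λ rs ys → r ʳ++ p ≡ rs ++ n ∷ ys) ⊎ All (_< n) (r ʳ++ p) → walks n 0 (r ʳ++ p) ≡ 0ℚ
          cases (inj₁ (rs , ys , eq)) = trans (cong (walks n 0) eq) (walks-wall n 0 rs n ys (cong (λ z → n + z) (sym (ℕP.+-identityʳ n))))
          cases (inj₂ all<) = ⊥-elim (absurd (trans (sym missing) (present all<)))

      open Row 0 n (ℕP.≤-trans (s≤s z≤n) (ℕP.m≤n+m 2 (a + b))) (walks n 0) (walks-wall n 0) finish descend public

    initial-state : ∀ k N q → Increasing 0 q → All (Position (suc k)) q → length q ≡ N → State k N 0 q []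
    initial-state k N q inc pos len = record { increasing = inc ; positions-q = pos ; decreasing = tt ; positions-r = [] ; total = len }

    -- The removed triangle lies in row `suc b`, so up to row `b` whole rows are swept with all
    -- `suc c` paths.
    count-lower : ∀ k → k ≤ b → Count k (suc c) (walks (suc c) (suc k))
    count-lower zero _ q e inc pos len rep = begin
        fromℕ (completions R (below 1) e)             ≡⟨ cong (λ ls → fromℕ (completions R ls e)) (below-suc 0) ⟩
        fromℕ (completions R (remaining 0 W) e)       ≡⟨ BottomRow.transfer W 0 q [] e (ℕP.+-identityʳ W) (λ { _ _ (() , _) }) (initial-state 0 (suc c) q inc pos len) rep ⟩
        strictSum 0 (walks (suc c) 0) q               ≡⟨ walks-transfer (suc c) 0 q inc (All.map (Position-bound 0) pos) ⟩
        walks (suc c) 1 q                             ∎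
      where open ≡-Reasoning
    count-lower (suc k) k<b q e inc pos len rep = begin
        fromℕ (completions R (below (2 + k)) e)       ≡⟨ cong (λ ls → fromℕ (completions R ls e)) (below-suc (suc k)) ⟩
        fromℕ (completions R (remaining (suc k) W) e) ≡⟨ UpperRow.transfer k (suc c) k<K (walks (suc c) (suc k)) (walks-wall (suc c) (suc k)) (count-lower k (ℕP.<⇒≤ k<b))
                                                           W 0 q [] e (ℕP.+-identityʳ W) (λ { _ _ (refl , _) → ℕP.<-irrefl refl k<b }) (initial-state (suc k) (suc c) q inc pos len) rep ⟩
        strictSum 0 (walks (suc c) (suc k)) q         ≡⟨ walks-transfer (suc c) (suc k) q inc (All.map (Position-bound (suc k)) pos) ⟩
        walks (suc c) (2 + k) q                       ∎
      where
      open ≡-Reasoning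
      k<K : suc k < K
      k<K = ℕP.≤-trans (s≤s k<b) (ℕP.≤-trans (ℕP.n≤1+n (suc b)) (ℕP.≤-trans (ℕP.≤-reflexive (ℕP.+-comm 2 b)) (ℕP.+-monoˡ-≤ 2 (ℕP.m≤n+m b a))))

    count-upper : ∀ κ → κ ≤ a → Count (κ + suc b) c (dented b (suc c) (suc κ))
    count-upper zero _ q e inc pos len rep = begin
        fromℕ (completions R (below (2 + b)) e)                       ≡⟨ cong (λ ls → fromℕ (completions R ls e)) (trans (below-suc (suc b)) (cong (remaining (suc b)) W≡)) ⟩
        -- Column 0 is cut off by the northeast side and column 1 holds the removed triangle, so the
        -- sweep begins at column 2. The entry 1 placed in `r` is the base of that triangle, where
        -- the rightmost path ends.
        fromℕ (completions R (remaining (suc b) (2 + (a + c))) e)     ≡⟨ cong fromℕ (skip-column (suc b) (suc (a + c)) 0 e (trans (ℕP.+-identityʳ _) (ℕP.+-comm 1 (a + c))) out₀) ⟩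
        fromℕ (completions R (remaining (suc b) (suc (a + c))) e)     ≡⟨ cong fromℕ (skip-column (suc b) (a + c) 1 e refl out₁) ⟩
        fromℕ (completions R (remaining (suc b) (a + c)) e)           ≡⟨ UpperRow.transfer b (suc c) k<K (walks (suc c) (suc b)) (walks-wall (suc c) (suc b)) (count-lower b ℕP.≤-refl)
                                                                           (a + c) 2 q (1 ∷ []) e refl (λ { _ (s≤s ()) (_ , refl) }) st rep′ ⟩
        strictSum 2 (λ p → walks (suc c) (suc b) (1 ∷ p)) q           ≡⟨ strictSum≡stepSum 2 _ q (walks-alternating (suc c) (suc b) ∘ (1 ∷_)) (λ { _ xs refl → walks-alternating (suc c) (suc b) [] 1 xs }) inc₂ ⟩
        stepSum (λ p → walks (suc c) (suc b) (1 ∷ p)) q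
          ≡⟨ stepSum-cong q (λ p → solve 2 (λ u v → u := u :- con 0ℚ :* v) refl (walks (suc c) (suc b) (1 ∷ p)) (walks (suc c) (suc b) (0 ∷ p))) ⟩
        stepSum (dented b (suc c) 0) q                                ≡⟨ dented-stepSum b (suc c) 0 (All.map (Position-bound (suc b)) pos) ⟩
        dented b (suc c) 1 q                                          ∎
      where
      open ≡-Reasoning
      open ℚS.+-*-Solver
      W≡ : W ≡ 2 + (a + c)
      W≡ = ℕP.+-comm (a + c) 2
      k<K : suc b < K
      k<K = ℕP.≤-trans (ℕP.≤-reflexive (ℕP.+-comm 2 b)) (ℕP.+-monoˡ-≤ 2 (ℕP.m≤n+m b a))
      ¬pos₀ : ¬ Position (suc b) 0
      ¬pos₀ (lt , _) = ℕP.<-irrefl (sym (ℕP.+-identityʳ b)) lt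
      out₀ : inside (at up (suc b) 0) ≡ false
      out₀ = BoolP.¬-not λ ins → ¬pos₀ (proj₁ (proj₂ (up-inside⁻ (suc b) 0 ins)))
      out₁ : inside (at up (suc b) 1) ≡ false
      out₁ = BoolP.¬-not λ ins → proj₂ (proj₂ (up-inside⁻ (suc b) 1 ins)) (refl , refl)
      inc₂ : Increasing 2 q
      inc₂ = Increasing-raise q inc (All.map (λ {y} (lt , _) → ℕP.+-cancelˡ-≤ b 2 y (ℕP.≤-trans (ℕP.≤-reflexive (ℕP.+-comm b 2)) lt)) pos)
      st : State (suc b) (suc c) 2 q (1 ∷ [])
      st = record
        { increasing  = inc₂
        ; positions-q = pos
        ; decreasing  = s≤s (s≤s z≤n) , tt
        ; positions-r = (ℕP.≤-reflexive (ℕP.+-comm 1 b) , s≤s (ℕP.≤-trans (ℕP.≤-trans (s≤s (s≤s z≤n)) (ℕP.≤-reflexive (sym (cong suc (ℕP.+-suc c (c + 0)))))) (ℕP.m≤n+m (2 * suc c) b)) , ℕP.m≤n+m 2 (a + c)) ∷ []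
        ; total       = cong suc len }
      rep′ : Represents e (coverage (suc b) 2 q (1 ∷ []))
      rep′ o k′ B′ ins = trans (rep o k′ B′ ins) (trans
        (sym (coverage-skip (suc b) 0 q [] o k′ B′
          (λ { refl refl refl → ¬pos₀ (proj₁ (proj₂ (up-inside⁻ k′ B′ ins))) })
          (λ { refl refl refl → ¬pos₀ (proj₂ (dn-inside⁻ k′ B′ ins)) })))
        (sym (coverage-keep (suc b) 1 q [] o k′ B′ (λ { refl refl refl → proj₂ (proj₂ (up-inside⁻ k′ B′ ins)) (refl , refl) }))))
    count-upper (suc κ) κ<a q e inc pos len rep = begin
        fromℕ (completions R (below (suc k)) e)       ≡⟨ cong (λ ls → fromℕ (completions R ls e)) (below-suc k) ⟩
        fromℕ (completions R (remaining k W) e)       ≡⟨ UpperRow.transfer (κ + suc b) c k<K (dented b (suc c) (suc κ)) (dented-wall b (suc c) (suc κ)) (count-upper κ (ℕP.<⇒≤ κ<a))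
                                                           W 0 q [] e (ℕP.+-identityʳ W) (λ { _ _ (eq , _) → ℕP.m≢1+n+m (suc b) (sym eq) }) (initial-state k c q inc pos len) rep ⟩
        strictSum 0 (dented b (suc c) (suc κ)) q      ≡⟨ strictSum≡stepSum 0 _ q (dented-alternating b (suc c) (suc κ)) (λ _ _ ()) inc ⟩
        stepSum (dented b (suc c) (suc κ)) q          ≡⟨ dented-stepSum b (suc c) (suc κ) (All.map (Position-bound k) pos) ⟩
        dented b (suc c) (2 + κ) q                    ∎
      where
      open ≡-Reasoning
      k : ℕ
      k = suc κ + suc b
      k<K : k < K
      k<K = ℕP.≤-trans (s≤s (ℕP.+-monoˡ-≤ (suc b) κ<a)) (ℕP.≤-reflexive (solve 2 (λ a b → con 1 :+ (a :+ (con 1 :+ b)) := a :+ b :+ con 2) refl a b))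
        where open ℕS.+-*-Solver

    M≡dented : a ≤ suc b → fromℕ (M R) ≡ dented b (suc c) (suc a) (range (2 + a) c)
    M≡dented a≤ = begin
        fromℕ (M R)                                              ≡⟨ cong fromℕ (M≡completions R) ⟩
        fromℕ (completions R (lozengesIn R) (λ _ → 0))           ≡⟨ cong (λ ls → fromℕ (completions R ls (λ _ → 0))) all-lozenges ⟩
        fromℕ (completions R (below (suc (a + suc b))) (λ _ → 0)) ≡⟨ count-upper a ℕP.≤-refl X (λ _ → 0) (Increasing-weaken X z≤n (range-increasing (2 + a) c)) positions (length-range (2 + a) c) rep ⟩
        dented b (suc c) (suc a) X                               ∎
      where
      open ≡-Reasoning
      open ℕS.+-*-Solver
      X = range (2 + a) c
      range-All : ∀ lo n {P : ℕ → Set} → (∀ y → lo ≤ y → y < lo + n → P y) → All P (range lo n)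
      range-All lo zero    h = []
      range-All lo (suc n) h = h lo ℕP.≤-refl (ℕP.m<m+n lo (s≤s z≤n))
        ∷ range-All (suc lo) n (λ y lo<y y< → h y (ℕP.<⇒≤ lo<y) (ℕP.≤-trans y< (ℕP.≤-reflexive (sym (ℕP.+-suc lo n)))))
      K≡ : K ≡ suc (a + suc b)
      K≡ = solve 2 (λ a b → a :+ b :+ con 2 := con 1 :+ (a :+ (con 1 :+ b))) refl a b
      positions : All (Position (suc (a + suc b))) X
      positions = range-All (2 + a) c λ y lo≤y y< →
          ℕP.≤-trans (ℕP.≤-reflexive (solve 2 (λ a b → con 1 :+ (a :+ (con 1 :+ b)) := b :+ (con 2 :+ a)) refl a b)) (ℕP.+-monoʳ-≤ b lo≤y)
        -- Here `a ≤ suc b` enters: it keeps the leftmost top position `a + c + 1` east of the wall.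
        , ℕP.≤-trans (s≤s (ℕP.≤-trans (ℕP.+-mono-≤ (ℕP.≤-pred y<) (ℕP.≤-pred y<)) (ℕP.+-monoˡ-≤ (suc a + c) (s≤s (ℕP.+-monoˡ-≤ c a≤)))))
            (ℕP.≤-reflexive (solve 3 (λ a b c → con 1 :+ ((con 2 :+ b :+ c) :+ (con 1 :+ a :+ c)) := con 1 :+ (a :+ (con 1 :+ b)) :+ con 2 :* (con 1 :+ c)) refl a b c))
        , ℕP.≤-trans y< (ℕP.≤-reflexive (solve 2 (λ a c → con 2 :+ a :+ c := a :+ c :+ con 2) refl a c))
      rep : Represents (λ _ → 0) (coverage (a + suc b) 0 X [])
      rep o k B ins = sym (coverage-initial (a + suc b) X o k B (ℕP.≤-pred (ℕP.≤-trans (proj₁ (inside-bounds o k B ins)) (ℕP.≤-reflexive K≡)))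
        λ { refl refl → let _ , (lt , _ , B<W) = dn-inside⁻ k B ins in
            member-range (2 + a) c B (ℕP.+-cancelˡ-≤ b (2 + a) B (ℕP.≤-trans (ℕP.≤-reflexive (solve 2 (λ a b → b :+ (con 2 :+ a) := con 1 :+ (a :+ (con 1 :+ b))) refl a b)) lt))
              (ℕP.≤-trans B<W (ℕP.≤-reflexive (solve 2 (λ a c → a :+ c :+ con 2 := con 2 :+ a :+ c) refl a c))) })
      empty-top : row K (a + c + 3) ≡ []
      empty-top = concatMap-[] _ (upTo (a + c + 3)) (λ j → outside (+ j ℤ.- + suc a))
        where
        outside : ∀ i → lozengesAt i (+ K) ≡ []
        outside i = cong (λ x → if x then keep i (+ K) d₀ (keep i (+ K) d₁ (keep i (+ K) d₂ [])) else []) (BoolP.¬-not λ ins → absurd i ins (locate up i (+ K) ins))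
          where
          absurd : ∀ i → inside (tri up i (+ K)) ≡ true → (∃₂ λ k B → i ≡ column B × + K ≡ + k) → ⊥
          absurd .(column B) ins (k , B , refl , _) = ℕP.<-irrefl refl (proj₁ (inside-bounds up K B ins))
      all-lozenges : lozengesIn R ≡ below (suc (a + suc b))
      all-lozenges = begin
        lozengesIn R                      ≡⟨ lozengesIn≡below ⟩
        below (a + b + 3)                 ≡⟨ cong below (ℕP.+-suc (a + b) 2) ⟩
        below (suc K)                     ≡⟨ concatMap-upTo-suc _ K ⟩
        below K ++ row K (a + c + 3)      ≡⟨ cong (below K ++_) empty-top ⟩
        below K ++ []                     ≡⟨ ListP.++-identityʳ (below K) ⟩
        below K                           ≡⟨ cong below K≡ ⟩
        below (suc (a + suc b))           ∎

  -- Both counts are values of the same function `dented b (suc c)`: the top line for `suc b` is one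
  -- above that for `b`, and the forced step carries one top block to the other.
  M-tight : ∀ b c → M (S (suc b) b c) ≡ M (S b b c)
  M-tight b c = fromℕ-injective (begin
      fromℕ (M (S (suc b) b c))                        ≡⟨ Phases.M≡dented (suc b) b c ℕP.≤-refl ⟩
      dented b (suc c) (2 + b) (range (3 + b) c)       ≡⟨ dented-stepSum b (suc c) (suc b) (All.map (λ y< → ℕP.≤-trans (ℕP.<⇒≤ y<) bound) (range-bounded (3 + b) c ℕP.≤-refl)) ⟨
      stepSum (dented b (suc c) (suc b)) (range (3 + b) c)
        ≡⟨ stepSum-tight (2 + b) c (dented b (suc c) (suc b)) (dented-alternating b (suc c) (suc b)) (λ rs → dented-wall b (suc c) (suc b) rs (2 + b + c) [] wall) ⟩
      dented b (suc c) (suc b) (range (2 + b) c)       ≡⟨ Phases.M≡dented b b c (ℕP.n≤1+n b) ⟨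
      fromℕ (M (S b b c))                              ∎)
    where
    open ≡-Reasoning
    open ℕS.+-*-Solver
    wall : 2 + b + c + (2 + b + c) ≡ suc b + suc b + 2 * suc c
    wall = solve 2 (λ b c → con 2 :+ b :+ c :+ (con 2 :+ b :+ c) := con 1 :+ b :+ (con 1 :+ b) :+ con 2 :* (con 1 :+ c)) refl b c
    bound : 3 + b + c ≤ suc b + suc b + 2 * suc c
    bound = ℕP.≤-trans (ℕP.m≤m+n (3 + b + c) (1 + b + c)) (ℕP.≤-reflexive (solve 2 (λ b c → con 3 :+ b :+ c :+ (con 1 :+ b :+ c) := con 1 :+ b :+ (con 1 :+ b) :+ con 2 :* (con 1 :+ c)) refl b c))

open Tilings

module Evaluation where

  open import Data.Rational using (_+_; _*_; _-_; -_)
  open ℚS.+-*-Solver using (solve; _:+_; _:*_; _:-_; :-_; _:=_; con)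

  private module ℕR = ℕS.+-*-Solver

  -- Vandermonde evaluation of the path counts.

  2*suc : ∀ k n → k ℕ.+ 2 ℕ.* suc n ≡ 2 ℕ.+ (k ℕ.+ 2 ℕ.* n)
  2*suc = ℕR.solve 2 (λ k n → k ℕR.:+ ℕR.con 2 ℕR.:* (ℕR.con 1 ℕR.:+ n) ℕR.:= ℕR.con 2 ℕR.:+ (k ℕR.:+ ℕR.con 2 ℕR.:* n)) refl

  node : ℕ → ℕ → ℚ
  node s y = fromℕ (s ℕ.∸ y) * fromℕ y

  -- The roots i(s - i) come from (A - i)(B - i) = AB - i(A + B) + i² with A + B = `s`: these are
  -- Newton polynomials in the variable AB.
  newton : ℕ → ℕ → ℚ → ℚ
  newton s zero    u = 1ℚ
  newton s (suc j) u = (u - (fromℕ j * fromℕ s - fromℕ j * fromℕ j)) * newton s j u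

  newton-monic : ∀ s j → Monic j (newton s j)
  newton-monic s zero    u = refl
  newton-monic s (suc j) = monic-* j {newton s j} (fromℕ j * fromℕ s - fromℕ j * fromℕ j) (newton-monic s j)

  φ-newton : ∀ s y → y ℕ.≤ s → ∀ j → φ s y j ≡ φ s y 0 * newton s j (node s y)
  φ-newton s y y≤s zero    = sym (ℚP.*-identityʳ (φ s y 0))
  φ-newton s y y≤s (suc j) = begin
      (A - B) * ((A - J) * X) * ((B - J) * Y)
        ≡⟨ solve 5 (λ a b j x y → (a :- b) :* ((a :- j) :* x) :* ((b :- j) :* y) := (a :* b :- (j :* (a :+ b) :- j :* j)) :* ((a :- b) :* x :* y)) refl A B J X Y ⟩
      (A * B - (J * (A + B) - J * J)) * φ s y j
        ≡⟨ cong₂ (λ t z → (A * B - (J * t - J * J)) * z) (trans (sym (fromℕ-+ (s ℕ.∸ y) y)) (cong fromℕ (ℕP.m∸n+n≡m y≤s))) (φ-newton s y y≤s j) ⟩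
      (A * B - (J * fromℕ s - J * J)) * (φ s y 0 * newton s j (node s y))
        ≡⟨ solve 3 (λ k f n → k :* (f :* n) := f :* (k :* n)) refl (A * B - (J * fromℕ s - J * J)) (φ s y 0) (newton s j (node s y)) ⟩
      φ s y 0 * newton s (suc j) (node s y) ∎
    where
    open ≡-Reasoning
    A = fromℕ (s ℕ.∸ y)
    B = fromℕ y
    J = fromℕ j
    X = ρ (s ℕ.∸ y) j
    Y = ρ y j

  det-product : ∀ s {q} → All (ℕ._≤ s) q →
    det (φ s) q (range 0 (length q)) ≡ product (λ y → φ s y 0) q * vandermonde (map (node s) q)
  det-product s {q} q≤s = begin
      det (φ s) q cs                                                            ≡⟨ det-cong cs (All.map (λ {y} → φ-newton s y) q≤s) ⟩
      det (λ y j → φ s y 0 * newton s j (node s y)) q cs                        ≡⟨ det-row-factor (λ y → φ s y 0) (λ y j → newton s j (node s y)) q cs ⟩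
      product (λ y → φ s y 0) q * det (λ y j → newton s j (node s y)) q cs      ≡⟨ cong (product (λ y → φ s y 0) q *_) (begin
        det (λ y j → newton s j (node s y)) q cs                                  ≡⟨ det-map-rows (λ u j → newton s j u) (node s) q cs ⟨
        det (λ u j → newton s j u) (map (node s) q) cs                            ≡⟨ cong (λ n → det (λ u j → newton s j u) (map (node s) q) (range 0 n)) (ListP.length-map (node s) q) ⟨
        det (λ u j → newton s j u) (map (node s) q) (range 0 (length (map (node s) q))) ≡⟨ det-vandermonde (newton s) (newton-monic s) (map (node s) q) ⟩
        vandermonde (map (node s) q)                                              ∎) ⟩
      product (λ y → φ s y 0) q * vandermonde (map (node s) q)                  ∎
    where
    open ≡-Reasoning
    cs = range 0 (length q)

  -- Shifting the argument by one over a block changes only the two end factors;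
  -- cross-multiplication avoids dividing by values of `f`.
  product-telescope : ∀ (f : ℕ → ℚ) lo m → product (f ∘ suc) (range lo m) * f lo ≡ product f (range lo m) * f (lo ℕ.+ m)
  product-telescope f lo zero    = cong (λ z → 1ℚ * f z) (sym (ℕP.+-identityʳ lo))
  product-telescope f lo (suc m) = begin
      f (suc lo) * product (f ∘ suc) (range (suc lo) m) * f lo     ≡⟨ solve 3 (λ x p y → x :* p :* y := y :* (p :* x)) refl (f (suc lo)) (product (f ∘ suc) (range (suc lo) m)) (f lo) ⟩
      f lo * (product (f ∘ suc) (range (suc lo) m) * f (suc lo))   ≡⟨ cong (f lo *_) (product-telescope f (suc lo) m) ⟩
      f lo * (product f (range (suc lo) m) * f (suc lo ℕ.+ m))     ≡⟨ sym (ℚP.*-assoc (f lo) (product f (range (suc lo) m)) (f (suc lo ℕ.+ m))) ⟩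
      f lo * product f (range (suc lo) m) * f (suc lo ℕ.+ m)       ≡⟨ cong (λ z → f lo * product f (range (suc lo) m) * f z) (sym (ℕP.+-suc lo m)) ⟩
      f lo * product f (range (suc lo) m) * f (lo ℕ.+ suc m)       ∎
    where open ≡-Reasoning

  product-cong-All : ∀ {P : Set} {g h : P → ℚ} {xs} → All (λ x → g x ≡ h x) xs → product g xs ≡ product h xs
  product-cong-All []          = refl
  product-cong-All (eq ∷ eqs) = cong₂ _*_ eq (product-cong-All eqs)

  product-range-suc : ∀ (f : ℕ → ℚ) lo m → product f (range (suc lo) m) ≡ product (f ∘ suc) (range lo m)
  product-range-suc f lo m = trans (cong (product f) (sym (map-suc-range lo m))) (product-map f suc (range lo m))

  -- Moving the first position from 0 to 1 affects only its row factor and the node differences to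
  -- it. These differences are (s - y) y for position 0 and (s - 1 - y)(y - 1) for position 1, so
  -- their ratio telescopes over the block; the row factors have ratio s - 2.
  walks-dent : ∀ n k lo → suc lo ℕ.+ n ℕ.≤ suc (k ℕ.+ 2 ℕ.* n) →
    let s = suc (suc (k ℕ.+ 2 ℕ.* n)) ; A = λ y → fromℕ s - fromℕ y in
    walks (suc n) k (1 ∷ range (suc lo) n) * (A (suc lo) * fromℕ (lo ℕ.+ n)) ≡
    (fromℕ s - 1ℚ - 1ℚ) * walks (suc n) k (0 ∷ range (suc lo) n) * (A (suc lo ℕ.+ n) * fromℕ lo)
  walks-dent n k lo le = begin
      coefficient (suc n) k * det (φ s₀) (1 ∷ X) cols * (A (suc lo) * fromℕ (lo ℕ.+ n))
        ≡⟨ cong (λ t → coefficient (suc n) k * det (φ t) (1 ∷ X) cols * (A (suc lo) * fromℕ (lo ℕ.+ n))) s≡ ⟩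
      Ck * det (φ s) (1 ∷ X) cols * (A (suc lo) * fromℕ (lo ℕ.+ n))
        ≡⟨ cong (λ t → Ck * t * (A (suc lo) * fromℕ (lo ℕ.+ n))) (det-first 1 (s≤s z≤n)) ⟩
      Ck * (φ s 1 0 * P₀ * (product (λ y → node s y - node s 1) X * V)) * (A (suc lo) * fromℕ (lo ℕ.+ n))
        ≡⟨ cong₂ (λ f p → Ck * (f * P₀ * (p * V)) * (A (suc lo) * fromℕ (lo ℕ.+ n))) φ₁ product₁ ⟩
      Ck * ((fromℕ s - 1ℚ - 1ℚ) * φ s 0 0 * P₀ * (PA₂ * PB * V)) * (A (suc lo) * fromℕ (lo ℕ.+ n))
        ≡⟨ solve 9 (λ C σ f P PA PB V x y → C :* (σ :* f :* P :* (PA :* PB :* V)) :* (x :* y) := C :* (σ :* f :* P :* V) :* ((PA :* x) :* (PB :* y))) refl Ck (fromℕ s - 1ℚ - 1ℚ) (φ s 0 0) P₀ PA₂ PB V (A (suc lo)) (fromℕ (lo ℕ.+ n)) ⟩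
      Ck * ((fromℕ s - 1ℚ - 1ℚ) * φ s 0 0 * P₀ * V) * ((PA₂ * A (suc lo)) * (PB * fromℕ (lo ℕ.+ n)))
        ≡⟨ cong₂ (λ x y → Ck * ((fromℕ s - 1ℚ - 1ℚ) * φ s 0 0 * P₀ * V) * (x * y)) (product-telescope (A ∘ suc) lo n) (sym (product-telescope fromℕ lo n)) ⟩
      Ck * ((fromℕ s - 1ℚ - 1ℚ) * φ s 0 0 * P₀ * V) * ((PA₁ * A (suc lo ℕ.+ n)) * (PB₁ * fromℕ lo))
        ≡⟨ solve 9 (λ C σ f P PA PB V x y → C :* (σ :* f :* P :* V) :* ((PA :* x) :* (PB :* y)) := σ :* (C :* (f :* P :* (PA :* PB :* V))) :* (x :* y)) refl Ck (fromℕ s - 1ℚ - 1ℚ) (φ s 0 0) P₀ PA₁ PB₁ V (A (suc lo ℕ.+ n)) (fromℕ lo) ⟩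
      (fromℕ s - 1ℚ - 1ℚ) * (Ck * (φ s 0 0 * P₀ * (PA₁ * PB₁ * V))) * (A (suc lo ℕ.+ n) * fromℕ lo)
        ≡⟨ cong (λ p → (fromℕ s - 1ℚ - 1ℚ) * (Ck * (φ s 0 0 * P₀ * (p * V))) * (A (suc lo ℕ.+ n) * fromℕ lo)) (sym product₀) ⟩
      (fromℕ s - 1ℚ - 1ℚ) * (Ck * (φ s 0 0 * P₀ * (product (λ y → node s y - node s 0) X * V))) * (A (suc lo ℕ.+ n) * fromℕ lo)
        ≡⟨ cong (λ t → (fromℕ s - 1ℚ - 1ℚ) * (Ck * t) * (A (suc lo ℕ.+ n) * fromℕ lo)) (sym (det-first 0 z≤n)) ⟩
      (fromℕ s - 1ℚ - 1ℚ) * (Ck * det (φ s) (0 ∷ X) cols) * (A (suc lo ℕ.+ n) * fromℕ lo)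
        ≡⟨ cong (λ t → (fromℕ s - 1ℚ - 1ℚ) * (coefficient (suc n) k * det (φ t) (0 ∷ X) cols) * (A (suc lo ℕ.+ n) * fromℕ lo)) (sym s≡) ⟩
      (fromℕ s - 1ℚ - 1ℚ) * walks (suc n) k (0 ∷ X) * (A (suc lo ℕ.+ n) * fromℕ lo) ∎
    where
    open ≡-Reasoning
    s₀ = k ℕ.+ 2 ℕ.* suc n
    s = suc (suc (k ℕ.+ 2 ℕ.* n))
    s≡ : s₀ ≡ s
    s≡ = 2*suc k n
    A : ℕ → ℚ
    A y = fromℕ s - fromℕ y
    X = range (suc lo) n
    cols = range 0 (suc n)
    Ck = coefficient (suc n) k
    P₀ = product (λ y → φ s y 0) X
    V  = vandermonde (map (node s) X)
    PA₁ PA₂ PB PB₁ : ℚ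
    PA₁ = product (A ∘ suc) (range lo n)
    PA₂ = product (A ∘ suc ∘ suc) (range lo n)
    PB  = product fromℕ (range lo n)
    PB₁ = product (fromℕ ∘ suc) (range lo n)
    X<s : All (ℕ._< s) X
    X<s = range-bounded (suc lo) n (ℕP.m≤n⇒m≤1+n le)
    X≤s : All (ℕ._≤ s) X
    X≤s = All.map ℕP.<⇒≤ X<s
    det-first : ∀ x → x ℕ.≤ s → det (φ s) (x ∷ X) cols ≡ φ s x 0 * P₀ * (product (λ y → node s y - node s x) X * V)
    det-first x x≤s = begin
      det (φ s) (x ∷ X) (range 0 (suc n))                          ≡⟨ cong (λ m → det (φ s) (x ∷ X) (range 0 (suc m))) (sym (length-range (suc lo) n)) ⟩
      det (φ s) (x ∷ X) (range 0 (length (x ∷ X)))                 ≡⟨ det-product s (x≤s ∷ X≤s) ⟩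
      φ s x 0 * P₀ * (product (_- node s x) (map (node s) X) * V)  ≡⟨ cong (λ p → φ s x 0 * P₀ * (p * V)) (product-map (_- node s x) (node s) X) ⟩
      φ s x 0 * P₀ * (product (λ y → node s y - node s x) X * V)   ∎
    node-A : ∀ {y} → y ℕ.≤ s → node s y ≡ A y * fromℕ y
    node-A {y} y≤s = cong (_* fromℕ y) (fromℕ-∸ y≤s)
    product₁ : product (λ y → node s y - node s 1) X ≡ PA₂ * PB
    product₁ = begin
      product (λ y → node s y - node s 1) X
        ≡⟨ product-cong-All (All.map (λ {y} y≤s → trans (cong₂ _-_ (node-A y≤s) (node-A (s≤s z≤n))) (solve 2 (λ t y → (t :- y) :* y :- (t :- con 1ℚ) :* con 1ℚ := (t :- (con 1ℚ :+ y)) :* (y :- con 1ℚ)) refl (fromℕ s) (fromℕ y))) X≤s) ⟩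
      product (λ y → (fromℕ s - (1ℚ + fromℕ y)) * (fromℕ y - 1ℚ)) X
        ≡⟨ product-range-suc (λ y → (fromℕ s - (1ℚ + fromℕ y)) * (fromℕ y - 1ℚ)) lo n ⟩
      product (λ y → (fromℕ s - (1ℚ + fromℕ (suc y))) * (fromℕ (suc y) - 1ℚ)) (range lo n)
        ≡⟨ product-cong (range lo n) (λ y → cong₂ _*_ (cong (_-_ (fromℕ s)) (sym (fromℕ-suc (suc y))))
             (trans (cong (_- 1ℚ) (fromℕ-suc y)) (solve 1 (λ y → con 1ℚ :+ y :- con 1ℚ := y) refl (fromℕ y)))) ⟩
      product (λ y → A (suc (suc y)) * fromℕ y) (range lo n)
        ≡⟨ product-* (A ∘ suc ∘ suc) fromℕ (range lo n) ⟩
      PA₂ * PB ∎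
    product₀ : product (λ y → node s y - node s 0) X ≡ PA₁ * PB₁
    product₀ = begin
      product (λ y → node s y - node s 0) X
        ≡⟨ product-cong-All (All.map (λ {y} y≤s → trans (cong₂ _-_ (node-A y≤s) (ℚP.*-zeroʳ (fromℕ s))) (solve 1 (λ z → z :- con 0ℚ := z) refl (A y * fromℕ y))) X≤s) ⟩
      product (λ y → A y * fromℕ y) X                              ≡⟨ product-range-suc (λ y → A y * fromℕ y) lo n ⟩
      product (λ y → A (suc y) * fromℕ (suc y)) (range lo n)       ≡⟨ product-* (A ∘ suc) (fromℕ ∘ suc) (range lo n) ⟩
      PA₁ * PB₁ ∎
    φ₁ : φ s 1 0 ≡ (fromℕ s - 1ℚ - 1ℚ) * φ s 0 0
    φ₁ = begin
      (fromℕ t - 1ℚ) * inverse-factorial t * inverse-factorial 1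
        ≡⟨ cong (λ z → (z - 1ℚ) * inverse-factorial t * 1ℚ) (trans (solve 1 (λ t → t := con 1ℚ :+ t :- con 1ℚ) refl (fromℕ t)) (cong (_- 1ℚ) (sym (fromℕ-suc t)))) ⟩
      (fromℕ s - 1ℚ - 1ℚ) * inverse-factorial t * 1ℚ
        ≡⟨ cong (λ z → (fromℕ s - 1ℚ - 1ℚ) * z * 1ℚ) (sym (suc*inverse-factorial t)) ⟩
      (fromℕ s - 1ℚ - 1ℚ) * (fromℕ s * inverse-factorial s) * 1ℚ
        ≡⟨ solve 3 (λ σ x y → σ :* (x :* y) :* con 1ℚ := σ :* ((x :- con 0ℚ) :* y :* con 1ℚ)) refl (fromℕ s - 1ℚ - 1ℚ) (fromℕ s) (inverse-factorial s) ⟩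
      (fromℕ s - 1ℚ - 1ℚ) * φ s 0 0 ∎
      where t = suc (k ℕ.+ 2 ℕ.* n)

  -- Shifting the end positions by one.

  *-cancel-unit : ∀ {x y u v} → u * v ≡ 1ℚ → x * u ≡ y * u → x ≡ y
  *-cancel-unit {x} {y} {u} {v} uv≡1 eq = begin
      x            ≡⟨ sym (ℚP.*-identityʳ x) ⟩
      x * 1ℚ       ≡⟨ cong (x *_) (sym uv≡1) ⟩
      x * (u * v)  ≡⟨ sym (ℚP.*-assoc x u v) ⟩
      x * u * v    ≡⟨ cong (_* v) eq ⟩
      y * u * v    ≡⟨ ℚP.*-assoc y u v ⟩
      y * (u * v)  ≡⟨ cong (y *_) uv≡1 ⟩
      y * 1ℚ       ≡⟨ ℚP.*-identityʳ y ⟩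
      y            ∎
    where open ≡-Reasoning

  inv-unique : ∀ {p v} → p * v ≡ 1ℚ → inv p ≡ v
  inv-unique {p} {v} pv≡1 = *-cancel-unit {inv p} {v} {p} {v} pv≡1
    (trans (ℚP.*-comm (inv p) p) (trans (inv-inverseʳ p≢0) (trans (sym pv≡1) (ℚP.*-comm p v))))
    where
    p≢0 : p ≢ 0ℚ
    p≢0 refl with trans (sym (ℚP.*-zeroˡ v)) pv≡1
    ... | ()

  φ-shift : ∀ s y → y ℕ.≤ s → φ (2 ℕ.+ s) (suc y) 0 * (fromℕ (suc (s ℕ.∸ y)) * fromℕ (suc y)) ≡ φ s y 0
  φ-shift s y y≤s rewrite ℕP.+-∸-assoc 1 y≤s = begin
      (fromℕ (suc A) - fromℕ (suc y)) * inverse-factorial (suc A) * inverse-factorial (suc y) * (fromℕ (suc A) * fromℕ (suc y))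
        ≡⟨ solve 5 (λ x p q u v → x :* p :* q :* (u :* v) := x :* (u :* p) :* (v :* q)) refl (fromℕ (suc A) - fromℕ (suc y)) (inverse-factorial (suc A)) (inverse-factorial (suc y)) (fromℕ (suc A)) (fromℕ (suc y)) ⟩
      (fromℕ (suc A) - fromℕ (suc y)) * (fromℕ (suc A) * inverse-factorial (suc A)) * (fromℕ (suc y) * inverse-factorial (suc y))
        ≡⟨ cong₂ (λ p q → (fromℕ (suc A) - fromℕ (suc y)) * p * q) (suc*inverse-factorial A) (suc*inverse-factorial y) ⟩
      (fromℕ (suc A) - fromℕ (suc y)) * inverse-factorial A * inverse-factorial y
        ≡⟨ cong (λ z → z * inverse-factorial A * inverse-factorial y) (trans (cong₂ _-_ (fromℕ-suc A) (fromℕ-suc y)) (solve 2 (λ a b → (con 1ℚ :+ a) :- (con 1ℚ :+ b) := a :- b) refl (fromℕ A) (fromℕ y))) ⟩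
      (fromℕ A - fromℕ y) * inverse-factorial A * inverse-factorial y ∎
    where
    open ≡-Reasoning
    A = s ℕ.∸ y

  -- Raising A and B by one raises AB by A + B + 1, the same amount at all positions of a line, so
  -- the Vandermonde product does not change.
  node-shift : ∀ s y → y ℕ.≤ s → node (2 ℕ.+ s) (suc y) ≡ node s y + (1ℚ + fromℕ s)
  node-shift s y y≤s rewrite ℕP.+-∸-assoc 1 y≤s = begin
      fromℕ (suc A) * fromℕ (suc y)                  ≡⟨ cong₂ _*_ (fromℕ-suc A) (fromℕ-suc y) ⟩
      (1ℚ + fromℕ A) * (1ℚ + fromℕ y)                ≡⟨ solve 2 (λ a y → (con 1ℚ :+ a) :* (con 1ℚ :+ y) := a :* y :+ (con 1ℚ :+ (a :+ y))) refl (fromℕ A) (fromℕ y) ⟩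
      fromℕ A * fromℕ y + (1ℚ + (fromℕ A + fromℕ y)) ≡⟨ cong (λ z → fromℕ A * fromℕ y + (1ℚ + z)) (trans (sym (fromℕ-+ A y)) (cong fromℕ (ℕP.m∸n+n≡m y≤s))) ⟩
      fromℕ A * fromℕ y + (1ℚ + fromℕ s)             ∎
    where
    open ≡-Reasoning
    A = s ℕ.∸ y

  vandermonde-translate : ∀ t us → vandermonde (map (_+ t) us) ≡ vandermonde us
  vandermonde-translate t []       = refl
  vandermonde-translate t (u ∷ us) = cong₂ _*_
    (trans (product-map (_- (u + t)) (_+ t) us) (product-cong us (λ x → solve 3 (λ x t u → x :+ t :- (u :+ t) := x :- u) refl x t u)))
    (vandermonde-translate t us)

  map-suc-bounded : ∀ {s q} → All (ℕ._≤ s) q → All (ℕ._≤ 2 ℕ.+ s) (map suc q)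
  map-suc-bounded []          = []
  map-suc-bounded (y≤s ∷ q≤s) = ℕP.m≤n⇒m≤1+n (s≤s y≤s) ∷ map-suc-bounded q≤s

  det-shift : ∀ s {q} → All (ℕ._≤ s) q →
    det (φ (2 ℕ.+ s)) (map suc q) (range 0 (length q)) * product (λ y → fromℕ (suc (s ℕ.∸ y)) * fromℕ (suc y)) q ≡ det (φ s) q (range 0 (length q))
  det-shift s {q} q≤s = begin
      det (φ (2 ℕ.+ s)) (map suc q) (range 0 (length q)) * G
        ≡⟨ cong (λ n → det (φ (2 ℕ.+ s)) (map suc q) (range 0 n) * G) (ListP.length-map suc q) ⟨
      det (φ (2 ℕ.+ s)) (map suc q) (range 0 (length (map suc q))) * G
        ≡⟨ cong (_* G) (det-product (2 ℕ.+ s) (map-suc-bounded q≤s)) ⟩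
      product (λ y → φ (2 ℕ.+ s) y 0) (map suc q) * vandermonde (map (node (2 ℕ.+ s)) (map suc q)) * G
        ≡⟨ cong₂ (λ x y → x * y * G) (product-map (λ y → φ (2 ℕ.+ s) y 0) suc q) nodes ⟩
      product (λ y → φ (2 ℕ.+ s) (suc y) 0) q * vandermonde (map (node s) q) * G
        ≡⟨ solve 3 (λ x y z → x :* y :* z := x :* z :* y) refl (product (λ y → φ (2 ℕ.+ s) (suc y) 0) q) (vandermonde (map (node s) q)) G ⟩
      product (λ y → φ (2 ℕ.+ s) (suc y) 0) q * G * vandermonde (map (node s) q)
        ≡⟨ cong (_* vandermonde (map (node s) q)) (trans (sym (product-* (λ y → φ (2 ℕ.+ s) (suc y) 0) g q)) (product-cong-All (All.map (λ {y} → φ-shift s y) q≤s))) ⟩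
      product (λ y → φ s y 0) q * vandermonde (map (node s) q)
        ≡⟨ det-product s q≤s ⟨
      det (φ s) q (range 0 (length q)) ∎
    where
    open ≡-Reasoning
    g : ℕ → ℚ
    g y = fromℕ (suc (s ℕ.∸ y)) * fromℕ (suc y)
    G = product g q
    map-nodes : ∀ {q} → All (ℕ._≤ s) q → map (node (2 ℕ.+ s)) (map suc q) ≡ map (_+ (1ℚ + fromℕ s)) (map (node s) q)
    map-nodes []                  = refl
    map-nodes (_∷_ {y} y≤s q≤s) = cong₂ _∷_ (node-shift s y y≤s) (map-nodes q≤s)
    nodes : vandermonde (map (node (2 ℕ.+ s)) (map suc q)) ≡ vandermonde (map (node s) q)
    nodes = trans (cong vandermonde (map-nodes q≤s)) (vandermonde-translate (1ℚ + fromℕ s) (map (node s) q))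

  eigenproduct : ℕ → ℕ → ℚ
  eigenproduct s n = product (eigenvalue s) (range 0 n)

  eigenproduct-suc : ∀ s n → eigenproduct (2 ℕ.+ s) (suc n) ≡ fromℕ (2 ℕ.+ s) * eigenproduct s n
  eigenproduct-suc s n = cong₂ _*_ (solve 1 (λ x → x :- (con 0ℚ :+ con 0ℚ) := x) refl (fromℕ (2 ℕ.+ s)))
    (trans (product-range-suc (eigenvalue (2 ℕ.+ s)) 0 n) (product-cong (range 0 n) shift))
    where
    shift : ∀ j → eigenvalue (2 ℕ.+ s) (suc j) ≡ eigenvalue s j
    shift j = trans (cong₂ (λ x y → x - (y + y)) (trans (fromℕ-suc (suc s)) (cong (λ z → 1ℚ + z) (fromℕ-suc s))) (fromℕ-suc j))
      (solve 2 (λ s j → (con 1ℚ :+ (con 1ℚ :+ s)) :- ((con 1ℚ :+ j) :+ (con 1ℚ :+ j)) := s :- (j :+ j)) refl (fromℕ s) (fromℕ j))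

  walks-peel : ∀ n k {q} → All (ℕ._≤ k ℕ.+ 2 ℕ.* n) q →
    walks (suc n) k (0 ∷ map suc q) ≡ coefficient (suc n) k * (inverse-factorial (suc (k ℕ.+ 2 ℕ.* n)) * det (φ (k ℕ.+ 2 ℕ.* n)) q (range 0 n))
  walks-peel n k {q} q≤ = trans
    (cong (λ s → coefficient (suc n) k * det (φ s) (0 ∷ map suc q) (range 0 (suc n))) (2*suc k n))
    (cong (coefficient (suc n) k *_) (det-peel (k ℕ.+ 2 ℕ.* n) n q≤))

  -- For all paths but the first, two more lines and a shift by one raise both A and B by one, so
  -- `det-shift` applies. The two lines contribute two eigenvalue products, whose leading factors
  -- `2 + s` and `3 + s` cancel against the factorials split off with the first path.
  walks-shift : ∀ n k {q} → length q ≡ n → All (ℕ._≤ k ℕ.+ 2 ℕ.* n) q → let s = k ℕ.+ 2 ℕ.* n in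
    walks (suc n) (2 ℕ.+ k) (0 ∷ map suc (map suc q)) * product (λ y → fromℕ (suc (s ℕ.∸ y)) * fromℕ (suc y)) q ≡
    walks (suc n) k (0 ∷ map suc q) * (eigenproduct s n * eigenproduct (suc s) n)
  walks-shift n k {q} refl q≤ = begin
      walks (suc n) (2 ℕ.+ k) (0 ∷ map suc (map suc q)) * G
        ≡⟨ cong (_* G) (walks-peel n (2 ℕ.+ k) (map-suc-bounded q≤)) ⟩
      Ck * eigenproduct (k ℕ.+ 2 ℕ.* suc n) (suc n) * eigenproduct (suc (k ℕ.+ 2 ℕ.* suc n)) (suc n) * (inverse-factorial (3 ℕ.+ s) * det (φ (2 ℕ.+ s)) (map suc q) (range 0 n)) * G
        ≡⟨ cong (λ t → Ck * eigenproduct t (suc n) * eigenproduct (suc t) (suc n) * (inverse-factorial (3 ℕ.+ s) * det (φ (2 ℕ.+ s)) (map suc q) (range 0 n)) * G) (2*suc k n) ⟩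
      Ck * eigenproduct (2 ℕ.+ s) (suc n) * eigenproduct (3 ℕ.+ s) (suc n) * (inverse-factorial (3 ℕ.+ s) * det (φ (2 ℕ.+ s)) (map suc q) (range 0 n)) * G
        ≡⟨ cong₂ (λ x y → Ck * x * y * (inverse-factorial (3 ℕ.+ s) * det (φ (2 ℕ.+ s)) (map suc q) (range 0 n)) * G) (eigenproduct-suc s n) (eigenproduct-suc (suc s) n) ⟩
      Ck * (fromℕ (2 ℕ.+ s) * e₀) * (fromℕ (3 ℕ.+ s) * e₁) * (inverse-factorial (3 ℕ.+ s) * det (φ (2 ℕ.+ s)) (map suc q) (range 0 n)) * G
        ≡⟨ solve 8 (λ C x e y f i D G → C :* (x :* e) :* (y :* f) :* (i :* D) :* G := C :* (x :* (y :* i)) :* (D :* G) :* (e :* f)) refl Ck (fromℕ (2 ℕ.+ s)) e₀ (fromℕ (3 ℕ.+ s)) e₁ (inverse-factorial (3 ℕ.+ s)) (det (φ (2 ℕ.+ s)) (map suc q) (range 0 n)) G ⟩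
      Ck * (fromℕ (2 ℕ.+ s) * (fromℕ (3 ℕ.+ s) * inverse-factorial (3 ℕ.+ s))) * (det (φ (2 ℕ.+ s)) (map suc q) (range 0 n) * G) * (e₀ * e₁)
        ≡⟨ cong₂ (λ x y → Ck * x * y * (e₀ * e₁)) (trans (cong (fromℕ (2 ℕ.+ s) *_) (suc*inverse-factorial (2 ℕ.+ s))) (suc*inverse-factorial (suc s))) (det-shift s q≤) ⟩
      Ck * inverse-factorial (suc s) * det (φ s) q (range 0 n) * (e₀ * e₁)
        ≡⟨ cong (_* (e₀ * e₁)) (trans (ℚP.*-assoc Ck (inverse-factorial (suc s)) _) (sym (walks-peel n k q≤))) ⟩
      walks (suc n) k (0 ∷ map suc q) * (e₀ * e₁) ∎
    where
    open ≡-Reasoning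
    s = k ℕ.+ 2 ℕ.* n
    Ck = coefficient (suc n) k
    e₀ = eigenproduct s n
    e₁ = eigenproduct (suc s) n
    G = product (λ y → fromℕ (suc (s ℕ.∸ y)) * fromℕ (suc y)) q

  -- Each product descends in steps of two and the two have opposite parity, so together they form a
  -- run of consecutive integers from m + 2 up.
  eigenproduct-factorial : ∀ m n → eigenproduct (m ℕ.+ 2 ℕ.* n) n * eigenproduct (suc (m ℕ.+ 2 ℕ.* n)) n * factorial (suc m) ≡ factorial (suc (m ℕ.+ 2 ℕ.* n))
  eigenproduct-factorial m zero = trans (ℚP.*-identityˡ _) (cong (factorial ∘ suc) (sym (ℕP.+-identityʳ m)))
  eigenproduct-factorial m (suc n) = begin
      eigenproduct (m ℕ.+ 2 ℕ.* suc n) (suc n) * eigenproduct (suc (m ℕ.+ 2 ℕ.* suc n)) (suc n) * factorial (suc m)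
        ≡⟨ cong (λ t → eigenproduct t (suc n) * eigenproduct (suc t) (suc n) * factorial (suc m)) (2*suc m n) ⟩
      eigenproduct (2 ℕ.+ s) (suc n) * eigenproduct (3 ℕ.+ s) (suc n) * factorial (suc m)
        ≡⟨ cong₂ (λ x y → x * y * factorial (suc m)) (eigenproduct-suc s n) (eigenproduct-suc (suc s) n) ⟩
      fromℕ (2 ℕ.+ s) * eigenproduct s n * (fromℕ (3 ℕ.+ s) * eigenproduct (suc s) n) * factorial (suc m)
        ≡⟨ solve 5 (λ x e y f g → x :* e :* (y :* f) :* g := y :* (x :* (e :* f :* g))) refl (fromℕ (2 ℕ.+ s)) (eigenproduct s n) (fromℕ (3 ℕ.+ s)) (eigenproduct (suc s) n) (factorial (suc m)) ⟩
      fromℕ (3 ℕ.+ s) * (fromℕ (2 ℕ.+ s) * (eigenproduct s n * eigenproduct (suc s) n * factorial (suc m)))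
        ≡⟨ cong (λ z → fromℕ (3 ℕ.+ s) * (fromℕ (2 ℕ.+ s) * z)) (eigenproduct-factorial m n) ⟩
      factorial (3 ℕ.+ s)
        ≡⟨ cong (factorial ∘ suc) (2*suc m n) ⟨
      factorial (suc (m ℕ.+ 2 ℕ.* suc n)) ∎
    where
    open ≡-Reasoning
    s = m ℕ.+ 2 ℕ.* n

  rising-product : ∀ α n → product (fromℕ ∘ suc) (range α n) * factorial α ≡ factorial (α ℕ.+ n)
  rising-product α zero    = trans (ℚP.*-identityˡ (factorial α)) (cong factorial (sym (ℕP.+-identityʳ α)))
  rising-product α (suc n) = begin
      fromℕ (suc α) * product (fromℕ ∘ suc) (range (suc α) n) * factorial α     ≡⟨ solve 3 (λ x p f → x :* p :* f := p :* (x :* f)) refl (fromℕ (suc α)) (product (fromℕ ∘ suc) (range (suc α) n)) (factorial α) ⟩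
      product (fromℕ ∘ suc) (range (suc α) n) * factorial (suc α)               ≡⟨ rising-product (suc α) n ⟩
      factorial (suc α ℕ.+ n)                                                   ≡⟨ cong factorial (ℕP.+-suc α n) ⟨
      factorial (α ℕ.+ suc n)                                                   ∎
    where open ≡-Reasoning

  falling-product : ∀ s α t n → s ≡ α ℕ.+ (t ℕ.+ n) → product (λ y → fromℕ (suc (s ℕ.∸ y))) (range α n) * factorial (suc t) ≡ factorial (suc (t ℕ.+ n))
  falling-product s α t zero    eq = trans (ℚP.*-identityˡ _) (cong (factorial ∘ suc) (sym (ℕP.+-identityʳ t)))
  falling-product s α t (suc n) eq = begin
      fromℕ (suc (s ℕ.∸ α)) * product (λ y → fromℕ (suc (s ℕ.∸ y))) (range (suc α) n) * factorial (suc t)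
        ≡⟨ ℚP.*-assoc (fromℕ (suc (s ℕ.∸ α))) _ _ ⟩
      fromℕ (suc (s ℕ.∸ α)) * (product (λ y → fromℕ (suc (s ℕ.∸ y))) (range (suc α) n) * factorial (suc t))
        ≡⟨ cong₂ (λ x y → fromℕ (suc x) * y) (trans (cong (ℕ._∸ α) eq) (trans (ℕP.m+n∸m≡n α (t ℕ.+ suc n)) (ℕP.+-suc t n)))
             (falling-product s (suc α) t n (trans eq (trans (cong (α ℕ.+_) (ℕP.+-suc t n)) (ℕP.+-suc α (t ℕ.+ n))))) ⟩
      factorial (suc (suc (t ℕ.+ n)))
        ≡⟨ cong (factorial ∘ suc) (ℕP.+-suc t n) ⟨
      factorial (suc (t ℕ.+ suc n)) ∎
    where open ≡-Reasoning

  -- Pochhammer symbols and factorials.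

  prodℕ-cong : ∀ n {f g : ℕ → ℚ} → (∀ j → f j ≡ g j) → prodℕ n f ≡ prodℕ n g
  prodℕ-cong zero    f≗g = refl
  prodℕ-cong (suc n) f≗g = cong₂ _*_ (prodℕ-cong n f≗g) (f≗g n)

  prodℕ-head : ∀ n f → prodℕ (suc n) f ≡ f 0 * prodℕ n (f ∘ suc)
  prodℕ-head zero    f = trans (ℚP.*-identityˡ (f 0)) (sym (ℚP.*-identityʳ (f 0)))
  prodℕ-head (suc n) f = trans (cong (_* f (suc n)) (prodℕ-head n f)) (ℚP.*-assoc (f 0) (prodℕ n (f ∘ suc)) (f (suc n)))

  poch-factorial : ∀ m k → poch (fromℕ (suc m)) (+ k) * factorial m ≡ factorial (m ℕ.+ k)
  poch-factorial m zero    = trans (ℚP.*-identityˡ (factorial m)) (cong factorial (sym (ℕP.+-identityʳ m)))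
  poch-factorial m (suc k) = begin
      poch (fromℕ (suc m)) (+ k) * (fromℕ (suc m) + fromℕ k) * factorial m     ≡⟨ solve 3 (λ p x f → p :* x :* f := x :* (p :* f)) refl (poch (fromℕ (suc m)) (+ k)) (fromℕ (suc m) + fromℕ k) (factorial m) ⟩
      (fromℕ (suc m) + fromℕ k) * (poch (fromℕ (suc m)) (+ k) * factorial m)   ≡⟨ cong₂ _*_ (sym (fromℕ-+ (suc m) k)) (poch-factorial m k) ⟩
      factorial (suc (m ℕ.+ k))                                                ≡⟨ cong factorial (ℕP.+-suc m k) ⟨
      factorial (m ℕ.+ suc k)                                                  ∎
    where open ≡-Reasoning

  -- The exponent `k - 1` includes `k = 0`, where the symbol is a reciprocal; this is the case
  -- `a = 0` of the prefactor in the formula.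
  poch-head : ∀ m k → fromℕ (suc m) * poch (fromℕ (2 ℕ.+ m)) (+ k ℤ.- + 1) ≡ poch (fromℕ (suc m)) (+ k)
  poch-head m zero = begin
      fromℕ (suc m) * inv (1ℚ * (fromℕ (2 ℕ.+ m) - 1ℚ))   ≡⟨ cong (λ x → fromℕ (suc m) * inv (1ℚ * (x - 1ℚ))) (fromℕ-suc (suc m)) ⟩
      fromℕ (suc m) * inv (1ℚ * (1ℚ + fromℕ (suc m) - 1ℚ)) ≡⟨ cong (λ x → fromℕ (suc m) * inv x) (solve 1 (λ x → con 1ℚ :* (con 1ℚ :+ x :- con 1ℚ) := x) refl (fromℕ (suc m))) ⟩
      fromℕ (suc m) * inv (fromℕ (suc m))                 ≡⟨ inv-inverseʳ (fromℕ-suc≢0 m) ⟩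
      1ℚ                                                  ∎
    where open ≡-Reasoning
  poch-head m (suc k) = sym (trans (prodℕ-head k (λ j → fromℕ (suc m) + fromℕ j)) (cong₂ _*_ (solve 1 (λ x → x :+ con 0ℚ := x) refl (fromℕ (suc m)))
    (prodℕ-cong k (λ j → trans (cong (λ z → fromℕ (suc m) + z) (fromℕ-suc j)) (trans (solve 2 (λ x j → x :+ (con 1ℚ :+ j) := (con 1ℚ :+ x) :+ j) refl (fromℕ (suc m)) (fromℕ j)) (cong (_+ fromℕ j) (sym (fromℕ-suc (suc m)))))))))

  -- With `d` for b - a and `α` for i - 1 these belong to the factor with index i in the product of
  -- the theorem.
  factor-numerator factor-denominator : ℕ → ℕ → ℕ → ℚ
  factor-numerator   d c α = poch (fromℕ (suc (c ℕ.+ α))) (+ suc d) * poch (fromℕ (suc (suc (α ℕ.+ d ℕ.+ c ℕ.+ c)))) (+ α)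
  factor-denominator d c α = poch (fromℕ (suc α)) (+ suc d) * poch (fromℕ (suc (suc (α ℕ.+ d)))) (+ α)

  -- The two symbols join to (2α + d + 1)! / α!.
  factor-denominator-unit : ∀ d c α → factor-denominator d c α * (factorial α * inverse-factorial (suc (α ℕ.+ (α ℕ.+ d)))) ≡ 1ℚ
  factor-denominator-unit d c α = begin
      p₃ * p₄ * (factorial α * g₅)       ≡⟨ solve 4 (λ x y f g → x :* y :* (f :* g) := y :* (x :* f) :* g) refl p₃ p₄ (factorial α) g₅ ⟩
      p₄ * (p₃ * factorial α) * g₅       ≡⟨ cong (λ z → p₄ * z * g₅) (trans (poch-factorial α (suc d)) (cong factorial (ℕP.+-suc α d))) ⟩
      p₄ * factorial (suc (α ℕ.+ d)) * g₅ ≡⟨ cong (_* g₅) (trans (poch-factorial (suc (α ℕ.+ d)) α) (cong (factorial ∘ suc) (ℕP.+-comm (α ℕ.+ d) α))) ⟩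
      factorial (suc (α ℕ.+ (α ℕ.+ d))) * g₅ ≡⟨ factorial-inverse (suc (α ℕ.+ (α ℕ.+ d))) ⟩
      1ℚ                                 ∎
    where
    open ≡-Reasoning
    p₃ = poch (fromℕ (suc α)) (+ suc d)
    p₄ = poch (fromℕ (suc (suc (α ℕ.+ d)))) (+ α)
    g₅ = inverse-factorial (suc (α ℕ.+ (α ℕ.+ d)))

  factor-denominator-inverse : ∀ d c α → factor-denominator d c α * inv (factor-denominator d c α) ≡ 1ℚ
  factor-denominator-inverse d c α = trans
    (cong (factor-denominator d c α *_) (inv-unique {factor-denominator d c α} {factorial α * inverse-factorial (suc (α ℕ.+ (α ℕ.+ d)))} (factor-denominator-unit d c α)))
    (factor-denominator-unit d c α)

  -- Path families ending in a block of consecutive positions (Proctor's plane partitions).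
  block : ℕ → ℕ → ℕ → ℚ
  block d c α = walks (suc c) (α ℕ.+ (α ℕ.+ d)) (0 ∷ range (suc α) c)

  -- Raising `α` by one means two more lines and a block shifted by one, so `walks-shift` gives the
  -- ratio. Its eigenvalue products and row factors are runs of consecutive integers, and in terms
  -- of factorials they match the Pochhammer symbols.
  block-step : ∀ d c α → block d c (suc α) * factor-denominator d c α ≡ block d c α * factor-numerator d c α
  block-step d c α = *-cancel-unit {u = f₁ * (PA * PB)} {v = f₃ * (g₂ * g₄)} unit (begin
      Θ′ * (p₃ * p₄) * (f₁ * (PA * PB))      ≡⟨ solve 6 (λ t x y f u v → t :* (x :* y) :* (f :* (u :* v)) := y :* (x :* f) :* (t :* (u :* v))) refl Θ′ p₃ p₄ f₁ PA PB ⟩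
      p₄ * (p₃ * f₁) * (Θ′ * (PA * PB))      ≡⟨ cong₂ _*_ (trans (cong (p₄ *_) h₃) h₄) shift ⟩
      f₅ * (Θ * E)                           ≡⟨ solve 3 (λ f t e → f :* (t :* e) := t :* (e :* f)) refl f₅ Θ E ⟩
      Θ * (E * f₅)                           ≡⟨ cong (Θ *_) (trans (eigenproduct-factorial k c) (sym h₂)) ⟩
      Θ * (p₂ * f₄)                          ≡⟨ cong (λ z → Θ * (p₂ * z)) (trans (sym hA) (cong (PA *_) (trans (sym h₁) (cong (p₁ *_) (sym hB))))) ⟩
      Θ * (p₂ * (PA * (p₁ * (PB * f₁))))     ≡⟨ solve 6 (λ t y u x v f → t :* (y :* (u :* (x :* (v :* f)))) := t :* (x :* y) :* (f :* (u :* v))) refl Θ p₂ PA p₁ PB f₁ ⟩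
      Θ * (p₁ * p₂) * (f₁ * (PA * PB))       ∎)
    where
    open ≡-Reasoning
    k = α ℕ.+ (α ℕ.+ d)
    s = k ℕ.+ 2 ℕ.* c
    t = α ℕ.+ d ℕ.+ c
    Θ  = block d c α
    Θ′ = block d c (suc α)
    p₁ = poch (fromℕ (suc (c ℕ.+ α))) (+ suc d)
    p₂ = poch (fromℕ (suc (suc (t ℕ.+ c)))) (+ α)
    p₃ = poch (fromℕ (suc α)) (+ suc d)
    p₄ = poch (fromℕ (suc (suc (α ℕ.+ d)))) (+ α)
    f₁ = factorial α
    f₂ = factorial (c ℕ.+ α)
    f₃ = factorial (suc t)
    f₄ = factorial (suc (t ℕ.+ c))
    f₅ = factorial (suc k)
    f₇ = factorial (suc (α ℕ.+ d))
    g₂ = inverse-factorial (c ℕ.+ α)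
    g₄ = inverse-factorial (suc (t ℕ.+ c))
    E  = eigenproduct s c * eigenproduct (suc s) c
    PA = product (λ y → fromℕ (suc (s ℕ.∸ y))) (range α c)
    PB = product (fromℕ ∘ suc) (range α c)
    h₁ : p₁ * f₂ ≡ f₃
    h₁ = trans (poch-factorial (c ℕ.+ α) (suc d)) (cong factorial (ℕR.solve 3 (λ a c d → c ℕR.:+ a ℕR.:+ (ℕR.con 1 ℕR.:+ d) ℕR.:= ℕR.con 1 ℕR.:+ (a ℕR.:+ d ℕR.:+ c)) refl α c d))
    h₂ : p₂ * f₄ ≡ factorial (suc s)
    h₂ = trans (poch-factorial (suc (t ℕ.+ c)) α) (cong factorial (ℕR.solve 3 (λ a c d → ℕR.con 1 ℕR.:+ (a ℕR.:+ d ℕR.:+ c ℕR.:+ c) ℕR.:+ a ℕR.:= ℕR.con 1 ℕR.:+ (a ℕR.:+ (a ℕR.:+ d) ℕR.:+ ℕR.con 2 ℕR.:* c)) refl α c d))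
    h₃ : p₃ * f₁ ≡ f₇
    h₃ = trans (poch-factorial α (suc d)) (cong factorial (ℕP.+-suc α d))
    h₄ : p₄ * f₇ ≡ f₅
    h₄ = trans (poch-factorial (suc (α ℕ.+ d)) α) (cong (factorial ∘ suc) (ℕP.+-comm (α ℕ.+ d) α))
    hA : PA * f₃ ≡ f₄
    hA = falling-product s α t c (ℕR.solve 3 (λ a c d → a ℕR.:+ (a ℕR.:+ d) ℕR.:+ ℕR.con 2 ℕR.:* c ℕR.:= a ℕR.:+ (a ℕR.:+ d ℕR.:+ c ℕR.:+ c)) refl α c d)
    hB : PB * f₁ ≡ f₂
    hB = trans (rising-product α c) (cong factorial (ℕP.+-comm α c))
    unit : f₁ * (PA * PB) * (f₃ * (g₂ * g₄)) ≡ 1ℚ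
    unit = begin
      f₁ * (PA * PB) * (f₃ * (g₂ * g₄))      ≡⟨ solve 6 (λ f u v x y z → f :* (u :* v) :* (x :* (y :* z)) := (v :* f :* y) :* (u :* x :* z)) refl f₁ PA PB f₃ g₂ g₄ ⟩
      (PB * f₁ * g₂) * (PA * f₃ * g₄)        ≡⟨ cong₂ (λ x y → x * g₂ * (y * g₄)) hB hA ⟩
      (f₂ * g₂) * (f₄ * g₄)                  ≡⟨ cong₂ _*_ (factorial-inverse (c ℕ.+ α)) (factorial-inverse (suc (t ℕ.+ c))) ⟩
      1ℚ                                     ∎
    shift : Θ′ * (PA * PB) ≡ Θ * E
    shift = begin
      Θ′ * (PA * PB)
        ≡⟨ cong₂ _*_ (cong₂ (λ k′ q → walks (suc c) k′ (0 ∷ q)) (cong suc (ℕP.+-suc α (α ℕ.+ d))) (sym (trans (cong (map suc) (map-suc-range α c)) (map-suc-range (suc α) c))))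
             (sym (product-* (λ y → fromℕ (suc (s ℕ.∸ y))) (fromℕ ∘ suc) (range α c))) ⟩
      walks (suc c) (2 ℕ.+ k) (0 ∷ map suc (map suc (range α c))) * product (λ y → fromℕ (suc (s ℕ.∸ y)) * fromℕ (suc y)) (range α c)
        ≡⟨ walks-shift c k (length-range α c) (All.map (λ y< → ℕP.≤-trans (ℕP.<⇒≤ y<) bound) (range-bounded α c ℕP.≤-refl)) ⟩
      walks (suc c) k (0 ∷ map suc (range α c)) * E
        ≡⟨ cong (λ q → walks (suc c) k (0 ∷ q) * E) (map-suc-range α c) ⟩
      Θ * E ∎
      where
      bound : α ℕ.+ c ℕ.≤ s
      bound = ℕP.+-mono-≤ (ℕP.m≤m+n α (α ℕ.+ d)) (ℕP.m≤m+n c (c ℕ.+ 0))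

  factor : ℕ → ℕ → ℕ → ℚ
  factor d c α = factor-numerator d c α * inv (factor-denominator d c α)

  block≡product : ∀ d c α → block d c α ≡ prodℕ α (factor d c)
  block≡product d c zero    = walks-range (suc c) d
  block≡product d c (suc α) = *-cancel-unit {u = Q} {v = inv Q} Q-unit (begin
      block d c (suc α) * Q                                     ≡⟨ block-step d c α ⟩
      block d c α * factor-numerator d c α                      ≡⟨ cong (_* factor-numerator d c α) (block≡product d c α) ⟩
      prodℕ α (factor d c) * factor-numerator d c α             ≡⟨ sym (ℚP.*-identityʳ _) ⟩
      prodℕ α (factor d c) * factor-numerator d c α * 1ℚ        ≡⟨ cong (prodℕ α (factor d c) * factor-numerator d c α *_) (sym Q-unit) ⟩
      prodℕ α (factor d c) * factor-numerator d c α * (Q * inv Q)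
        ≡⟨ solve 4 (λ p n q i → p :* n :* (q :* i) := p :* (n :* i) :* q) refl (prodℕ α (factor d c)) (factor-numerator d c α) Q (inv Q) ⟩
      prodℕ α (factor d c) * factor d c α * Q                   ∎)
    where
    open ≡-Reasoning
    Q = factor-denominator d c α
    Q-unit = factor-denominator-inverse d c α

  -- The linear factor and the final formula.

  2ℚ : ℚ
  2ℚ = 1ℚ + 1ℚ

  linear-factor : ℕ → ℕ → ℕ → ℚ
  linear-factor a b c = (fromℕ b + fromℕ b - fromℕ a + 2ℚ) * fromℕ c + (fromℕ b + 1ℚ) * (fromℕ b + 2ℚ)

  linear-factor-correct : ∀ a b c →
    fromℤ ((+ (2 ℕ.* b) ℤ.- + a ℤ.+ + 2) ℤ.* + c ℤ.+ + ((b ℕ.+ 1) ℕ.* (b ℕ.+ 2))) ≡ linear-factor a b c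
  linear-factor-correct a b c = begin
      fromℤ ((+ (2 ℕ.* b) ℤ.- + a ℤ.+ + 2) ℤ.* + c ℤ.+ + ((b ℕ.+ 1) ℕ.* (b ℕ.+ 2)))
        ≡⟨ fromℤ-+ ((+ (2 ℕ.* b) ℤ.- + a ℤ.+ + 2) ℤ.* + c) (+ ((b ℕ.+ 1) ℕ.* (b ℕ.+ 2))) ⟩
      fromℤ ((+ (2 ℕ.* b) ℤ.- + a ℤ.+ + 2) ℤ.* + c) + fromℕ ((b ℕ.+ 1) ℕ.* (b ℕ.+ 2))
        ≡⟨ cong₂ _+_ (fromℤ-* (+ (2 ℕ.* b) ℤ.- + a ℤ.+ + 2) (+ c)) (trans (fromℕ-* (b ℕ.+ 1) (b ℕ.+ 2)) (cong₂ _*_ (fromℕ-+ b 1) (fromℕ-+ b 2))) ⟩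
      fromℤ (+ (2 ℕ.* b) ℤ.- + a ℤ.+ + 2) * fromℕ c + (fromℕ b + 1ℚ) * (fromℕ b + 2ℚ)
        ≡⟨ cong (λ z → z * fromℕ c + (fromℕ b + 1ℚ) * (fromℕ b + 2ℚ)) (begin
             fromℤ (+ (2 ℕ.* b) ℤ.- + a ℤ.+ + 2)
               ≡⟨ fromℤ-+ (+ (2 ℕ.* b) ℤ.- + a) (+ 2) ⟩
             fromℤ (+ (2 ℕ.* b) ℤ.- + a) + 2ℚ
               ≡⟨ solve 2 (λ x y → x :+ con 2ℚ := x :+ y :- y :+ con 2ℚ) refl (fromℤ (+ (2 ℕ.* b) ℤ.- + a)) (fromℕ a) ⟩
             fromℤ (+ (2 ℕ.* b) ℤ.- + a) + fromℕ a - fromℕ a + 2ℚ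
               ≡⟨ cong (λ z → z - fromℕ a + 2ℚ) (trans (sym (fromℤ-+ (+ (2 ℕ.* b) ℤ.- + a) (+ a))) (cong fromℤ (cancel (+ (2 ℕ.* b)) (+ a)))) ⟩
             fromℕ (2 ℕ.* b) - fromℕ a + 2ℚ
               ≡⟨ cong (λ z → z - fromℕ a + 2ℚ) (trans (fromℕ-+ b (b ℕ.+ 0)) (cong (λ z → fromℕ b + fromℕ z) (ℕP.+-identityʳ b))) ⟩
             fromℕ b + fromℕ b - fromℕ a + 2ℚ ∎) ⟩
      linear-factor a b c ∎
    where
    open ≡-Reasoning
    cancel : ∀ x y → x ℤ.- y ℤ.+ y ≡ x
    cancel = ℤS.+-*-Solver.solve 2 (λ x y → x ℤS.+-*-Solver.:- y ℤS.+-*-Solver.:+ y ℤS.+-*-Solver.:= x) refl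

  -- By `walks-dent` both terms become multiples of the count with first position 0, with the common
  -- factor a + 1. The remaining difference (a + b + 2c + 2)(b + c + 2) - (a + c + 1)(b + 2c + 2)
  -- expands to the linear factor.
  dented-linear : ∀ a b c →
    dented b (suc c) (suc a) (range (2 ℕ.+ a) c) * (fromℕ (suc (c ℕ.+ a)) * fromℕ (2 ℕ.+ (b ℕ.+ c ℕ.+ c))) ≡
    walks (suc c) (suc a ℕ.+ suc b) (0 ∷ range (2 ℕ.+ a) c) * (fromℕ (suc a) * linear-factor a b c)
  dented-linear a b c = begin
      (W₁ - fromℕ (suc a) * W₀) * (fromℕ (suc (c ℕ.+ a)) * fromℕ (2 ℕ.+ (b ℕ.+ c ℕ.+ c)))
        ≡⟨ cong₂ (λ x y → (W₁ - fromℕ (suc a) * W₀) * (x * y)) (cong (fromℕ ∘ suc) (ℕP.+-comm c a)) A₁ ⟩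
      (W₁ - fromℕ (suc a) * W₀) * (fromℕ (suc a ℕ.+ c) * A (2 ℕ.+ a))
        ≡⟨ solve 5 (λ u v w x y → (u :- v :* w) :* (x :* y) := u :* (y :* x) :- v :* w :* (x :* y)) refl W₁ (fromℕ (suc a)) W₀ (fromℕ (suc a ℕ.+ c)) (A (2 ℕ.+ a)) ⟩
      W₁ * (A (2 ℕ.+ a) * fromℕ (suc a ℕ.+ c)) - fromℕ (suc a) * W₀ * (fromℕ (suc a ℕ.+ c) * A (2 ℕ.+ a))
        ≡⟨ cong (_- fromℕ (suc a) * W₀ * (fromℕ (suc a ℕ.+ c) * A (2 ℕ.+ a))) (walks-dent c (suc a ℕ.+ suc b) (suc a) le) ⟩
      (fromℕ s - 1ℚ - 1ℚ) * W₀ * (A (2 ℕ.+ a ℕ.+ c) * fromℕ (suc a)) - fromℕ (suc a) * W₀ * (fromℕ (suc a ℕ.+ c) * A (2 ℕ.+ a))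
        ≡⟨ solve 6 (λ σ w x y z t → σ :* w :* (x :* y) :- y :* w :* (z :* t) := w :* (y :* (σ :* x :- z :* t))) refl (fromℕ s - 1ℚ - 1ℚ) W₀ (A (2 ℕ.+ a ℕ.+ c)) (fromℕ (suc a)) (fromℕ (suc a ℕ.+ c)) (A (2 ℕ.+ a)) ⟩
      W₀ * (fromℕ (suc a) * ((fromℕ s - 1ℚ - 1ℚ) * A (2 ℕ.+ a ℕ.+ c) - fromℕ (suc a ℕ.+ c) * A (2 ℕ.+ a)))
        ≡⟨ cong (λ z → W₀ * (fromℕ (suc a) * z)) bracket ⟩
      W₀ * (fromℕ (suc a) * linear-factor a b c) ∎
    where
    open ≡-Reasoning
    s = 2 ℕ.+ (suc a ℕ.+ suc b ℕ.+ 2 ℕ.* c)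
    A : ℕ → ℚ
    A y = fromℕ s - fromℕ y
    W₀ = walks (suc c) (suc a ℕ.+ suc b) (0 ∷ range (2 ℕ.+ a) c)
    W₁ = walks (suc c) (suc a ℕ.+ suc b) (1 ∷ range (2 ℕ.+ a) c)
    le : 2 ℕ.+ a ℕ.+ c ℕ.≤ suc (suc a ℕ.+ suc b ℕ.+ 2 ℕ.* c)
    le = ℕP.≤-trans (ℕP.m≤m+n (2 ℕ.+ a ℕ.+ c) (suc b ℕ.+ c)) (ℕP.≤-reflexive (ℕR.solve 3 (λ a b c → ℕR.con 2 ℕR.:+ a ℕR.:+ c ℕR.:+ (ℕR.con 1 ℕR.:+ b ℕR.:+ c) ℕR.:= ℕR.con 1 ℕR.:+ (ℕR.con 1 ℕR.:+ a ℕR.:+ (ℕR.con 1 ℕR.:+ b) ℕR.:+ ℕR.con 2 ℕR.:* c)) refl a b c))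
    s-split : ∀ x y → x ℕ.+ y ≡ s → A y ≡ fromℕ x
    s-split x y eq = trans (cong (_- fromℕ y) (trans (cong fromℕ (sym eq)) (fromℕ-+ x y))) (solve 2 (λ x y → x :+ y :- y := x) refl (fromℕ x) (fromℕ y))
    A₁ : fromℕ (2 ℕ.+ (b ℕ.+ c ℕ.+ c)) ≡ A (2 ℕ.+ a)
    A₁ = sym (s-split (2 ℕ.+ (b ℕ.+ c ℕ.+ c)) (2 ℕ.+ a) (ℕR.solve 3 (λ a b c → ℕR.con 2 ℕR.:+ (b ℕR.:+ c ℕR.:+ c) ℕR.:+ (ℕR.con 2 ℕR.:+ a) ℕR.:= ℕR.con 2 ℕR.:+ (ℕR.con 1 ℕR.:+ a ℕR.:+ (ℕR.con 1 ℕR.:+ b) ℕR.:+ ℕR.con 2 ℕR.:* c)) refl a b c))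
    α = fromℕ a
    β = fromℕ b
    γ = fromℕ c
    e₁ : fromℕ s - 1ℚ - 1ℚ ≡ α + β + γ + γ + 2ℚ
    e₁ = begin
      fromℕ s - 1ℚ - 1ℚ                          ≡⟨ cong (λ z → fromℕ z - 1ℚ - 1ℚ) (ℕR.solve 3 (λ a b c → ℕR.con 2 ℕR.:+ (ℕR.con 1 ℕR.:+ a ℕR.:+ (ℕR.con 1 ℕR.:+ b) ℕR.:+ ℕR.con 2 ℕR.:* c) ℕR.:= a ℕR.:+ b ℕR.:+ c ℕR.:+ c ℕR.:+ ℕR.con 4) refl a b c) ⟩
      fromℕ (a ℕ.+ b ℕ.+ c ℕ.+ c ℕ.+ 4) - 1ℚ - 1ℚ ≡⟨ cong (λ z → z - 1ℚ - 1ℚ) (trans (fromℕ-+ (a ℕ.+ b ℕ.+ c ℕ.+ c) 4) (cong (_+ fromℕ 4) (trans (fromℕ-+ (a ℕ.+ b ℕ.+ c) c) (cong (_+ γ) (trans (fromℕ-+ (a ℕ.+ b) c) (cong (_+ γ) (fromℕ-+ a b))))))) ⟩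
      α + β + γ + γ + fromℕ 4 - 1ℚ - 1ℚ          ≡⟨ solve 3 (λ a b c → a :+ b :+ c :+ c :+ con (fromℕ 4) :- con 1ℚ :- con 1ℚ := a :+ b :+ c :+ c :+ con 2ℚ) refl α β γ ⟩
      α + β + γ + γ + 2ℚ                         ∎
    e₂ : A (2 ℕ.+ a ℕ.+ c) ≡ β + γ + 2ℚ
    e₂ = trans (s-split (b ℕ.+ c ℕ.+ 2) (2 ℕ.+ a ℕ.+ c) (ℕR.solve 3 (λ a b c → b ℕR.:+ c ℕR.:+ ℕR.con 2 ℕR.:+ (ℕR.con 2 ℕR.:+ a ℕR.:+ c) ℕR.:= ℕR.con 2 ℕR.:+ (ℕR.con 1 ℕR.:+ a ℕR.:+ (ℕR.con 1 ℕR.:+ b) ℕR.:+ ℕR.con 2 ℕR.:* c)) refl a b c))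
      (trans (fromℕ-+ (b ℕ.+ c) 2) (cong (_+ 2ℚ) (fromℕ-+ b c)))
    e₃ : fromℕ (suc a ℕ.+ c) ≡ 1ℚ + α + γ
    e₃ = trans (fromℕ-+ (suc a) c) (cong (_+ γ) (fromℕ-suc a))
    e₄ : A (2 ℕ.+ a) ≡ β + γ + γ + 2ℚ
    e₄ = trans (sym A₁) (trans (cong fromℕ (ℕP.+-comm 2 (b ℕ.+ c ℕ.+ c))) (trans (fromℕ-+ (b ℕ.+ c ℕ.+ c) 2) (cong (_+ 2ℚ) (trans (fromℕ-+ (b ℕ.+ c) c) (cong (_+ γ) (fromℕ-+ b c))))))
    bracket : (fromℕ s - 1ℚ - 1ℚ) * A (2 ℕ.+ a ℕ.+ c) - fromℕ (suc a ℕ.+ c) * A (2 ℕ.+ a) ≡ linear-factor a b c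
    bracket = trans (cong₂ _-_ (cong₂ _*_ e₁ e₂) (cong₂ _*_ e₃ e₄))
      (solve 3 (λ a b c → (a :+ b :+ c :+ c :+ con 2ℚ) :* (b :+ c :+ con 2ℚ) :- (con 1ℚ :+ a :+ c) :* (b :+ c :+ c :+ con 2ℚ)
                       := (b :+ b :- a :+ con 2ℚ) :* c :+ (b :+ con 1ℚ) :* (b :+ con 2ℚ)) refl α β γ)

  factor-correct : ∀ a d c j → let b = a ℕ.+ d ; i = suc j in
    (poch (fromℕ (c ℕ.+ i)) (+ b ℤ.- + a ℤ.+ + 1) * poch (fromℤ (+ (2 ℕ.* c ℕ.+ b ℕ.+ 1 ℕ.+ i) ℤ.- + a)) (+ i ℤ.- + 1))
      * inv (poch (fromℕ i) (+ b ℤ.- + a ℤ.+ + 1) * poch (fromℤ (+ (b ℕ.+ 1 ℕ.+ i) ℤ.- + a)) (+ i ℤ.- + 1))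
    ≡ factor d c j
  factor-correct a d c j = cong₂ (λ x y → x * inv y)
    (cong₂ _*_ (cong₂ poch (cong fromℕ (ℕP.+-suc c j)) exponent) (cong (λ x → poch (fromℤ x) (+ j)) base₁))
    (cong₂ _*_ (cong (poch (fromℕ (suc j))) exponent) (cong (λ x → poch (fromℤ x) (+ j)) base₂))
    where
    open ℤS.+-*-Solver renaming (solve to solveℤ; _:+_ to _⊕_; _:-_ to _⊖_; _:=_ to _≐_; con to κ)
    exponent : + (a ℕ.+ d) ℤ.- + a ℤ.+ + 1 ≡ + suc d
    exponent = solveℤ 2 (λ a d → a ⊕ d ⊖ a ⊕ κ (+ 1) ≐ κ (+ 1) ⊕ d) refl (+ a) (+ d)
    base₁ : + (2 ℕ.* c ℕ.+ (a ℕ.+ d) ℕ.+ 1 ℕ.+ suc j) ℤ.- + a ≡ + suc (suc (j ℕ.+ d ℕ.+ c ℕ.+ c))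
    base₁ = trans (cong (λ z → + z ℤ.- + a) (ℕR.solve 4 (λ a c d j → ℕR.con 2 ℕR.:* c ℕR.:+ (a ℕR.:+ d) ℕR.:+ ℕR.con 1 ℕR.:+ (ℕR.con 1 ℕR.:+ j) ℕR.:= ℕR.con 2 ℕR.:+ (j ℕR.:+ d ℕR.:+ c ℕR.:+ c) ℕR.:+ a) refl a c d j))
      (solveℤ 2 (λ x a → x ⊕ a ⊖ a ≐ x) refl (+ suc (suc (j ℕ.+ d ℕ.+ c ℕ.+ c))) (+ a))
    base₂ : + (a ℕ.+ d ℕ.+ 1 ℕ.+ suc j) ℤ.- + a ≡ + suc (suc (j ℕ.+ d))
    base₂ = trans (cong (λ z → + z ℤ.- + a) (ℕR.solve 3 (λ a d j → a ℕR.:+ d ℕR.:+ ℕR.con 1 ℕR.:+ (ℕR.con 1 ℕR.:+ j) ℕR.:= ℕR.con 2 ℕR.:+ (j ℕR.:+ d) ℕR.:+ a) refl a d j))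
      (solveℤ 2 (λ x a → x ⊕ a ⊖ a ≐ x) refl (+ suc (suc (j ℕ.+ d))) (+ a))

  module _ (a d c : ℕ) where
    private
      b = a ℕ.+ d
      pA = poch (fromℕ (2 ℕ.+ (c ℕ.+ a))) (+ d)
      pB = poch (fromℕ (3 ℕ.+ (b ℕ.+ c ℕ.+ c))) (+ a ℤ.- + 1)
      pC = poch (fromℕ (2 ℕ.+ a)) (+ suc d)
      pD = poch (fromℕ (3 ℕ.+ b)) (+ a ℤ.- + 1)
      Π  = prodℕ a (factor d c)

    -- The top block has `α = suc a`, one factor more than the product of the theorem, and this
    -- extra factor is the source of the prefactor. Its two symbols lose their first entries a + c +
    -- 1 and b + 2c + 2, the ones multiplied onto the count in `dented-linear`.
    numerator-split : factor-numerator d c a ≡ (fromℕ (suc (c ℕ.+ a)) * fromℕ (2 ℕ.+ (b ℕ.+ c ℕ.+ c))) * (pA * pB)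
    numerator-split = trans
      (cong₂ _*_ (sym (poch-head (c ℕ.+ a) (suc d))) (sym (poch-head (suc (b ℕ.+ c ℕ.+ c)) a)))
      (solve 4 (λ x p y q → (x :* p) :* (y :* q) := (x :* y) :* (p :* q)) refl (fromℕ (suc (c ℕ.+ a))) pA (fromℕ (2 ℕ.+ (b ℕ.+ c ℕ.+ c))) pB)

    -- The symbols exchange an entry: once a + 1 is put in front, the first one ends in b + 2, which
    -- becomes the head of the second.
    denominator-split : factor-denominator d c a ≡ (pC * pD) * fromℕ (suc a)
    denominator-split = sym (begin
        pC * pD * fromℕ (suc a)                                          ≡⟨ solve 3 (λ p q x → p :* q :* x := x :* p :* q) refl pC pD (fromℕ (suc a)) ⟩
        fromℕ (suc a) * pC * pD                                          ≡⟨ cong (_* pD) (poch-head a (2 ℕ.+ d)) ⟩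
        poch (fromℕ (suc a)) (+ suc d) * (fromℕ (suc a) + fromℕ (suc d)) * pD ≡⟨ cong (λ z → poch (fromℕ (suc a)) (+ suc d) * z * pD) (trans (sym (fromℕ-+ (suc a) (suc d))) (cong (fromℕ ∘ suc) (ℕP.+-suc a d))) ⟩
        poch (fromℕ (suc a)) (+ suc d) * fromℕ (2 ℕ.+ b) * pD            ≡⟨ ℚP.*-assoc (poch (fromℕ (suc a)) (+ suc d)) (fromℕ (2 ℕ.+ b)) pD ⟩
        poch (fromℕ (suc a)) (+ suc d) * (fromℕ (2 ℕ.+ b) * pD)          ≡⟨ cong (poch (fromℕ (suc a)) (+ suc d) *_) (poch-head (suc b) a) ⟩
        factor-denominator d c a                                         ∎)
      where open ≡-Reasoning

    inv-prefactor : inv (pC * pD) ≡ fromℕ (suc a) * inv (factor-denominator d c a)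
    inv-prefactor = inv-unique {pC * pD} {fromℕ (suc a) * inv Q} (trans (sym (ℚP.*-assoc (pC * pD) (fromℕ (suc a)) (inv Q)))
      (trans (cong (_* inv Q) (sym denominator-split)) (factor-denominator-inverse d c a)))
      where Q = factor-denominator d c a

    formula≡ : formula a b c ≡ pA * pB * linear-factor a b c * inv (pC * pD) * Π
    formula≡ = cong₂ _*_
      (cong₂ (λ x y → x * inv y)
        (cong₂ _*_ (cong₂ _*_ (cong₂ poch (cong fromℕ (ℕP.+-comm (c ℕ.+ a) 2)) difference)
                              (cong (λ z → poch (fromℕ z) (+ a ℤ.- + 1)) (ℕR.solve 2 (λ b c → ℕR.con 2 ℕR.:* c ℕR.:+ b ℕR.:+ ℕR.con 3 ℕR.:= ℕR.con 3 ℕR.:+ (b ℕR.:+ c ℕR.:+ c)) refl b c)))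
                   (linear-factor-correct a b c))
        (cong₂ _*_ (cong₂ poch (cong fromℕ (ℕP.+-comm a 2)) (trans (cong (ℤ._+ + 1) difference) (cong +_ (ℕP.+-comm d 1))))
                   (cong (λ z → poch (fromℕ z) (+ a ℤ.- + 1)) (ℕP.+-comm b 3))))
      (prodℕ-cong a (factor-correct a d c))
      where
      open ℤS.+-*-Solver renaming (solve to solveℤ; _:+_ to _⊕_; _:-_ to _⊖_; _:=_ to _≐_)
      difference : + b ℤ.- + a ≡ + d
      difference = solveℤ 2 (λ a d → a ⊕ d ⊖ a ≐ d) refl (+ a) (+ d)

    dented≡formula : dented b (suc c) (suc a) (range (2 ℕ.+ a) c) ≡ formula a b c
    dented≡formula = *-cancel-unit {u = X} {v = inv x₁ * inv x₂} X-unit (begin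
        dented b (suc c) (suc a) (range (2 ℕ.+ a) c) * X          ≡⟨ dented-linear a b c ⟩
        block d c (suc a) * (fromℕ (suc a) * L)                   ≡⟨ cong (_* (fromℕ (suc a) * L)) (block≡product d c (suc a)) ⟩
        Π * (factor-numerator d c a * inv Q) * (fromℕ (suc a) * L) ≡⟨ cong (λ z → Π * (z * inv Q) * (fromℕ (suc a) * L)) numerator-split ⟩
        Π * (X * (pA * pB) * inv Q) * (fromℕ (suc a) * L)
          ≡⟨ solve 7 (λ p x u v i n l → p :* (x :* (u :* v) :* i) :* (n :* l) := u :* v :* l :* (n :* i) :* p :* x) refl Π X pA pB (inv Q) (fromℕ (suc a)) L ⟩
        pA * pB * L * (fromℕ (suc a) * inv Q) * Π * X             ≡⟨ cong (λ z → pA * pB * L * z * Π * X) (sym inv-prefactor) ⟩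
        pA * pB * L * inv (pC * pD) * Π * X                       ≡⟨ cong (_* X) (sym formula≡) ⟩
        formula a b c * X                                         ∎)
      where
      open ≡-Reasoning
      x₁ = fromℕ (suc (c ℕ.+ a))
      x₂ = fromℕ (2 ℕ.+ (b ℕ.+ c ℕ.+ c))
      X = x₁ * x₂
      L = linear-factor a b c
      Q = factor-denominator d c a
      X-unit : X * (inv x₁ * inv x₂) ≡ 1ℚ
      X-unit = trans (solve 4 (λ a b c d → a :* b :* (c :* d) := (a :* c) :* (b :* d)) refl x₁ x₂ (inv x₁) (inv x₂))
        (cong₂ _*_ (inv-inverseʳ (fromℕ-suc≢0 (c ℕ.+ a))) (inv-inverseʳ (fromℕ-suc≢0 (suc (b ℕ.+ c ℕ.+ c)))))

open Evaluation

theorem2p1 : ((a b c : ℕ) → a ≤ b → fromℕ (M (S a b c)) ≡ formula a b c)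
    × ((b c : ℕ) → M (S (suc b) b c) ≡ M (S b b c))
theorem2p1 = tilings-formula , M-tight
  where
  tilings-formula : (a b c : ℕ) → a ≤ b → fromℕ (M (S a b c)) ≡ formula a b c
  tilings-formula a b c a≤b = trans (Phases.M≡dented a b c (ℕP.m≤n⇒m≤1+n a≤b))
    (subst (λ b → dented b (suc c) (suc a) (range (2 ℕ.+ a) c) ≡ formula a b c) (ℕP.m+[n∸m]≡n a≤b) (dented≡formula a (b ℕ.∸ a) c))
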